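{- Let $n>1$ be an odd integer. For integers $k\geq 0$ define $$c_q(k)=(-1)^k\frac{(1+q^{4k+1})(q^{2};q^{4})^2_k}{(1+q)(q^{4};q^{4})^2_k}q^{2k^2+k}.$$ Then, modulo $\Phi_n(-q)^3\Phi_n(q)^2$, $$\sum_{k=0}^{n-1}\sum_{j=0}^{k}c_q(j)c_q(k-j)\equiv [n]^2_{q^2}\,q^{(n-1)^2}\bigg(\sum_{k=0}^{\frac{n-1}{2}}\frac{(q^{2};q^{4})_k}{[4k+1](q^{4};q^{4})_k}q^{2k}\bigg)^2.$$
   Context: Here $q$ is an indeterminate. The $q$-shifted factorial is $(a;q)_0=1$, $(a;q)_m=(1-a)(1-aq)\cdots(1-aq^{m-1})$ for $m\geq1$, and $(a_1,\dots,a_s;q)_m=(a_1;q)_m\cdots(a_s;q)_m$. The $q$-integer is $[m]=[m]_q=1+q+\cdots+q^{m-1}$, and $[m]_{q^2}=1+q^2+\cdots+q^{2(m-1)}$. $\Phi_n(q)$ denotes the $n$-th cyclotomic polynomial in $q$. A congruence between rational functions in $q$ modulo a polynomial $P(q)$ means that the numerator of the difference (in reduced form) is divisible by $P(q)$ while its denominator is coprime to $P(q)$. -}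

module Defs where

open import Data.Nat as ℕ using (ℕ; zero; suc; _∸_; _<ᵇ_)
open import Data.Nat.Divisibility using (_∣?_)
open import Data.Bool using (Bool; true; false; if_then_else_; not)
open import Data.List using (List; []; _∷_; _++_; map; replicate; reverse; length; foldr; last)
open import Data.List.Relation.Unary.All using (All)
open import Data.Maybe using (just; nothing)
open import Data.Product using (Σ; _×_; ∃)
open import Relation.Nullary.Decidable using (does)
open import Relation.Binary.PropositionalEquality using (_≡_)
open import Data.Rational as Q using (ℚ; 0ℚ; 1ℚ)

-- Polynomials in q with rational coefficients:
-- a list [a₀, a₁, …] stands for a₀ + a₁ q + a₂ q² + …
-- (trailing zeros allowed; equality is the semantic one, _≈P_).

Poly : Set
Poly = List ℚ

infixl 6 _⊕_ _⊖_
infixl 7 _⊛_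
infix 4 _≈P_ _∣P_

_⊕_ : Poly → Poly → Poly
[] ⊕ q = q
(a ∷ p) ⊕ [] = a ∷ p
(a ∷ p) ⊕ (b ∷ q) = (a Q.+ b) ∷ (p ⊕ q)

scale : ℚ → Poly → Poly
scale c p = map (c Q.*_) p

negP : Poly → Poly
negP p = map Q.-_ p

_⊖_ : Poly → Poly → Poly
p ⊖ q = p ⊕ negP q

_⊛_ : Poly → Poly → Poly
[] ⊛ q = []
(a ∷ p) ⊛ q = scale a q ⊕ (0ℚ ∷ (p ⊛ q))

constP : ℚ → Poly
constP c = c ∷ []

oneP : Poly
oneP = constP 1ℚ

X^ : ℕ → Poly
X^ k = replicate k 0ℚ ++ (1ℚ ∷ [])

_^P_ : Poly → ℕ → Poly
p ^P zero = oneP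
p ^P suc k = p ⊛ (p ^P k)

substNeg : Poly → Poly
substNeg = go true
  where
  go : Bool → Poly → Poly
  go b [] = []
  go true (a ∷ p) = a ∷ go false p
  go false (a ∷ p) = Q.- a ∷ go true p

IsZeroP : Poly → Set
IsZeroP p = All (_≡ 0ℚ) p

_≈P_ : Poly → Poly → Set
p ≈P q = IsZeroP (p ⊖ q)

_∣P_ : Poly → Poly → Set
d ∣P p = Σ Poly λ r → (r ⊛ d) ≈P p

CoprimeP : Poly → Poly → Set
CoprimeP a b = Σ Poly λ s → Σ Poly λ t → (s ⊛ a ⊕ t ⊛ b) ≈P oneP

private
  dropZerosFront : List ℚ → List ℚ
  dropZerosFront [] = []
  dropZerosFront (a ∷ l) = if does (a Q.≟ 0ℚ) then dropZerosFront l else a ∷ l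

  subFront : List ℚ → List ℚ → List ℚ
  subFront xs [] = xs
  subFront [] ys = []
  subFront (x ∷ xs) (y ∷ ys) = (x Q.- y) ∷ subFront xs ys

  -- rp: dividend, highest coefficient first; ds: tail of the (monic, highest
  -- first) divisor.  Returns the quotient, highest coefficient first.
  rdiv : ℕ → List ℚ → List ℚ → List ℚ
  rdiv zero ds rp = []
  rdiv (suc f) ds [] = []
  rdiv (suc f) ds (c ∷ rest) =
    if length rest <ᵇ length ds then []
    else c ∷ rdiv f ds (subFront rest (scale c ds))

monicQuot : Poly → Poly → Poly
monicQuot p d with dropZerosFront (reverse d)
... | [] = []
... | (_ ∷ ds) = reverse (rdiv (length p) ds (dropZerosFront (reverse p)))

-- Cyclotomic polynomials, via  q^n - 1 = ∏_{d ∣ n} Φ_d(q).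

private
  prodDivs : ℕ → ℕ → List Poly → Poly
  prodDivs n i [] = oneP
  prodDivs n i (p ∷ ps) =
    (if does (i ∣? n) then p else oneP) ⊛ prodDivs n (suc i) ps

cycs : ℕ → List Poly
cycs zero = []
cycs (suc m) =
  cycs m ++ (monicQuot (X^ (suc m) ⊖ oneP) (prodDivs (suc m) 1 (cycs m)) ∷ [])

-- Φ n = Φ_n(q)  (Φ 0 is set to 1; never used)
Φ : ℕ → Poly
Φ n with last (cycs n)
... | just p = p
... | nothing = oneP

record RatFun : Set where
  constructor _//_
  field
    num : Poly
    den : Poly
open RatFun public

infixl 6 _⊞_
infixl 7 _⊠_

_⊞_ : RatFun → RatFun → RatFun
(a // b) ⊞ (c // d) = (a ⊛ d ⊕ c ⊛ b) // (b ⊛ d)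

_⊠_ : RatFun → RatFun → RatFun
(a // b) ⊠ (c // d) = (a ⊛ c) // (b ⊛ d)

polyR : Poly → RatFun
polyR p = p // oneP

zeroR : RatFun
zeroR = [] // oneP

sumR : ℕ → (ℕ → RatFun) → RatFun
sumR zero f = zeroR
sumR (suc n) f = sumR n f ⊞ f n

-- A ≡ B (mod P): the difference A - B, written in reduced form U/V, has
-- P ∣ U and V coprime to P.  Equivalently (stated without computing gcds):
-- A - B = U/V for some U, V with P ∣ U and gcd(V, P) = 1.
CongMod : RatFun → RatFun → Poly → Set
CongMod (a // b) (c // d) P =
  Σ Poly λ U → Σ Poly λ V →
    (P ∣P U) × CoprimeP V P × ((a ⊛ d ⊖ c ⊛ b) ⊛ V ≈P U ⊛ (b ⊛ d))

qpoch : ℕ → ℕ → ℕ → Poly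
qpoch e s zero = oneP
qpoch e s (suc k) = qpoch e s k ⊛ (oneP ⊖ X^ (e ℕ.+ s ℕ.* k))

qint : ℕ → ℕ → Poly
qint r zero = []
qint r (suc m) = qint r m ⊕ X^ (r ℕ.* m)

signP : ℕ → Poly
signP zero = oneP
signP (suc k) = negP (signP k)

cq : ℕ → RatFun
cq k =
  (signP k ⊛ (oneP ⊕ X^ (4 ℕ.* k ℕ.+ 1)) ⊛ (qpoch 2 4 k ^P 2)
     ⊛ X^ (2 ℕ.* k ℕ.* k ℕ.+ k))
  // ((oneP ⊕ X^ 1) ⊛ (qpoch 4 4 k ^P 2))

lhs : ℕ → RatFun
lhs n = sumR n (λ k → sumR (suc k) (λ j → cq j ⊠ cq (k ∸ j)))

innerSum : ℕ → RatFun
innerSum n = sumR (suc (ℕ._/_ (n ∸ 1) 2))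
  (λ k → (qpoch 2 4 k ⊛ X^ (2 ℕ.* k)) // (qint 1 (4 ℕ.* k ℕ.+ 1) ⊛ qpoch 4 4 k))

rhs : ℕ → RatFun
rhs n = polyR ((qint 2 n ^P 2) ⊛ X^ ((n ∸ 1) ℕ.* (n ∸ 1))) ⊠ innerSum n ⊠ innerSum n

modulus : ℕ → Poly
modulus n = (substNeg (Φ n) ^P 3) ⊛ (Φ n ^P 2)

{-# OPTIONS --safe #-}
module Submission where

-- Put n = 2h + 1, p = q⁴ and u = q^(2n).  A terminating case of Watson's 8φ7
-- transformation identifies a u-deformation of S = ∑_{k ≤ h} c_q(k) with a u-deformation
-- of the sum on the right-hand side: both satisfy the same first-order inhomogeneous
-- recurrence in h, by telescoping.  Since y (1 - u/y) (1 - u y) = -u (1 - y)² + y (1 - u)²,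
-- removing the deformation changes both sides by multiples of (1 - u)² only, so that
-- S ≡ R modulo (1 - u)², where R² is the right-hand side.
--
-- For k > h the summand c_q(k) is divisible by (1 - u)², hence the double sum is S² plus
-- (1 - u)² times 2 ∑_{i > h} c~(i) ∑_{j ≤ 2h - i} c_q(j), where c~ = c_q / (1 - u)².
-- As Φ_n(q) Φ_n(-q) divides 1 - u, this gives the congruence modulo Φ_n(q)² Φ_n(-q)².
-- Modulo Φ_n(-q) we have q^n ≡ -1, and the reflections k ↦ h - k for k ≤ h and
-- k ↦ 3h + 1 - k for k > h change the sign of c_q and c~.  Therefore S and R vanish
-- modulo Φ_n(-q) and the mixed terms cancel in pairs, which gains the third factor.

-- The deformation has no free parameter: it is tied to h by u = q^(4h+2). On the antidiagonal m + k
-- = h, up to units, (q²;q⁴)_k² becomes `f (h+k) / f (h-k)` and 1/(q⁴;q⁴)_k² becomes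
-- `(1-u) g (h-k) / g (h+k+1)`. Raising k by one adds the two factors 1 - u/y and 1 - u y, with y =
-- q^(4k+2) for f and y = q^(4k+4) for g. Hence the error is a multiple of (1 - u)², and hence too a
-- recurrence in h is available. The obstacle is the denominators. `1/g (h+k+1)` has a pole along 1
-- - u, and 1/(1 - q^(4k+1)) has one along Φ_n(q) when 4k + 1 = n. Multiplication by 1 - u clears
-- both, so identities are proved in a ring of fractions `K`, with a predicate `O` that says which
-- elements lie in the local ring at the modulus P. The second pole is what separates the two
-- moduli: at Φ_n(-q) it is absent, and R is there a multiple of 1 - u. The facts about P behind all
-- local inverses are P ∣ q^(2n) - 1 and the coprimality of P to q^(2j) - 1 for n not dividing j.

open import Defs
open import Algebra.Bundles using (CommutativeRing)
import Algebra.Properties.CommutativeSemiring.Exp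
import Algebra.Properties.Ring
import Algebra.Properties.Semiring.Exp
import Algebra.Properties.Semiring.Mult.TCOptimised
import Algebra.Solver.Ring
open import Algebra.Solver.Ring.AlmostCommutativeRing using (fromCommutativeRing; _-Raw-AlmostCommutative⟶_)
open import Data.Bool using (Bool; true; false; if_then_else_)
open import Data.Empty using (⊥-elim)
open import Data.Integer as ℤ using (ℤ; +_; -[1+_])
import Data.Integer.Properties as ℤₚ
open import Data.List as List using (List; []; _∷_; _++_; length; reverse)
import Data.List.Properties as Listₚ
open import Data.List.Relation.Unary.All using (All; []; _∷_)
import Data.List.Relation.Unary.All.Properties as Allₚ
open import Data.Maybe using (Maybe; just; nothing)
open import Data.Nat as ℕ using (ℕ; zero; suc; _<_; _%_)
import Data.Nat.Coprimality as ℕCoprimality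
open import Data.Nat.Divisibility using (_∣_; _∣?_; divides)
import Data.Nat.Divisibility as Div
import Data.Nat.DivMod as DivMod
import Data.Nat.GCD as GCD
import Data.Nat.Properties as ℕₚ
open import Data.Nat.Solver using (module +-*-Solver)
open +-*-Solver using () renaming (solve to solveℕ; _:+_ to _+ₙ_; _:*_ to _*ₙ_; _:=_ to _=ₙ_; con to conₙ)
open import Data.Product using (Σ; _×_; _,_; proj₁; proj₂)
open import Data.Rational as ℚ using (ℚ; 0ℚ; 1ℚ)
import Data.Rational.Properties as ℚₚ
open import Data.Sum using (inj₁; inj₂)
open import Level using (Level)
import Relation.Binary.Reasoning.Setoid
open import Relation.Binary.PropositionalEquality as ≡ using (_≡_)
open import Relation.Nullary using (¬_; yes; no)
open import Relation.Nullary.Decidable using (does)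

-- A ring solver whose coefficients are the integers, so that cancellation is
-- decided even though equality in the ring itself is not.

module IntegerSolver {c ℓ : Level} (R : CommutativeRing c ℓ) where
  open CommutativeRing R
  open Algebra.Properties.Ring ring using (-‿distribˡ-*; -0#≈0#; -‿+-comm; -‿involutive)
  open Algebra.Properties.Semiring.Mult.TCOptimised semiring
    using (1+×; ×-homo-+) renaming (_×_ to _·_)
  open Relation.Binary.Reasoning.Setoid setoid

  private
    ι : ℤ → Carrier
    ι (+ n)      = n · 1#
    ι (-[1+ n ]) = - (suc n · 1#)

    cancel₁ : ∀ a x y → (a + x) - (a + y) ≈ x - y
    cancel₁ a x y = begin
      (a + x) + - (a + y)      ≈⟨ +-cong (+-comm a x) (sym (-‿+-comm a y)) ⟩
      (x + a) + (- a + - y)    ≈⟨ +-assoc x a _ ⟩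
      x + (a + (- a + - y))    ≈⟨ +-congˡ (sym (+-assoc a (- a) _)) ⟩
      x + ((a - a) + - y)      ≈⟨ +-congˡ (+-congʳ (-‿inverseʳ a)) ⟩
      x + (0# + - y)           ≈⟨ +-congˡ (+-identityˡ _) ⟩
      x - y                    ∎

    ι-⊖ : ∀ m n → ι (m ℤ.⊖ n) ≈ m · 1# - n · 1#
    ι-⊖ m zero rewrite ℤₚ.⊖-≥ {m} {0} ℕ.z≤n = begin
      m · 1#       ≈⟨ +-identityʳ _ ⟨
      m · 1# + 0#  ≈⟨ +-congˡ -0#≈0# ⟨
      m · 1# - 0#  ∎
    ι-⊖ zero (suc n) = sym (+-identityˡ _)
    ι-⊖ (suc m) (suc n) rewrite ℤₚ.[1+m]⊖[1+n]≡m⊖n m n =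
      trans (ι-⊖ m n) (sym (trans (+-cong (1+× m 1#) (-‿cong (1+× n 1#)))
                                  (cancel₁ 1# (m · 1#) (n · 1#))))

    ι-+ : ∀ i j → ι (i ℤ.+ j) ≈ ι i + ι j
    ι-+ (+ m) (+ n) = ×-homo-+ 1# m n
    ι-+ (+ m) (-[1+ n ]) = ι-⊖ m (suc n)
    ι-+ (-[1+ m ]) (+ n) = trans (ι-⊖ n (suc m)) (+-comm _ _)
    ι-+ (-[1+ m ]) (-[1+ n ]) = begin
      - (suc (suc (m ℕ.+ n)) · 1#)       ≡⟨ ≡.cong (λ k → - (k · 1#)) (≡.sym (ℕₚ.+-suc (suc m) n)) ⟩
      - ((suc m ℕ.+ suc n) · 1#)         ≈⟨ -‿cong (×-homo-+ 1# (suc m) (suc n)) ⟩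
      - (suc m · 1# + suc n · 1#)        ≈⟨ -‿+-comm _ _ ⟨
      - (suc m · 1#) + - (suc n · 1#)    ∎

    ι-neg : ∀ i → ι (ℤ.- i) ≈ - ι i
    ι-neg (+ zero)    = sym -0#≈0#
    ι-neg (+ (suc n)) = refl
    ι-neg (-[1+ n ])  = sym (-‿involutive _)

    ι-*⁺ : ∀ m j → ι (+ m ℤ.* j) ≈ ι (+ m) * ι j
    ι-*⁺ zero j = trans (reflexive (≡.cong ι (ℤₚ.*-zeroˡ j))) (sym (zeroˡ _))
    ι-*⁺ (suc m) j = begin
      ι (+ suc m ℤ.* j)             ≡⟨ ≡.cong ι (ℤₚ.suc-* (+ m) j) ⟩
      ι (j ℤ.+ + m ℤ.* j)           ≈⟨ ι-+ j _ ⟩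
      ι j + ι (+ m ℤ.* j)           ≈⟨ +-cong (sym (*-identityˡ _)) (ι-*⁺ m j) ⟩
      1# * ι j + ι (+ m) * ι j      ≈⟨ distribʳ _ _ _ ⟨
      (1# + m · 1#) * ι j           ≈⟨ *-congʳ (1+× m 1#) ⟨
      ι (+ suc m) * ι j             ∎

    ι-* : ∀ i j → ι (i ℤ.* j) ≈ ι i * ι j
    ι-* (+ m) j = ι-*⁺ m j
    ι-* (-[1+ m ]) j = begin
      ι (-[1+ m ] ℤ.* j)          ≡⟨ ≡.cong ι (ℤₚ.neg-distribˡ-* (+ suc m) j) ⟨
      ι (ℤ.- (+ suc m ℤ.* j))     ≈⟨ ι-neg (+ suc m ℤ.* j) ⟩
      - ι (+ suc m ℤ.* j)         ≈⟨ -‿cong (ι-*⁺ (suc m) j) ⟩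
      - (ι (+ suc m) * ι j)       ≈⟨ -‿distribˡ-* _ _ ⟩
      ι (-[1+ m ]) * ι j          ∎

    ℤ⟶R : ℤ.+-*-rawRing -Raw-AlmostCommutative⟶ fromCommutativeRing R
    ℤ⟶R = record
      { ⟦_⟧ = ι ; +-homo = ι-+ ; *-homo = ι-* ; -‿homo = ι-neg
      ; 0-homo = refl ; 1-homo = refl }

    ι-≟ : ∀ i j → Maybe (ι i ≈ ι j)
    ι-≟ i j with i ℤ.≟ j
    ... | yes i≡j = just (reflexive (≡.cong ι i≡j))
    ... | no  _   = nothing

  open Algebra.Solver.Ring ℤ.+-*-rawRing (fromCommutativeRing R) ℤ⟶R ι-≟ public
    using (solve; Polynomial; con; _:+_; _:*_; _:-_; :-_; _:^_; _:=_)

  :1 : ∀ {n} → Polynomial n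
  :1 = con (+ 1)

-- Sums over antidiagonals and telescoping.

module FiniteSums {c ℓ : Level} (R : CommutativeRing c ℓ) where
  open CommutativeRing R hiding (zero)
  open IntegerSolver R
  open Relation.Binary.Reasoning.Setoid setoid

  -- diag T M is the sum of T m k over m + k = M.
  diag : (ℕ → ℕ → Carrier) → ℕ → Carrier
  diag T zero    = T 0 0
  diag T (suc M) = T (suc M) 0 + diag (λ m k → T m (suc k)) M

  diag-cong : ∀ {T T′} M → (∀ m k → m ℕ.+ k ≡ M → T m k ≈ T′ m k) → diag T M ≈ diag T′ M
  diag-cong zero    T≈T′ = T≈T′ 0 0 ≡.refl
  diag-cong (suc M) T≈T′ = +-cong (T≈T′ (suc M) 0 (ℕₚ.+-identityʳ _))
    (diag-cong M λ m k m+k≡M → T≈T′ m (suc k) (≡.trans (ℕₚ.+-suc m k) (≡.cong suc m+k≡M)))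

  diag-linear : ∀ a b T T′ M →
    diag (λ m k → a * T m k + b * T′ m k) M ≈ a * diag T M + b * diag T′ M
  diag-linear a b T T′ zero    = refl
  diag-linear a b T T′ (suc M) = trans (+-congˡ (diag-linear a b _ _ M))
    (solve 6 (λ a b x y z w → (a :* x :+ b :* y) :+ (a :* z :+ b :* w)
       := a :* (x :+ z) :+ b :* (y :+ w)) refl a b _ _ _ _)

  diag-scale : ∀ a T M → diag (λ m k → a * T m k) M ≈ a * diag T M
  diag-scale a T zero    = refl
  diag-scale a T (suc M) = trans (+-congˡ (diag-scale a _ M)) (sym (distribˡ _ _ _))

  diag-last : ∀ T M → diag T (suc M) ≈ diag (λ m k → T (suc m) k) M + T 0 (suc M)
  diag-last T zero    = refl
  diag-last T (suc M) = trans (+-congˡ (diag-last (λ m k → T m (suc k)) M)) (sym (+-assoc _ _ _))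

  -- The arguments (m, k + 1) and (m + 1, k) are neighbours on the antidiagonal of `suc M`, so
  -- consecutive terms share a value of Γ and only the two ends survive.
  diag-telescope : ∀ {T} (Γ : ℕ → ℕ → Carrier) M →
    (∀ m k → m ℕ.+ k ≡ M → T m k ≈ Γ m (suc k) - Γ (suc m) k) →
    diag T M ≈ Γ 0 (suc M) - Γ (suc M) 0
  diag-telescope Γ zero    step = step 0 0 ≡.refl
  diag-telescope {T} Γ (suc M) step = begin
    T (suc M) 0 + diag (λ m k → T m (suc k)) M
      ≈⟨ +-cong (step (suc M) 0 (ℕₚ.+-identityʳ _))
           (diag-telescope (λ m k → Γ m (suc k)) M
             λ m k m+k≡M → step m (suc k) (≡.trans (ℕₚ.+-suc m k) (≡.cong suc m+k≡M))) ⟩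
    (Γ (suc M) 1 - Γ (suc (suc M)) 0) + (Γ 0 (suc (suc M)) - Γ (suc M) 1)
      ≈⟨ solve 3 (λ x y z → (x :- y) :+ (z :- x) := z :- y) refl _ _ _ ⟩
    Γ 0 (suc (suc M)) - Γ (suc (suc M)) 0 ∎

-- Powers and shifted factorials in base q⁴.

-- Two explicit successors, unlike `k + k`, let `f (m + dbl (suc k))` unfold into two factors after
-- rewriting with `+-suc`.
dbl : ℕ → ℕ
dbl zero    = zero
dbl (suc k) = suc (suc (dbl k))

module QPowers {c ℓ : Level} (R : CommutativeRing c ℓ) (q : CommutativeRing.Carrier R) where
  open CommutativeRing R hiding (zero)
  open IntegerSolver R

  s p : Carrier
  s = q * q
  p = s * s

  X : ℕ → Carrier
  X zero    = 1#
  X (suc k) = p * X k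

  -- As `X k` is q^(4k), these are (q⁴;q⁴)_k and (q²;q⁴)_k.
  f g : ℕ → Carrier
  f zero    = 1#
  f (suc k) = f k * (1# - X (suc k))
  g zero    = 1#
  g (suc k) = g k * (1# - s * X k)

  -- e k = (-1)^k q^(2k²-k) and d m = (-1)^m q^(2m²).
  e d : ℕ → Carrier
  e zero    = 1#
  e (suc k) = - (q * X k) * e k
  d zero    = 1#
  d (suc m) = - (s * X m) * d m

  X-+ : ∀ m k → X (m ℕ.+ k) ≈ X m * X k
  X-+ zero    k = sym (*-identityˡ _)
  X-+ (suc m) k = trans (*-congˡ (X-+ m k)) (sym (*-assoc _ _ _))

  X-dbl : ∀ k → X (dbl k) ≈ X k * X k
  X-dbl zero    = sym (*-identityˡ _)
  X-dbl (suc k) = trans (*-congˡ (*-congˡ (X-dbl k)))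
    (solve 2 (λ p x → p :* (p :* (x :* x)) := (p :* x) :* (p :* x)) refl p (X k))

  X-J : ∀ m k → X (m ℕ.+ dbl k) ≈ X m * (X k * X k)
  X-J m k = trans (X-+ m (dbl k)) (*-congˡ (X-dbl k))

-- Inverses of `f k`, `g k` and 1 - q^(4k+1), given as data, so that the identity below can be
-- proved in any commutative ring that has them.
record QInverses {c ℓ : Level} (R : CommutativeRing c ℓ) (q : CommutativeRing.Carrier R) : Set (c Level.⊔ ℓ) where
  open CommutativeRing R
  open QPowers R q
  field
    fi gi ci : ℕ → Carrier
    f*fi : ∀ k → f k * fi k ≈ 1#
    g*gi : ∀ k → g k * gi k ≈ 1#
    c*ci : ∀ k → (1# - q * X k) * ci k ≈ 1#

-- The terminating identity, by a common first-order recurrence.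

module WatsonIdentity {c ℓ : Level} (R : CommutativeRing c ℓ) (q : CommutativeRing.Carrier R)
                      (inverses : QInverses R q) where
  open CommutativeRing R hiding (zero)
  open IntegerSolver R
  open FiniteSums R
  open QPowers R q
  open QInverses inverses
  open Relation.Binary.Reasoning.Setoid setoid

  private
    1-cong : ∀ {x y} → x ≈ y → 1# - x ≈ 1# - y
    1-cong x≈y = +-congˡ (-‿cong x≈y)

    inverse-step : ∀ {a b x a′} → a * b ≈ 1# → (a * x) * a′ ≈ 1# → b ≈ a′ * x
    inverse-step {a} {b} {x} {a′} ab≈1 axa′≈1 = begin
      b                    ≈⟨ *-identityʳ b ⟨
      b * 1#               ≈⟨ *-congˡ axa′≈1 ⟨
      b * ((a * x) * a′)   ≈⟨ solve 4 (λ a b x a′ → b :* ((a :* x) :* a′) := (a :* b) :* (a′ :* x)) refl a b x a′ ⟩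
      (a * b) * (a′ * x)   ≈⟨ *-congʳ ab≈1 ⟩
      1# * (a′ * x)        ≈⟨ *-identityˡ _ ⟩
      a′ * x               ∎

  -- Inverses are always rewritten towards the larger index. The two sides of an identity then share
  -- the same opaque inverses, and the ring solver can finish without division.
  fi-suc : ∀ m → fi m ≈ fi (suc m) * (1# - p * X m)
  fi-suc m = inverse-step (f*fi m) (f*fi (suc m))

  gi-suc : ∀ m → gi m ≈ gi (suc m) * (1# - s * X m)
  gi-suc m = inverse-step (g*gi m) (g*gi (suc m))

  fi-0 : fi 0 ≈ 1#
  fi-0 = trans (sym (*-identityˡ _)) (f*fi 0)

  gi-0 : gi 0 ≈ 1#
  gi-0 = trans (sym (*-identityˡ _)) (g*gi 0)

  -- With N = m + k, `t` and `v` are the deformed summands of S and of R; both contain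
  -- `f (N+k) / f (N-k)`. The summand `u` (here not q^(2n)) is auxiliary: the recurrence of `v`
  -- reduces to its sum, which has a closed form. The predecessor never truncates, as `u` is only
  -- summed with N at least 1.
  t v u : ℕ → ℕ → Carrier
  t m k = e k * (1# + q * X k) * f (m ℕ.+ dbl k) * g m * fi m * gi (suc (m ℕ.+ dbl k))
  v m k = d m * f (m ℕ.+ dbl k) * fi m * (fi k * gi k) * ci k
  u m k = d m * f (ℕ.pred (m ℕ.+ dbl k)) * fi m * (fi k * gi k)

  -- For y = X M, the coefficients of the recurrence a y Z (M + 1) + b y Z M ≈ 1 + p y
  -- shared by both sums.
  a b : Carrier → Carrier
  a y = 1# - q * (p * y)
  b y = s * y * (q - p * y)

  a-cong : ∀ {x y} → x ≈ y → a x ≈ a y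
  a-cong x≈y = 1-cong (*-congˡ (*-congˡ x≈y))

  b-cong : ∀ {x y} → x ≈ y → b x ≈ b y
  b-cong x≈y = *-cong (*-congˡ x≈y) (+-congˡ (-‿cong (*-congˡ x≈y)))

  -- A creative-telescoping certificate: `t m k` stripped of 1 + q X k and of the last factors of f
  -- and 1/g, times a factor that depends on m + k alone.
  Γ : ℕ → ℕ → Carrier
  Γ m k = - (1# - (X m * X k) * (X m * X k)) * (e k * f (ℕ.pred (m ℕ.+ dbl k)) * g m * fi m * gi (m ℕ.+ dbl k))

  -- The coefficients are taken at `X m * X k` instead of `X M`, which makes this a polynomial
  -- identity in independent q, X m and X k; `recurrence` puts M = m + k back.
  t-telescopes : ∀ m k → a (X m * X k) * t (suc m) k + b (X m * X k) * t m k ≈ Γ m (suc k) - Γ (suc m) k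
  t-telescopes m k rewrite ℕₚ.+-suc m (suc (dbl k)) | ℕₚ.+-suc m (dbl k) = begin
    a (A * x) * (E * (1# + q * x) * (F * (1# - p * XJ)) * (G * (1# - s * A)) * fi′ * gi″)
      + b (A * x) * (E * (1# + q * x) * F * G * fi m * gi (suc J))
      ≈⟨ +-cong (*-congˡ (*-congʳ (*-congʳ (*-congʳ (*-congˡ (*-congˡ (1-cong (*-congˡ XJ≈))))))))
                (*-congˡ (*-cong (*-congˡ (fi-suc m)) gi′≈)) ⟩
    a (A * x) * (E * (1# + q * x) * (F * (1# - p * (A * (x * x)))) * (G * (1# - s * A)) * fi′ * gi″)
      + b (A * x) * (E * (1# + q * x) * F * G * (fi′ * (1# - p * A)) * (gi″ * (1# - s * (p * (A * (x * x))))))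
      ≈⟨ solve 8 (λ q A x E F G fi′ gi″ → let s = q :* q ; p = s :* s ; y = A :* x ; z = A :* (x :* x) in
           (:1 :- q :* (p :* y)) :* (E :* (:1 :+ q :* x) :* (F :* (:1 :- p :* z)) :* (G :* (:1 :- s :* A)) :* fi′ :* gi″)
           :+ s :* y :* (q :- p :* y) :* (E :* (:1 :+ q :* x) :* F :* G :* (fi′ :* (:1 :- p :* A)) :* (gi″ :* (:1 :- s :* (p :* z))))
           := (:- (:1 :- (A :* (p :* x)) :* (A :* (p :* x)))) :*
                ((:- (q :* x) :* E) :* (F :* (:1 :- p :* z)) :* G :* (fi′ :* (:1 :- p :* A)) :* gi″)
              :- (:- (:1 :- ((p :* A) :* x) :* ((p :* A) :* x))) :*
                (E :* F :* (G :* (:1 :- s :* A)) :* fi′ :* (gi″ :* (:1 :- s :* (p :* z)))))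
         refl q A x E F G fi′ gi″ ⟩
    - (1# - (A * (p * x)) * (A * (p * x))) *
        ((- (q * x) * E) * (F * (1# - p * (A * (x * x)))) * G * (fi′ * (1# - p * A)) * gi″)
      - (- (1# - ((p * A) * x) * ((p * A) * x)) *
        (E * F * (G * (1# - s * A)) * fi′ * (gi″ * (1# - s * (p * (A * (x * x)))))))
      ≈⟨ +-cong (*-congˡ (*-congʳ (*-cong (*-congʳ (*-congˡ (*-congˡ (1-cong (*-congˡ XJ≈))))) (fi-suc m))))
                (-‿cong (*-congˡ (*-congˡ gi′≈))) ⟨
    - (1# - (A * (p * x)) * (A * (p * x))) *
        ((- (q * x) * E) * (F * (1# - p * XJ)) * G * fi m * gi″)
      - (- (1# - ((p * A) * x) * ((p * A) * x)) *
        (E * F * (G * (1# - s * A)) * fi′ * gi (suc J))) ∎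
    where
    J = m ℕ.+ dbl k
    A = X m
    x = X k
    E = e k
    F = f J
    G = g m
    XJ = X J
    XJ≈ = X-J m k
    fi′ = fi (suc m)
    gi″ = gi (suc (suc J))
    gi′≈ : gi (suc J) ≈ gi″ * (1# - s * (p * (A * (x * x))))
    gi′≈ = trans (gi-suc (suc J)) (*-congˡ (1-cong (*-congˡ (*-congˡ XJ≈))))

  W V : ℕ → Carrier
  W = diag t
  V = diag v

  -- The antidiagonal of `suc M` has one term more than that of M. The shift in m reaches all of its
  -- terms but the one with m = 0, which accounts for the extra summand on the right.
  recurrence : ∀ T (Δ : ℕ → Carrier) M →
    diag (λ m k → a (X m * X k) * T (suc m) k + b (X m * X k) * T m k) M ≈ Δ M →
    a (X M) * diag T (suc M) + b (X M) * diag T M ≈ Δ M + a (X M) * T 0 (suc M)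
  recurrence T Δ M eq = begin
    a (X M) * diag T (suc M) + b (X M) * diag T M
      ≈⟨ +-congʳ (*-congˡ (diag-last T M)) ⟩
    a (X M) * (diag (λ m k → T (suc m) k) M + T 0 (suc M)) + b (X M) * diag T M
      ≈⟨ solve 5 (λ a b x y z → a :* (x :+ y) :+ b :* z := (a :* x :+ b :* z) :+ a :* y) refl _ _ _ _ _ ⟩
    (a (X M) * diag (λ m k → T (suc m) k) M + b (X M) * diag T M) + a (X M) * T 0 (suc M)
      ≈⟨ +-congʳ (diag-linear _ _ _ _ M) ⟨
    diag (λ m k → a (X M) * T (suc m) k + b (X M) * T m k) M + a (X M) * T 0 (suc M)
      ≈⟨ +-congʳ (diag-cong M λ m k m+k≡M →
           let y≈ = trans (reflexive (≡.cong X (≡.sym m+k≡M))) (X-+ m k)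
           in +-cong (*-congʳ (a-cong y≈)) (*-congʳ (b-cong y≈))) ⟩
    diag (λ m k → a (X m * X k) * T (suc m) k + b (X m * X k) * T m k) M + a (X M) * T 0 (suc M)
      ≈⟨ +-congʳ eq ⟩
    Δ M + a (X M) * T 0 (suc M) ∎

  -- The end `Γ 0 (suc M)` cancels the term `t 0 (suc M)` missed by the shift, and at the other end,
  -- where k = 0, all factors of f and g cancel against their inverses.
  W-recurrence : ∀ M → a (X M) * W (suc M) + b (X M) * W M ≈ 1# + p * X M
  W-recurrence M = begin
    a (X M) * W (suc M) + b (X M) * W M
      ≈⟨ recurrence t (λ M → Γ 0 (suc M) - Γ (suc M) 0) M (diag-telescope Γ M λ m k _ → t-telescopes m k) ⟩
    (Γ 0 (suc M) - Γ (suc M) 0) + a y * t 0 (suc M)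
      ≈⟨ solve 3 (λ x y z → (x :- y) :+ z := (z :+ x) :- y) refl _ _ _ ⟩
    (a y * t 0 (suc M) + Γ 0 (suc M)) - Γ (suc M) 0
      ≈⟨ +-cong last (-‿cong first) ⟩
    0# - (- (1# + p * y))
      ≈⟨ solve 1 (λ z → con (+ 0) :- :- z := z) refl (1# + p * y) ⟩
    1# + p * y ∎
    where
    y = X M
    J = suc (dbl M)
    first : Γ (suc M) 0 ≈ - (1# + p * y)
    first rewrite ℕₚ.+-identityʳ M = begin
      - (1# - ((p * y) * 1#) * ((p * y) * 1#)) * (1# * f M * g (suc M) * fi (suc M) * gi (suc M))
        ≈⟨ solve 6 (λ p y f g fi gi → :- (:1 :- ((p :* y) :* :1) :* ((p :* y) :* :1)) :* (:1 :* f :* g :* fi :* gi)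
             := :- (:1 :+ p :* y) :* ((f :* (:1 :- p :* y)) :* fi :* (g :* gi))) refl p y (f M) (g (suc M)) _ _ ⟩
      - (1# + p * y) * (f (suc M) * fi (suc M) * (g (suc M) * gi (suc M)))
        ≈⟨ *-congˡ (*-cong (f*fi (suc M)) (g*gi (suc M))) ⟩
      - (1# + p * y) * (1# * 1#)
        ≈⟨ solve 1 (λ z → z :* (:1 :* :1) := z) refl _ ⟩
      - (1# + p * y) ∎
    last : a y * t 0 (suc M) + Γ 0 (suc M) ≈ 0#
    last = begin
      a y * (E * (1# + q * (p * y)) * (F * (1# - p * (p * X (dbl M)))) * 1# * fi 0 * gi″)
        + - (1# - (1# * (p * y)) * (1# * (p * y))) * (E * F * 1# * fi 0 * gi (suc J))
        ≈⟨ +-cong (*-congˡ (*-congʳ (*-congʳ (*-congʳ (*-congˡ (*-congˡ (1-cong (*-congˡ (*-congˡ (X-dbl M))))))))))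
                  (*-congˡ (*-congˡ (trans (gi-suc (suc J))
                     (*-congˡ (1-cong (*-congˡ (*-congˡ (*-congˡ (X-dbl M))))))))) ⟩
      a y * (E * (1# + q * (p * y)) * (F * (1# - p * (p * (y * y)))) * 1# * fi 0 * gi″)
        + - (1# - (1# * (p * y)) * (1# * (p * y))) * (E * F * 1# * fi 0 * (gi″ * (1# - s * (p * (p * (y * y))))))
        ≈⟨ solve 6 (λ q y E F fi gi → let s = q :* q ; p = s :* s in
             (:1 :- q :* (p :* y)) :* (E :* (:1 :+ q :* (p :* y)) :* (F :* (:1 :- p :* (p :* (y :* y)))) :* :1 :* fi :* gi)
             :+ (:- (:1 :- (:1 :* (p :* y)) :* (:1 :* (p :* y)))) :* (E :* F :* :1 :* fi :* (gi :* (:1 :- s :* (p :* (p :* (y :* y))))))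
             := con (+ 0)) refl q y E F (fi 0) gi″ ⟩
      0# ∎
      where
      E = e (suc M)
      F = f J
      gi″ = gi (suc (suc J))

  -- The combination with coefficients a and b produces a factor 1 - q X k, which cancels `ci k`.
  -- The factor left in front of `u` is constant along an antidiagonal.
  uv-relation : ∀ m k → a (X m * X k) * v (suc m) k + b (X m * X k) * v m k
                ≈ (1# - (p * (X m * X k)) * (p * (X m * X k))) * u (suc m) k
  uv-relation m k = begin
    a (A * x) * ((- (s * A) * D) * (F * (1# - p * X J)) * fi′ * h * ci k)
      + b (A * x) * (D * F * fi m * h * ci k)
      ≈⟨ +-cong (*-congˡ (*-congʳ (*-congʳ (*-congʳ (*-congˡ (*-congˡ (1-cong (*-congˡ (X-J m k)))))))))
                (*-congˡ (*-congʳ (*-congʳ (*-congˡ (fi-suc m))))) ⟩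
    a (A * x) * ((- (s * A) * D) * (F * (1# - p * (A * (x * x)))) * fi′ * h * ci k)
      + b (A * x) * (D * F * (fi′ * (1# - p * A)) * h * ci k)
      ≈⟨ solve 8 (λ q A x D F fi′ h c → let s = q :* q ; p = s :* s ; y = A :* x ; z = A :* (x :* x) in
           (:1 :- q :* (p :* y)) :* ((:- (s :* A) :* D) :* (F :* (:1 :- p :* z)) :* fi′ :* h :* c)
           :+ s :* y :* (q :- p :* y) :* (D :* F :* (fi′ :* (:1 :- p :* A)) :* h :* c)
           := ((:1 :- (p :* y) :* (p :* y)) :* ((:- (s :* A) :* D) :* F :* fi′ :* h)) :* ((:1 :- q :* x) :* c))
         refl q A x D F fi′ h (ci k) ⟩
    ((1# - (p * (A * x)) * (p * (A * x))) * ((- (s * A) * D) * F * fi′ * h)) * ((1# - q * x) * ci k)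
      ≈⟨ *-congˡ (c*ci k) ⟩
    ((1# - (p * (A * x)) * (p * (A * x))) * ((- (s * A) * D) * F * fi′ * h)) * 1#
      ≈⟨ *-identityʳ _ ⟩
    (1# - (p * (A * x)) * (p * (A * x))) * ((- (s * A) * D) * F * fi′ * h) ∎
    where
    J = m ℕ.+ dbl k
    A = X m
    x = X k
    D = d m
    F = f J
    h = fi k * gi k
    fi′ = fi (suc m)

  private
    -- This is 1/(f (k-1) g (k-1)) with the usual convention that it vanishes at k = 0; accordingly
    -- the certificate Δ for `u` is zero at its end k = 0.
    δ : ℕ → Carrier
    δ zero    = 0#
    δ (suc k) = fi k * gi k

    s*δ : ∀ k → s * δ k ≈ fi k * gi k * ((1# - X k) * (s - X k))
    s*δ zero    = solve 3 (λ s f g → s :* con (+ 0) := f :* g :* ((:1 :- :1) :* (s :- :1))) refl s (fi 0) (gi 0)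
    s*δ (suc k) = trans (*-congˡ (*-cong (fi-suc k) (gi-suc k)))
      (solve 4 (λ s x f g → let p = s :* s in
         s :* ((f :* (:1 :- p :* x)) :* (g :* (:1 :- s :* x))) := f :* g :* ((:1 :- p :* x) :* (s :- p :* x)))
       refl s (X k) _ _)

    Δ : ℕ → ℕ → Carrier
    Δ m zero    = 0#
    Δ m (suc k) = - (1# + s * (X m * X k)) * (d m * f (m ℕ.+ dbl k) * fi m * (fi k * gi k))

    -- Brings both clauses of Δ into one formula, so that the telescoping of `u` needs no case
    -- distinction on k.
    Δ′ : ∀ m k → Δ (suc m) k ≈ (1# + s * (X m * X k)) * (X m * d m * f (ℕ.pred (m ℕ.+ dbl k)) * fi (suc m) * (s * δ k))
    Δ′ m zero = solve 5 (λ s y z w v → con (+ 0) := (:1 :+ s :* y) :* (z :* w :* v :* (s :* con (+ 0))))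
      refl s (X m * X 0) (X m * d m) _ _
    Δ′ m (suc k) rewrite ℕₚ.+-suc m (suc (dbl k)) | ℕₚ.+-suc m (dbl k) =
      solve 7 (λ s x A D F fi h → let p = s :* s in
        :- (:1 :+ s :* ((p :* A) :* x)) :* ((:- (s :* A) :* D) :* F :* fi :* h)
        := (:1 :+ s :* (A :* (p :* x))) :* (A :* D :* F :* fi :* (s :* h)))
      refl s (X k) (X m) (d m) _ _ _

    f-pred : ∀ m k M → m ℕ.+ k ≡ suc M → f (m ℕ.+ dbl k) ≈ f (ℕ.pred (m ℕ.+ dbl k)) * (1# - X (m ℕ.+ dbl k))
    f-pred (suc m) k       M _ = refl
    f-pred zero    (suc k) M _ = refl
    f-pred zero    zero    M ()

    u-telescopes : ∀ M m k → m ℕ.+ k ≡ suc M →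
      (1# - p * (X m * X k)) * u (suc m) k + - (1# - X m * X k) * u m k ≈ Δ m (suc k) - Δ (suc m) k
    u-telescopes M m k m+k≡ = begin
      (1# - p * (A * x)) * ((- (s * A) * D) * f J * fi′ * h) + - (1# - A * x) * (D * F * fi m * h)
        ≈⟨ +-cong (*-congˡ (*-congʳ (*-congʳ (*-congˡ fJ)))) (*-congˡ (*-congʳ (*-congˡ (fi-suc m)))) ⟩
      (1# - p * (A * x)) * ((- (s * A) * D) * (F * (1# - A * (x * x))) * fi′ * h)
        + - (1# - A * x) * (D * F * (fi′ * (1# - p * A)) * h)
        ≈⟨ solve 7 (λ s A x D F fi′ h → let p = s :* s ; y = A :* x ; z = A :* (x :* x) in
             (:1 :- p :* y) :* ((:- (s :* A) :* D) :* (F :* (:1 :- z)) :* fi′ :* h)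
               :+ (:- (:1 :- y)) :* (D :* F :* (fi′ :* (:1 :- p :* A)) :* h)
             := :- (:1 :+ s :* y) :* (D :* (F :* (:1 :- z)) :* (fi′ :* (:1 :- p :* A)) :* h)
               :- (:1 :+ s :* y) :* (A :* D :* F :* fi′ :* (h :* ((:1 :- x) :* (s :- x)))))
           refl s A x D F fi′ h ⟩
      - (1# + s * (A * x)) * (D * (F * (1# - A * (x * x))) * (fi′ * (1# - p * A)) * h)
        - (1# + s * (A * x)) * (A * D * F * fi′ * (h * ((1# - x) * (s - x))))
        ≈⟨ +-cong (*-congˡ (*-congʳ (*-cong (*-congˡ fJ) (fi-suc m))))
             (-‿cong (trans (Δ′ m k) (*-congˡ (*-congˡ (s*δ k))))) ⟨
      Δ m (suc k) - Δ (suc m) k ∎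
      where
      J = m ℕ.+ dbl k
      A = X m
      x = X k
      D = d m
      F = f (ℕ.pred J)
      h = fi k * gi k
      fi′ = fi (suc m)
      fJ : f J ≈ F * (1# - A * (x * x))
      fJ = trans (f-pred m k M m+k≡) (*-congˡ (1-cong (X-J m k)))

  -- The product (1 - X N) `diag u N` is independent of N, because the telescoped difference cancels
  -- the newly added term, and it is 1 at N = 1. The induction cannot start at N = 0, where 1 - X N
  -- is zero.
  u-sum : ∀ M → (1# - X (suc M)) * diag u (suc M) ≈ 1#
  u-sum zero = begin
    (1# - p * 1#) * ((- (s * 1#) * 1#) * 1# * fi 1 * (fi 0 * gi 0) + 1# * f 1 * fi 0 * (fi 1 * gi 1))
      ≈⟨ *-congˡ (+-cong (*-congˡ (*-cong fi-0 gi-0)) (*-congʳ (*-congˡ fi-0))) ⟩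
    (1# - p * 1#) * ((- (s * 1#) * 1#) * 1# * fi 1 * (1# * 1#) + 1# * f 1 * 1# * (fi 1 * gi 1))
      ≈⟨ solve 3 (λ s fi gi → let p = s :* s ; f = :1 :* (:1 :- p :* :1) ; g = :1 :* (:1 :- s :* :1) in
           (:1 :- p :* :1) :* ((:- (s :* :1) :* :1) :* :1 :* fi :* (:1 :* :1) :+ :1 :* f :* :1 :* (fi :* gi))
           := (f :* fi) :* (:- s :+ (:1 :+ s) :* (g :* gi))) refl s (fi 1) (gi 1) ⟩
    (f 1 * fi 1) * (- s + (1# + s) * (g 1 * gi 1))
      ≈⟨ *-cong (f*fi 1) (+-congˡ (*-congˡ (g*gi 1))) ⟩
    1# * (- s + (1# + s) * 1#)
      ≈⟨ solve 1 (λ s → :1 :* (:- s :+ (:1 :+ s) :* :1) := :1) refl s ⟩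
    1# ∎
  u-sum (suc M) = begin
    (1# - p * y) * diag u (suc (suc M))
      ≈⟨ *-congˡ (diag-last u (suc M)) ⟩
    (1# - p * y) * (D′ + l)
      ≈⟨ solve 4 (λ c e x l → c :* (x :+ l) := (c :* x :+ (:- e) :* con (+ 0)) :+ c :* l) refl _ (1# - y) _ _ ⟩
    ((1# - p * y) * D′ + - (1# - y) * 0#) + (1# - p * y) * l
      -- The sum over the previous antidiagonal is subtracted and added: one copy telescopes against
      -- the shifted sum, the other is evaluated by induction.
      ≈⟨ solve 5 (λ c e x l z → (c :* x :+ (:- e) :* con (+ 0)) :+ c :* l
           := ((c :* x :+ (:- e) :* z) :+ c :* l) :+ e :* z) refl _ (1# - y) _ _ (diag u (suc M)) ⟩
    (((1# - p * y) * D′ + - (1# - y) * diag u (suc M)) + (1# - p * y) * l) + (1# - y) * diag u (suc M)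
      ≈⟨ +-cong (+-congʳ (trans (sym (diag-linear _ _ (λ m k → u (suc m) k) u (suc M))) (diag-cong (suc M) coefficients))) (u-sum M) ⟩
    (diag (λ m k → (1# - p * (X m * X k)) * u (suc m) k + - (1# - X m * X k) * u m k) (suc M)
      + (1# - p * y) * l) + 1#
      ≈⟨ +-congʳ (+-congʳ (diag-telescope Δ (suc M) (u-telescopes M))) ⟩
    ((Δ 0 (suc (suc M)) - 0#) + (1# - p * y) * l) + 1#
      ≈⟨ +-congʳ last ⟩
    0# + 1#
      ≈⟨ +-identityˡ 1# ⟩
    1# ∎
    where
    y = X (suc M)
    N = suc M
    D′ = diag (λ m k → u (suc m) k) (suc M)
    l = u 0 (suc (suc M))
    coefficients : ∀ m k → m ℕ.+ k ≡ suc M →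
      (1# - p * y) * u (suc m) k + - (1# - y) * u m k ≈
      (1# - p * (X m * X k)) * u (suc m) k + - (1# - X m * X k) * u m k
    coefficients m k m+k≡ =
      let y≈ = trans (reflexive (≡.cong X (≡.sym m+k≡))) (X-+ m k)
      in +-cong (*-congʳ (1-cong (*-congˡ y≈))) (*-congʳ (-‿cong (1-cong y≈)))
    last : (Δ 0 (suc (suc M)) - 0#) + (1# - p * y) * l ≈ 0#
    last = begin
      (- (1# + s * (1# * y)) * (1# * F * fi 0 * (fi N * gi N)) - 0#)
        + (1# - p * y) * (1# * (F * (1# - p * X (dbl N))) * fi 0 * (fi′ * gi′))
        ≈⟨ +-cong (+-congʳ (*-congˡ (*-congˡ (*-cong (fi-suc N) (gi-suc N)))))
             (*-congˡ (*-congʳ (*-congʳ (*-congˡ (*-congˡ (1-cong (*-congˡ (X-dbl N)))))))) ⟩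
      (- (1# + s * (1# * y)) * (1# * F * fi 0 * ((fi′ * (1# - p * y)) * (gi′ * (1# - s * y)))) - 0#)
        + (1# - p * y) * (1# * (F * (1# - p * (y * y))) * fi 0 * (fi′ * gi′))
        ≈⟨ solve 6 (λ s y F fi fi′ gi′ → let p = s :* s in
             (:- (:1 :+ s :* (:1 :* y)) :* (:1 :* F :* fi :* ((fi′ :* (:1 :- p :* y)) :* (gi′ :* (:1 :- s :* y)))) :- con (+ 0))
             :+ (:1 :- p :* y) :* (:1 :* (F :* (:1 :- p :* (y :* y))) :* fi :* (fi′ :* gi′)) := con (+ 0))
           refl s y F (fi 0) fi′ gi′ ⟩
      0# ∎
      where
      F = f (dbl N)
      fi′ = fi (suc N)
      gi′ = gi (suc N)

  -- The factor 1 - (p y)² from `uv-relation` splits as (1 + p y)(1 - p y), and the second factor is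
  -- exactly what `u-sum` absorbs.
  V-recurrence : ∀ M → a (X M) * V (suc M) + b (X M) * V M ≈ 1# + p * X M
  V-recurrence M = begin
    a y * V (suc M) + b y * V M
      ≈⟨ recurrence v (λ M → (1# - (p * X M) * (p * X M)) * diag (λ m k → u (suc m) k) M) M sums ⟩
    κ * diag (λ m k → u (suc m) k) M + a y * v 0 (suc M)
      ≈⟨ +-congˡ last ⟩
    κ * diag (λ m k → u (suc m) k) M + κ * u 0 (suc M)
      ≈⟨ distribˡ _ _ _ ⟨
    κ * (diag (λ m k → u (suc m) k) M + u 0 (suc M))
      ≈⟨ *-congˡ (diag-last u M) ⟨
    κ * diag u (suc M)
      ≈⟨ solve 2 (λ z w → (:1 :- z :* z) :* w := (:1 :+ z) :* ((:1 :- z) :* w)) refl (p * y) _ ⟩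
    (1# + p * y) * ((1# - p * y) * diag u (suc M))
      ≈⟨ *-congˡ (u-sum M) ⟩
    (1# + p * y) * 1#
      ≈⟨ *-identityʳ _ ⟩
    1# + p * y ∎
    where
    y = X M
    κ = 1# - (p * y) * (p * y)
    sums : diag (λ m k → a (X m * X k) * v (suc m) k + b (X m * X k) * v m k) M ≈ κ * diag (λ m k → u (suc m) k) M
    sums = trans (diag-cong M λ m k m+k≡M →
             let y≈ = trans (sym (X-+ m k)) (reflexive (≡.cong X m+k≡M))
             in trans (uv-relation m k) (*-congʳ (1-cong (*-cong (*-congˡ y≈) (*-congˡ y≈)))))
           (diag-scale κ _ M)
    last : a y * v 0 (suc M) ≈ κ * u 0 (suc M)
    last = begin
      (1# - q * (p * y)) * (1# * (F * (1# - p * (p * X (dbl M)))) * fi 0 * h * ci (suc M))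
        ≈⟨ *-congˡ (*-congʳ (*-congʳ (*-congʳ (*-congˡ (*-congˡ (1-cong (*-congˡ (*-congˡ (X-dbl M))))))))) ⟩
      (1# - q * (p * y)) * (1# * (F * (1# - p * (p * (y * y)))) * fi 0 * h * ci (suc M))
        ≈⟨ solve 7 (λ q p y F fi h c →
             (:1 :- q :* (p :* y)) :* (:1 :* (F :* (:1 :- p :* (p :* (y :* y)))) :* fi :* h :* c)
             := ((:1 :- q :* (p :* y)) :* c) :* ((:1 :- (p :* y) :* (p :* y)) :* (:1 :* F :* fi :* h)))
           refl q p y F (fi 0) h (ci (suc M)) ⟩
      ((1# - q * (p * y)) * ci (suc M)) * (κ * u 0 (suc M))
        ≈⟨ *-congʳ (c*ci (suc M)) ⟩
      1# * (κ * u 0 (suc M))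
        ≈⟨ *-identityˡ _ ⟩
      κ * u 0 (suc M) ∎
      where
      F = f (suc (dbl M))
      h = fi (suc M) * gi (suc M)

  -- The leading coefficient of the common recurrence is 1 - q X (M + 1), with inverse `ci (suc M)`,
  -- so the recurrence determines each sum from the previous one.
  W≈V : ∀ N → W N ≈ V N
  W≈V zero = begin
    1# * (1# + q * 1#) * 1# * 1# * fi 0 * gi 1
      ≈⟨ *-congʳ (*-congˡ fi-0) ⟩
    1# * (1# + q * 1#) * 1# * 1# * 1# * gi 1
      ≈⟨ *-identityʳ _ ⟨
    1# * (1# + q * 1#) * 1# * 1# * 1# * gi 1 * 1#
      ≈⟨ *-congˡ (c*ci 0) ⟨
    1# * (1# + q * 1#) * 1# * 1# * 1# * gi 1 * ((1# - q * 1#) * ci 0)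
      ≈⟨ solve 3 (λ q gi ci → :1 :* (:1 :+ q :* :1) :* :1 :* :1 :* :1 :* gi :* ((:1 :- q :* :1) :* ci)
           := (:1 :* (:1 :- (q :* q) :* :1) :* gi) :* (:1 :* :1 :* :1 :* (:1 :* :1) :* ci)) refl q (gi 1) (ci 0) ⟩
    (g 1 * gi 1) * (1# * 1# * 1# * (1# * 1#) * ci 0)
      ≈⟨ *-cong (g*gi 1) (*-congʳ (*-cong (*-congˡ (sym fi-0)) (*-cong (sym fi-0) (sym gi-0)))) ⟩
    1# * (1# * 1# * fi 0 * (fi 0 * gi 0) * ci 0)
      ≈⟨ *-identityˡ _ ⟩
    1# * 1# * fi 0 * (fi 0 * gi 0) * ci 0 ∎
  W≈V (suc M) = begin
    W (suc M)                     ≈⟨ isolate (W-recurrence M) ⟩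
    c′ * ((1# + p * y) - b y * W M) ≈⟨ *-congˡ (+-congˡ (-‿cong (*-congˡ (W≈V M)))) ⟩
    c′ * ((1# + p * y) - b y * V M) ≈⟨ isolate (V-recurrence M) ⟨
    V (suc M)                     ∎
    where
    y = X M
    c′ = ci (suc M)
    isolate : ∀ {z w} → a y * z + b y * w ≈ 1# + p * y → z ≈ c′ * ((1# + p * y) - b y * w)
    isolate {z} {w} eq = begin
      z                                            ≈⟨ *-identityˡ z ⟨
      1# * z                                       ≈⟨ *-congʳ (c*ci (suc M)) ⟨
      a y * c′ * z                                 ≈⟨ solve 5 (λ a c z b w → a :* c :* z := c :* ((a :* z :+ b :* w) :- b :* w)) refl _ _ _ (b y) w ⟩
      c′ * ((a y * z + b y * w) - b y * w)         ≈⟨ *-congˡ (+-congʳ eq) ⟩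
      c′ * ((1# + p * y) - b y * w)                ∎

-- The commutative ring of polynomials over the rationals.

module PolynomialRing where
  open IntegerSolver ℚₚ.+-*-commutativeRing
  open ≡.≡-Reasoning

  coef : Poly → ℕ → ℚ
  coef []      i       = 0ℚ
  coef (a ∷ p) zero    = a
  coef (a ∷ p) (suc i) = coef p i

  infix 4 _≋_
  -- Coefficientwise equality ignores trailing zeros. The record wrapper lets the two polynomials be
  -- inferred from a proof; `_≈P_` appears only at the very end.
  record _≋_ (p r : Poly) : Set where
    constructor mk
    field at : ∀ i → coef p i ≡ coef r i
  open _≋_ public

  ≋-refl : ∀ {p} → p ≋ p
  ≋-refl = mk λ _ → ≡.refl

  ≋-sym : ∀ {p r} → p ≋ r → r ≋ p
  ≋-sym e = mk λ i → ≡.sym (at e i)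

  ≋-trans : ∀ {p r t} → p ≋ r → r ≋ t → p ≋ t
  ≋-trans e e′ = mk λ i → ≡.trans (at e i) (at e′ i)

  coef-⊕ : ∀ p r i → coef (p ⊕ r) i ≡ coef p i ℚ.+ coef r i
  coef-⊕ []      r       i       = ≡.sym (ℚₚ.+-identityˡ _)
  coef-⊕ (a ∷ p) []      i       = ≡.sym (ℚₚ.+-identityʳ _)
  coef-⊕ (a ∷ p) (b ∷ r) zero    = ≡.refl
  coef-⊕ (a ∷ p) (b ∷ r) (suc i) = coef-⊕ p r i

  coef-scale : ∀ c p i → coef (scale c p) i ≡ c ℚ.* coef p i
  coef-scale c []      i       = ≡.sym (ℚₚ.*-zeroʳ c)
  coef-scale c (a ∷ p) zero    = ≡.refl
  coef-scale c (a ∷ p) (suc i) = coef-scale c p i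

  coef-neg : ∀ p i → coef (negP p) i ≡ ℚ.- coef p i
  coef-neg []      i       = ≡.refl
  coef-neg (a ∷ p) zero    = ≡.refl
  coef-neg (a ∷ p) (suc i) = coef-neg p i

  coef-⊖ : ∀ p r i → coef (p ⊖ r) i ≡ coef p i ℚ.- coef r i
  coef-⊖ p r i = ≡.trans (coef-⊕ p (negP r) i) (≡.cong (coef p i ℚ.+_) (coef-neg r i))

  ∷-cong : ∀ {a b p r} → a ≡ b → p ≋ r → a ∷ p ≋ b ∷ r
  ∷-cong a≡b p≋r = mk λ { zero → a≡b ; (suc i) → at p≋r i }

  tail : ∀ {a b p r} → a ∷ p ≋ b ∷ r → p ≋ r
  tail e = mk λ i → at e (suc i)

  0∷[] : ∀ {p} → p ≋ [] → 0ℚ ∷ p ≋ []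
  0∷[] e = mk λ { zero → ≡.refl ; (suc i) → at e i }

  ⊕-cong : ∀ {p p′ r r′} → p ≋ p′ → r ≋ r′ → p ⊕ r ≋ p′ ⊕ r′
  ⊕-cong {p} {p′} {r} {r′} e e′ = mk λ i →
    ≡.trans (coef-⊕ p r i) (≡.trans (≡.cong₂ ℚ._+_ (at e i) (at e′ i)) (≡.sym (coef-⊕ p′ r′ i)))

  ⊕-assoc : ∀ p r t → (p ⊕ r) ⊕ t ≋ p ⊕ (r ⊕ t)
  ⊕-assoc p r t = mk λ i → begin
    coef ((p ⊕ r) ⊕ t) i                   ≡⟨ coef-⊕ (p ⊕ r) t i ⟩
    coef (p ⊕ r) i ℚ.+ coef t i            ≡⟨ ≡.cong (ℚ._+ coef t i) (coef-⊕ p r i) ⟩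
    coef p i ℚ.+ coef r i ℚ.+ coef t i     ≡⟨ ℚₚ.+-assoc (coef p i) _ _ ⟩
    coef p i ℚ.+ (coef r i ℚ.+ coef t i)   ≡⟨ ≡.cong (coef p i ℚ.+_) (coef-⊕ r t i) ⟨
    coef p i ℚ.+ coef (r ⊕ t) i            ≡⟨ coef-⊕ p (r ⊕ t) i ⟨
    coef (p ⊕ (r ⊕ t)) i                   ∎

  ⊕-comm : ∀ p r → p ⊕ r ≋ r ⊕ p
  ⊕-comm p r = mk λ i →
    ≡.trans (coef-⊕ p r i) (≡.trans (ℚₚ.+-comm (coef p i) (coef r i)) (≡.sym (coef-⊕ r p i)))

  ⊕-identityʳ : ∀ p → p ⊕ [] ≋ p
  ⊕-identityʳ p = ⊕-comm p []

  negP-cong : ∀ {p r} → p ≋ r → negP p ≋ negP r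
  negP-cong {p} {r} e = mk λ i →
    ≡.trans (coef-neg p i) (≡.trans (≡.cong ℚ.-_ (at e i)) (≡.sym (coef-neg r i)))

  negP-inverseʳ : ∀ p → p ⊕ negP p ≋ []
  negP-inverseʳ p = mk λ i → ≡.trans (coef-⊖ p p i) (ℚₚ.+-inverseʳ (coef p i))

  scale-cong : ∀ {a b p r} → a ≡ b → p ≋ r → scale a p ≋ scale b r
  scale-cong {a} {b} {p} {r} a≡b e = mk λ i →
    ≡.trans (coef-scale a p i) (≡.trans (≡.cong₂ ℚ._*_ a≡b (at e i)) (≡.sym (coef-scale b r i)))

  scale-0 : ∀ p → scale 0ℚ p ≋ []
  scale-0 p = mk λ i → ≡.trans (coef-scale 0ℚ p i) (ℚₚ.*-zeroˡ (coef p i))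

  scale-1 : ∀ p → scale 1ℚ p ≋ p
  scale-1 p = mk λ i → ≡.trans (coef-scale 1ℚ p i) (ℚₚ.*-identityˡ (coef p i))

  ⊛-zeroʳ : ∀ p → p ⊛ [] ≋ []
  ⊛-zeroʳ []      = ≋-refl
  ⊛-zeroʳ (a ∷ p) = 0∷[] (⊛-zeroʳ p)

  ⊛-zero : ∀ {p} r → p ≋ [] → p ⊛ r ≋ []
  ⊛-zero {[]}    r e = ≋-refl
  ⊛-zero {a ∷ p} r e = ⊕-cong (≋-trans (scale-cong {a} {0ℚ} {r} (at e 0) ≋-refl) (scale-0 r))
                              (0∷[] (⊛-zero {p} r (mk λ i → at e (suc i))))

  ⊛-congˡ : ∀ p {r r′} → r ≋ r′ → p ⊛ r ≋ p ⊛ r′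
  ⊛-congˡ []      e = ≋-refl
  ⊛-congˡ (a ∷ p) e = ⊕-cong (scale-cong {a} ≡.refl e) (∷-cong ≡.refl (⊛-congˡ p e))

  ⊛-congʳ : ∀ {p p′} r → p ≋ p′ → p ⊛ r ≋ p′ ⊛ r
  ⊛-congʳ {[]}    {p′}     r e = ≋-sym (⊛-zero {p′} r (≋-sym e))
  ⊛-congʳ {a ∷ p} {[]}     r e = ⊛-zero {a ∷ p} r e
  ⊛-congʳ {a ∷ p} {b ∷ p′} r e =
    ⊕-cong (scale-cong {a} {b} {r} (at e 0) ≋-refl) (∷-cong ≡.refl (⊛-congʳ {p} {p′} r (tail e)))

  ⊛-cong : ∀ {p p′ r r′} → p ≋ p′ → r ≋ r′ → p ⊛ r ≋ p′ ⊛ r′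
  ⊛-cong {p} {p′} {r} {r′} e e′ = ≋-trans (⊛-congˡ p e′) (⊛-congʳ r′ e)

  -- Multiplication recurses on its left factor; the matching recursion on the right factor is what
  -- commutativity rests on.
  ⊛-∷ʳ : ∀ p b r → p ⊛ (b ∷ r) ≋ scale b p ⊕ (0ℚ ∷ p ⊛ r)
  ⊛-∷ʳ []      b r = ≋-sym (0∷[] ≋-refl)
  ⊛-∷ʳ (a ∷ p) b r = ∷-cong (≡.cong (ℚ._+ 0ℚ) (ℚₚ.*-comm a b)) (mk λ i → begin
    coef (scale a r ⊕ p ⊛ (b ∷ r)) i
      ≡⟨ coef-⊕ (scale a r) _ i ⟩
    coef (scale a r) i ℚ.+ coef (p ⊛ (b ∷ r)) i
      ≡⟨ ≡.cong (coef (scale a r) i ℚ.+_) (≡.trans (at (⊛-∷ʳ p b r) i) (coef-⊕ (scale b p) _ i)) ⟩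
    coef (scale a r) i ℚ.+ (coef (scale b p) i ℚ.+ coef (0ℚ ∷ p ⊛ r) i)
      ≡⟨ solve 3 (λ x y z → x :+ (y :+ z) := y :+ (x :+ z)) ≡.refl (coef (scale a r) i) (coef (scale b p) i) (coef (0ℚ ∷ p ⊛ r) i) ⟩
    coef (scale b p) i ℚ.+ (coef (scale a r) i ℚ.+ coef (0ℚ ∷ p ⊛ r) i)
      ≡⟨ ≡.cong (coef (scale b p) i ℚ.+_) (coef-⊕ (scale a r) _ i) ⟨
    coef (scale b p) i ℚ.+ coef (scale a r ⊕ (0ℚ ∷ p ⊛ r)) i
      ≡⟨ coef-⊕ (scale b p) _ i ⟨
    coef (scale b p ⊕ (scale a r ⊕ (0ℚ ∷ p ⊛ r))) i ∎)

  ⊛-comm : ∀ p r → p ⊛ r ≋ r ⊛ p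
  ⊛-comm []      r = ≋-sym (⊛-zeroʳ r)
  ⊛-comm (a ∷ p) r = ≋-trans (⊕-cong (≋-refl {scale a r}) (∷-cong ≡.refl (⊛-comm p r))) (≋-sym (⊛-∷ʳ r a p))

  ⊛-distribˡ : ∀ p r t → p ⊛ (r ⊕ t) ≋ p ⊛ r ⊕ p ⊛ t
  ⊛-distribˡ []      r t = ≋-refl
  ⊛-distribˡ (a ∷ p) r t = mk λ i → begin
    coef (scale a (r ⊕ t) ⊕ (0ℚ ∷ p ⊛ (r ⊕ t))) i
      ≡⟨ coef-⊕ (scale a (r ⊕ t)) _ i ⟩
    coef (scale a (r ⊕ t)) i ℚ.+ coef (0ℚ ∷ p ⊛ (r ⊕ t)) i
      ≡⟨ ≡.cong₂ ℚ._+_ (≡.trans (coef-scale a (r ⊕ t) i) (≡.cong (a ℚ.*_) (coef-⊕ r t i)))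
                       (at (∷-cong ≡.refl (⊛-distribˡ p r t)) i) ⟩
    a ℚ.* (coef r i ℚ.+ coef t i) ℚ.+ coef (0ℚ ∷ (p ⊛ r ⊕ p ⊛ t)) i
      ≡⟨ ≡.cong (a ℚ.* (coef r i ℚ.+ coef t i) ℚ.+_) (coef-⊕ (0ℚ ∷ p ⊛ r) (0ℚ ∷ p ⊛ t) i) ⟩
    a ℚ.* (coef r i ℚ.+ coef t i) ℚ.+ (coef (0ℚ ∷ p ⊛ r) i ℚ.+ coef (0ℚ ∷ p ⊛ t) i)
      ≡⟨ solve 5 (λ a x y z w → a :* (x :+ y) :+ (z :+ w) := (a :* x :+ z) :+ (a :* y :+ w)) ≡.refl a (coef r i) (coef t i) (coef (0ℚ ∷ p ⊛ r) i) (coef (0ℚ ∷ p ⊛ t) i) ⟩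
    (a ℚ.* coef r i ℚ.+ coef (0ℚ ∷ p ⊛ r) i) ℚ.+ (a ℚ.* coef t i ℚ.+ coef (0ℚ ∷ p ⊛ t) i)
      ≡⟨ ≡.cong₂ ℚ._+_ (coef-⊛ r) (coef-⊛ t) ⟨
    coef ((a ∷ p) ⊛ r) i ℚ.+ coef ((a ∷ p) ⊛ t) i
      ≡⟨ coef-⊕ ((a ∷ p) ⊛ r) _ i ⟨
    coef ((a ∷ p) ⊛ r ⊕ (a ∷ p) ⊛ t) i ∎
    where
    coef-⊛ : ∀ r {i} → coef ((a ∷ p) ⊛ r) i ≡ a ℚ.* coef r i ℚ.+ coef (0ℚ ∷ p ⊛ r) i
    coef-⊛ r {i} = ≡.trans (coef-⊕ (scale a r) _ i) (≡.cong (ℚ._+ coef (0ℚ ∷ p ⊛ r) i) (coef-scale a r i))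

  ⊛-distribʳ : ∀ t p r → (p ⊕ r) ⊛ t ≋ p ⊛ t ⊕ r ⊛ t
  ⊛-distribʳ t p r = ≋-trans (⊛-comm (p ⊕ r) t)
    (≋-trans (⊛-distribˡ t p r) (⊕-cong (⊛-comm t p) (⊛-comm t r)))

  scale-⊛ : ∀ a p r → scale a p ⊛ r ≋ scale a (p ⊛ r)
  scale-⊛ a []      r = ≋-refl
  scale-⊛ a (b ∷ p) r = mk λ i → begin
    coef (scale (a ℚ.* b) r ⊕ (0ℚ ∷ scale a p ⊛ r)) i
      ≡⟨ coef-⊕ (scale (a ℚ.* b) r) _ i ⟩
    coef (scale (a ℚ.* b) r) i ℚ.+ coef (0ℚ ∷ scale a p ⊛ r) i
      ≡⟨ ≡.cong₂ ℚ._+_ (coef-scale (a ℚ.* b) r i) (shift i) ⟩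
    a ℚ.* b ℚ.* coef r i ℚ.+ a ℚ.* coef (0ℚ ∷ p ⊛ r) i
      ≡⟨ solve 4 (λ a b x y → a :* b :* x :+ a :* y := a :* (b :* x :+ y)) ≡.refl a b (coef r i) (coef (0ℚ ∷ p ⊛ r) i) ⟩
    a ℚ.* (b ℚ.* coef r i ℚ.+ coef (0ℚ ∷ p ⊛ r) i)
      ≡⟨ ≡.cong (a ℚ.*_) (≡.trans (coef-⊕ (scale b r) _ i) (≡.cong (ℚ._+ _) (coef-scale b r i))) ⟨
    a ℚ.* coef (scale b r ⊕ (0ℚ ∷ p ⊛ r)) i
      ≡⟨ coef-scale a (scale b r ⊕ (0ℚ ∷ p ⊛ r)) i ⟨
    coef (scale a (scale b r ⊕ (0ℚ ∷ p ⊛ r))) i ∎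
    where
    shift : ∀ i → coef (0ℚ ∷ scale a p ⊛ r) i ≡ a ℚ.* coef (0ℚ ∷ p ⊛ r) i
    shift zero    = ≡.sym (ℚₚ.*-zeroʳ a)
    shift (suc i) = ≡.trans (at (scale-⊛ a p r) i) (coef-scale a (p ⊛ r) i)

  shift-⊛ : ∀ p r → (0ℚ ∷ p) ⊛ r ≋ 0ℚ ∷ p ⊛ r
  shift-⊛ p r = ⊕-cong (scale-0 r) ≋-refl

  ⊛-assoc : ∀ p r t → (p ⊛ r) ⊛ t ≋ p ⊛ (r ⊛ t)
  ⊛-assoc []      r t = ≋-refl
  ⊛-assoc (a ∷ p) r t = ≋-trans (⊛-distribʳ t (scale a r) (0ℚ ∷ p ⊛ r))
    (⊕-cong (scale-⊛ a r t) (≋-trans (shift-⊛ (p ⊛ r) t) (∷-cong ≡.refl (⊛-assoc p r t))))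

  ⊛-constˡ : ∀ c r → constP c ⊛ r ≋ scale c r
  ⊛-constˡ c r = ≋-trans (⊕-cong (≋-refl {scale c r}) (0∷[] (≋-refl {[]}))) (⊕-identityʳ (scale c r))

  ⊛-identityˡ : ∀ r → oneP ⊛ r ≋ r
  ⊛-identityˡ r = ≋-trans (⊛-constˡ 1ℚ r) (scale-1 r)

  ℚ[q] : CommutativeRing Level.zero Level.zero
  ℚ[q] = record
    { Carrier = Poly ; _≈_ = _≋_ ; _+_ = _⊕_ ; _*_ = _⊛_ ; -_ = negP ; 0# = [] ; 1# = oneP
    ; isCommutativeRing = record
      { isRing = record
        { +-isAbelianGroup = record
          { isGroup = record
            { isMonoid = record
              { isSemigroup = record
                { isMagma = record
                  { isEquivalence = record { refl = ≋-refl ; sym = ≋-sym ; trans = ≋-trans }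
                  ; ∙-cong = ⊕-cong }
                ; assoc = ⊕-assoc }
              ; identity = (λ p → ≋-refl) , ⊕-identityʳ }
            ; inverse = (λ p → ≋-trans (⊕-comm (negP p) p) (negP-inverseʳ p)) , negP-inverseʳ
            ; ⁻¹-cong = negP-cong }
          ; comm = ⊕-comm }
        ; *-cong = ⊛-cong
        ; *-assoc = ⊛-assoc
        ; *-identity = ⊛-identityˡ , λ p → ≋-trans (⊛-comm p oneP) (⊛-identityˡ p)
        ; distrib = ⊛-distribˡ , ⊛-distribʳ }
      ; *-comm = ⊛-comm } }

  ≋[]⇒IsZeroP : ∀ p → p ≋ [] → IsZeroP p
  ≋[]⇒IsZeroP []      e = []
  ≋[]⇒IsZeroP (a ∷ p) e = at e 0 ∷ ≋[]⇒IsZeroP p (mk λ i → at e (suc i))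

  ≋⇒≈P : ∀ {p r} → p ≋ r → p ≈P r
  ≋⇒≈P {p} {r} e = ≋[]⇒IsZeroP (p ⊖ r) (≋-trans (⊕-cong e (≋-refl {negP r})) (negP-inverseʳ r))

open PolynomialRing

-- Divisibility, coprimality in the sense of Bézout, and regular elements.

module Coprimality {c ℓ : Level} (R : CommutativeRing c ℓ) where
  open CommutativeRing R hiding (zero)
  open IntegerSolver R

  infix 4 _∣ᴿ_
  _∣ᴿ_ : Carrier → Carrier → Set (c Level.⊔ ℓ)
  a ∣ᴿ b = Σ Carrier λ r → r * a ≈ b

  Coprime : Carrier → Carrier → Set (c Level.⊔ ℓ)
  Coprime a b = Σ Carrier λ s → Σ Carrier λ t → s * a + t * b ≈ 1#

  ∣-refl : ∀ {a} → a ∣ᴿ a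
  ∣-refl = 1# , *-identityˡ _

  ∣-resp : ∀ {a b a′ b′} → a ≈ a′ → b ≈ b′ → a ∣ᴿ b → a′ ∣ᴿ b′
  ∣-resp a≈ b≈ (r , e) = r , trans (*-congˡ (sym a≈)) (trans e b≈)

  ∣-trans : ∀ {a b c} → a ∣ᴿ b → b ∣ᴿ c → a ∣ᴿ c
  ∣-trans (r , e) (r′ , e′) = r′ * r , trans (*-assoc _ _ _) (trans (*-congˡ e) e′)

  ∣-*ˡ : ∀ {a b} c → a ∣ᴿ b → a ∣ᴿ c * b
  ∣-*ˡ c (r , e) = c * r , trans (*-assoc _ _ _) (*-congˡ e)

  ∣-*-mono : ∀ {a b a′ b′} → a ∣ᴿ a′ → b ∣ᴿ b′ → a * b ∣ᴿ a′ * b′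
  ∣-*-mono {a} {b} (r , e) (r′ , e′) = r * r′ ,
    trans (solve 4 (λ r r′ a b → r :* r′ :* (a :* b) := (r :* a) :* (r′ :* b)) refl r r′ a b) (*-cong e e′)

  coprime-sym : ∀ {a b} → Coprime a b → Coprime b a
  coprime-sym (s , t , e) = t , s , trans (+-comm _ _) e

  coprime-1 : ∀ {a} → Coprime 1# a
  coprime-1 {a} = 1# , 0# , solve 1 (λ a → :1 :* :1 :+ con (+ 0) :* a := :1) refl a

  -- The ideal (a, b) is contained in (a′, b), so the latter contains 1 as well.
  coprime-combination : ∀ {a b a′} α β → a ≈ α * a′ + β * b → Coprime a b → Coprime a′ b
  coprime-combination {a} {b} {a′} α β a≈ (s , t , e) = s * α , s * β + t ,
    trans (solve 6 (λ s α β t a′ b → (s :* α) :* a′ :+ (s :* β :+ t) :* b := s :* (α :* a′ :+ β :* b) :+ t :* b)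
            refl s α β t a′ b)
      (trans (+-congʳ (*-congˡ (sym a≈))) e)

  coprime-resp : ∀ {a b a′} → a ≈ a′ → Coprime a b → Coprime a′ b
  coprime-resp a≈a′ (s , t , e) = s , t , trans (+-congʳ (*-congˡ (sym a≈a′))) e

  coprime-∣ : ∀ {a a′ b} → a′ ∣ᴿ a → Coprime a b → Coprime a′ b
  coprime-∣ {a} {a′} {b} (r , e) =
    coprime-combination r 0# (trans (sym e) (solve 2 (λ x b → x := x :+ con (+ 0) :* b) refl (r * a′) b))

  coprime-* : ∀ {a b c} → Coprime a c → Coprime b c → Coprime (a * b) c
  coprime-* {a} {b} {c} (s , t , e) (s′ , t′ , e′) = s * s′ , s * a * t′ + t ,
    trans (solve 7 (λ s t s′ t′ a b c → (s :* s′) :* (a :* b) :+ (s :* a :* t′ :+ t) :* c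
                     := (s :* a) :* (s′ :* b :+ t′ :* c) :+ t :* c) refl s t s′ t′ a b c)
      (trans (+-congʳ (trans (*-congˡ e′) (*-identityʳ _))) e)

  coprime-∣-* : ∀ {a b c} → Coprime a b → a ∣ᴿ c → b ∣ᴿ c → a * b ∣ᴿ c
  coprime-∣-* {a} {b} {c} (s , t , e) (r , ra≈c) (r′ , r′b≈c) = s * r′ + t * r ,
    trans (solve 6 (λ s t a b r r′ → (s :* r′ :+ t :* r) :* (a :* b)
                     := (s :* a) :* (r′ :* b) :+ (t :* b) :* (r :* a)) refl s t a b r r′)
      (trans (+-cong (*-congˡ r′b≈c) (*-congˡ ra≈c))
        (trans (sym (distribʳ c _ _)) (trans (*-congʳ e) (*-identityˡ c))))

  -- Non-zero-divisors: the condition imposed on denominators of fractions.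
  Cancellable : Carrier → Set (c Level.⊔ ℓ)
  Cancellable d = ∀ x → x * d ≈ 0# → x ≈ 0#

  cancel : ∀ {d} x y → Cancellable d → x * d ≈ y * d → x ≈ y
  cancel {d} x y cancellable e = trans (solve 2 (λ x y → x := (x :- y) :+ y) refl x y)
    (trans (+-congʳ (cancellable (x - y)
      (trans (solve 3 (λ x y d → (x :- y) :* d := x :* d :- y :* d) refl x y d)
        (trans (+-congʳ e) (-‿inverseʳ (y * d))))))
      (+-identityˡ y))

  cancellable-1 : Cancellable 1#
  cancellable-1 x e = trans (sym (*-identityʳ x)) e

  cancellable-* : ∀ {a b} → Cancellable a → Cancellable b → Cancellable (a * b)
  cancellable-* ca cb x e = ca x (cb _ (trans (*-assoc _ _ _) e))

  cancellable-∣ : ∀ {a b} → a ∣ᴿ b → Cancellable b → Cancellable a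
  cancellable-∣ {a} (r , e) cb x xa≈0 = cb x
    (trans (*-congˡ (sym e)) (trans (solve 3 (λ x r a → x :* (r :* a) := r :* (x :* a)) refl x r a)
      (trans (*-congˡ xa≈0) (zeroʳ r))))

-- Correctness of long division by a monic polynomial.

module MonicDivision where
  open CommutativeRing ℚ[q] using (+-cong; +-congˡ; +-congʳ; *-congˡ; *-congʳ; -‿cong; setoid; *-identityʳ)
  open IntegerSolver ℚ[q]
  open Relation.Binary.Reasoning.Setoid setoid

  -- A condition on the list itself, which must end in 1. Dropping zeros then does nothing, and the
  -- length is the degree plus one, as the division loop expects.
  Monic : Poly → Set
  Monic p = Σ Poly λ low → p ≡ low ++ (1ℚ ∷ [])

  coef-≥length : ∀ p {i} → length p ℕ.≤ i → coef p i ≡ 0ℚ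
  coef-≥length []      _           = ≡.refl
  coef-≥length (a ∷ p) (ℕ.s≤s l≤i) = coef-≥length p l≤i

  coef-++ : ∀ p r i → coef (p ++ r) (length p ℕ.+ i) ≡ coef r i
  coef-++ []      r i = ≡.refl
  coef-++ (a ∷ p) r i = coef-++ p r i

  coef-leading : ∀ low → coef (low ++ (1ℚ ∷ [])) (length low) ≡ 1ℚ
  coef-leading low = ≡.trans (≡.cong (coef (low ++ (1ℚ ∷ []))) (≡.sym (ℕₚ.+-identityʳ (length low))))
                       (coef-++ low (1ℚ ∷ []) 0)

  length-monic : ∀ low → length (low ++ (1ℚ ∷ [])) ≡ suc (length low)
  length-monic low = ≡.trans (Listₚ.length-++ low) (ℕₚ.+-comm (length low) 1)

  module _ (low : Poly) where
    private D = low ++ (1ℚ ∷ [])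

    -- `length low` is the degree of D. The tail of x vanishes by induction, since the head of x
    -- contributes nothing beyond that degree; the head is then read off at that degree, where D has
    -- coefficient 1.
    low-degree⇒zero : ∀ x → (∀ i → length low ℕ.≤ i → coef (x ⊛ D) i ≡ 0ℚ) → x ≋ []
    low-degree⇒zero []      _    = ≋-refl
    low-degree⇒zero (a ∷ x) high = ≋-trans (∷-cong a≡0 x≋[]) (0∷[] ≋-refl)
      where
      expand : ∀ i → coef ((a ∷ x) ⊛ D) i ≡ a ℚ.* coef D i ℚ.+ coef (0ℚ ∷ x ⊛ D) i
      expand i = ≡.trans (coef-⊕ (scale a D) _ i) (≡.cong (ℚ._+ _) (coef-scale a D i))
      x≋[] : x ≋ []
      x≋[] = low-degree⇒zero x λ i l≤i → ≡.trans (≡.sym (ℚₚ.+-identityˡ _))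
        (≡.trans (≡.cong (ℚ._+ coef (x ⊛ D) i)
          (≡.sym (≡.trans (≡.cong (a ℚ.*_) (coef-≥length D (≡.subst (ℕ._≤ suc i) (≡.sym (length-monic low)) (ℕ.s≤s l≤i))))
                          (ℚₚ.*-zeroʳ a))))
        (≡.trans (≡.sym (expand (suc i))) (high (suc i) (ℕₚ.m≤n⇒m≤1+n l≤i))))
      a≡0 : a ≡ 0ℚ
      a≡0 = ≡.trans (≡.sym (≡.trans (≡.cong₂ ℚ._+_ (≡.trans (≡.cong (a ℚ.*_) (coef-leading low)) (ℚₚ.*-identityʳ a))
                                       (at (0∷[] (⊛-zero {x} D x≋[])) (length low)))
                                     (ℚₚ.+-identityʳ a)))
              (≡.trans (≡.sym (expand (length low))) (high (length low) ℕₚ.≤-refl))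

  ∷≋ : ∀ a p → a ∷ p ≋ constP a ⊕ X^ 1 ⊛ p
  ∷≋ a p = ≋-trans (∷-cong (≡.sym (ℚₚ.+-identityʳ a)) (≋-refl {p})) (+-congˡ {constP a} (≋-sym shifted))
    where
    shifted : X^ 1 ⊛ p ≋ 0ℚ ∷ p
    shifted = ≋-trans (shift-⊛ oneP p) (∷-cong ≡.refl (⊛-identityˡ p))

  X^-cong : ∀ {i j} → i ≡ j → X^ i ≋ X^ j
  X^-cong ≡.refl = ≋-refl

  X^-suc : ∀ j → X^ (suc j) ≋ X^ 1 ⊛ X^ j
  X^-suc j = ≋-trans (∷≋ 0ℚ (X^ j)) (⊕-cong (0∷[] {[]} ≋-refl) ≋-refl)

  X^-+ : ∀ i j → X^ (i ℕ.+ j) ≋ X^ i ⊛ X^ j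
  X^-+ zero    j = ≋-sym (⊛-identityˡ (X^ j))
  X^-+ (suc i) j = begin
    X^ (suc (i ℕ.+ j))        ≈⟨ X^-suc (i ℕ.+ j) ⟩
    X^ 1 ⊛ X^ (i ℕ.+ j)       ≈⟨ *-congˡ {X^ 1} (X^-+ i j) ⟩
    X^ 1 ⊛ (X^ i ⊛ X^ j)      ≈⟨ ⊛-assoc (X^ 1) (X^ i) (X^ j) ⟨
    X^ 1 ⊛ X^ i ⊛ X^ j        ≈⟨ *-congʳ (X^-suc i) ⟨
    X^ (suc i) ⊛ X^ j         ∎

  ++≋ : ∀ p r → p ++ r ≋ p ⊕ X^ (length p) ⊛ r
  ++≋ []      r = ≋-sym (⊛-identityˡ r)
  ++≋ (a ∷ p) r = begin
    a ∷ (p ++ r)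
      ≈⟨ ∷≋ a (p ++ r) ⟩
    constP a ⊕ X^ 1 ⊛ (p ++ r)
      ≈⟨ +-congˡ {constP a} (*-congˡ {X^ 1} (++≋ p r)) ⟩
    constP a ⊕ X^ 1 ⊛ (p ⊕ X^ (length p) ⊛ r)
      ≈⟨ solve 5 (λ a x p y r → a :+ x :* (p :+ y :* r) := (a :+ x :* p) :+ (x :* y) :* r) ≋-refl
           (constP a) (X^ 1) p (X^ (length p)) r ⟩
    (constP a ⊕ X^ 1 ⊛ p) ⊕ X^ 1 ⊛ X^ (length p) ⊛ r
      ≈⟨ +-cong (∷≋ a p) (*-congʳ (X^-suc (length p))) ⟨
    (a ∷ p) ⊕ X^ (suc (length p)) ⊛ r ∎

  reverse-∷≋ : ∀ a p → reverse (a ∷ p) ≋ reverse p ⊕ X^ (length p) ⊛ constP a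
  reverse-∷≋ a p rewrite Listₚ.unfold-reverse a p =
    ≋-trans (++≋ (reverse p) (a ∷ []))
      (+-congˡ {reverse p} (*-congʳ (X^-cong (Listₚ.length-reverse p))))

  -- The helpers of monicQuot are private, so they are named here through unification.
  mutual
    quot : ℕ → List ℚ → List ℚ → List ℚ
    quot = _

    monicQuot≡quot : ∀ p d ds → reverse d ≡ 1ℚ ∷ ds → monicQuot p d ≡ quot (length p) ds (reverse p)
    monicQuot≡quot p d ds eq with reverse d | eq
    -- With `length p` and `reverse p` abstracted, `quot` is applied to distinct variables, so
    -- unification has a unique solution.
    ... | _ | ≡.refl with length p | reverse p
    ... | l | rp = ≡.refl

  -- quotLoop acc f ds r z is the quotient being built with the digits acc already
  -- known, the remainder (highest coefficient first) being subFront r z.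
  mutual
    quotLoop : List ℚ → ℕ → List ℚ → List ℚ → List ℚ → List ℚ
    quotLoop = _

    quot-1 : ∀ f ds r → (length r ℕ.<ᵇ length ds) ≡ false →
      quot (suc f) ds (1ℚ ∷ r) ≡ quotLoop (1ℚ ∷ []) f ds r (scale 1ℚ ds)
    quot-1 f ds r eq with length r ℕ.<ᵇ length ds | eq
    ... | false | ≡.refl with scale 1ℚ ds | constP 1ℚ
    ... | z | acc = ≡.refl

  mutual
    subFront : List ℚ → List ℚ → List ℚ
    subFront = _

    quotLoop-subFront : ∀ acc f ds r z → quotLoop acc f ds r z ≡ quotLoop acc f ds (subFront r z) []
    quotLoop-subFront acc f ds r z = ≡.refl

  quotLoop-step : ∀ acc f ds c r → (length r ℕ.<ᵇ length ds) ≡ false →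
    quotLoop acc (suc f) ds (c ∷ r) [] ≡ quotLoop (c ∷ acc) f ds (subFront r (scale c ds)) []
  quotLoop-step acc f ds c r eq with length r ℕ.<ᵇ length ds | eq
  ... | false | ≡.refl = ≡.refl

  quotLoop-stop : ∀ acc f ds c r → (length r ℕ.<ᵇ length ds) ≡ true →
    quotLoop acc (suc f) ds (c ∷ r) [] ≡ acc
  quotLoop-stop acc f ds c r eq with length r ℕ.<ᵇ length ds | eq
  ... | true | ≡.refl = ≡.refl

  length-subFront : ∀ r z → length z ℕ.≤ length r → length (subFront r z) ≡ length r
  length-subFront r       []      _           = ≡.refl
  length-subFront (a ∷ r) (b ∷ z) (ℕ.s≤s z≤r) = ≡.cong suc (length-subFront r z z≤r)

  subFront≋ : ∀ j r z → length r ≡ j ℕ.+ length z → reverse (subFront r z) ≋ reverse r ⊖ X^ j ⊛ reverse z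
  subFront≋ j r [] _ = begin
    reverse r                   ≈⟨ solve 1 (λ r → r := r :- con (+ 0)) ≋-refl (reverse r) ⟩
    reverse r ⊖ []              ≈⟨ +-congˡ {reverse r} (-‿cong (⊛-zeroʳ (X^ j))) ⟨
    reverse r ⊖ X^ j ⊛ []       ∎
  subFront≋ j [] (b ∷ z) eq with ≡.trans eq (ℕₚ.+-suc j (length z))
  ... | ()
  subFront≋ j (a ∷ r) (b ∷ z) eq = begin
    reverse ((a ℚ.- b) ∷ subFront r z)
      ≈⟨ reverse-∷≋ (a ℚ.- b) (subFront r z) ⟩
    reverse (subFront r z) ⊕ X^ (length (subFront r z)) ⊛ (constP a ⊖ constP b)
      ≈⟨ +-cong (subFront≋ j r z r≡) (*-congʳ (X^-cong
           (length-subFront r z (≡.subst (length z ℕ.≤_) (≡.sym r≡) (ℕₚ.m≤n+m _ j))))) ⟩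
    (reverse r ⊖ X^ j ⊛ reverse z) ⊕ X^ (length r) ⊛ (constP a ⊖ constP b)
      ≈⟨ solve 6 (λ r x z y a b → (r :- x :* z) :+ y :* (a :- b) := (r :+ y :* a) :- (x :* z :+ y :* b)) ≋-refl
           (reverse r) (X^ j) (reverse z) (X^ (length r)) (constP a) (constP b) ⟩
    (reverse r ⊕ X^ (length r) ⊛ constP a) ⊖ (X^ j ⊛ reverse z ⊕ X^ (length r) ⊛ constP b)
      ≈⟨ +-congˡ {reverse r ⊕ X^ (length r) ⊛ constP a} (-‿cong (+-congˡ {X^ j ⊛ reverse z} (*-congʳ
           (≋-trans (X^-cong r≡) (X^-+ j (length z)))))) ⟩
    (reverse r ⊕ X^ (length r) ⊛ constP a) ⊖ (X^ j ⊛ reverse z ⊕ X^ j ⊛ X^ (length z) ⊛ constP b)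
      ≈⟨ +-congˡ {reverse r ⊕ X^ (length r) ⊛ constP a} (-‿cong
           (solve 4 (λ x z y b → x :* z :+ x :* y :* b := x :* (z :+ y :* b)) ≋-refl
             (X^ j) (reverse z) (X^ (length z)) (constP b))) ⟩
    (reverse r ⊕ X^ (length r) ⊛ constP a) ⊖ X^ j ⊛ (reverse z ⊕ X^ (length z) ⊛ constP b)
      ≈⟨ +-cong (reverse-∷≋ a r) (-‿cong (*-congˡ {X^ j} (reverse-∷≋ b z))) ⟨
    reverse (a ∷ r) ⊖ X^ j ⊛ reverse (b ∷ z) ∎
    where
    r≡ : length r ≡ j ℕ.+ length z
    r≡ = ℕₚ.suc-injective (≡.trans eq (ℕₚ.+-suc j (length z)))

  reverse-scale : ∀ c p → reverse (scale c p) ≋ constP c ⊛ reverse p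
  reverse-scale c p rewrite ≡.sym (Listₚ.reverse-map (c ℚ.*_) p) = ≋-sym (⊛-constˡ c (reverse p))

  <ᵇ-true : ∀ {m n} → m < n → (m ℕ.<ᵇ n) ≡ true
  <ᵇ-true {m} {n} m<n with m ℕ.<ᵇ n | ℕₚ.<⇒<ᵇ m<n
  ... | true | _ = ≡.refl

  <ᵇ-false : ∀ {m n} → n ℕ.≤ m → (m ℕ.<ᵇ n) ≡ false
  <ᵇ-false {m} {n} n≤m with m ℕ.<ᵇ n in eq
  ... | false = ≡.refl
  ... | true  = ⊥-elim (ℕₚ.<⇒≱ (ℕₚ.<ᵇ⇒< m n (≡.subst Data.Bool.T (≡.sym eq) _)) n≤m)

  -- The invariant of the division loop, k being the degree of D. The field `digits` says that the
  -- digits found so far are the top coefficients of the quotient; a run started with the digit 1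
  -- therefore returns a monic polynomial.
  record Division (D : Poly) (k : ℕ) (value quotient acc : Poly) : Set where
    field
      remainder : Poly
      exact     : quotient ⊛ D ⊕ remainder ≋ value
      small     : ∀ i → k ℕ.≤ i → coef remainder i ≡ 0ℚ
      digits    : Σ Poly λ l → quotient ≡ l ++ acc

  Division-resp : ∀ {D k value x y acc} → x ≡ y → Division D k value y acc → Division D k value x acc
  Division-resp ≡.refl division = division

  -- One step of long division moves c X^j D from the dividend into the quotient, so the total is
  -- unchanged.
  step-value : ∀ ds j c acc r → length r ≡ j ℕ.+ length ds → let D = reverse (1ℚ ∷ ds) in
    X^ j ⊛ (c ∷ acc) ⊛ D ⊕ reverse (subFront r (scale c ds)) ≋ X^ (suc j) ⊛ acc ⊛ D ⊕ reverse (c ∷ r)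
  step-value ds j c acc r r≡ = begin
    X^ j ⊛ (c ∷ acc) ⊛ D ⊕ reverse (subFront r (scale c ds))
      ≈⟨ +-cong (⊛-cong (*-congˡ {X^ j} (∷≋ c acc)) D≋)
           (≋-trans (subFront≋ j r (scale c ds) (≡.trans r≡ (≡.cong (j ℕ.+_) (≡.sym (Listₚ.length-map _ ds)))))
             (+-congˡ {reverse r} (-‿cong (*-congˡ {X^ j} (reverse-scale c ds))))) ⟩
    X^ j ⊛ (constP c ⊕ X^ 1 ⊛ acc) ⊛ (reverse ds ⊕ X^ (length ds) ⊛ oneP) ⊕ (reverse r ⊖ X^ j ⊛ (constP c ⊛ reverse ds))
      ≈⟨ solve 7 (λ x c x₁ acc d k r →
           x :* (c :+ x₁ :* acc) :* (d :+ k :* :1) :+ (r :- x :* (c :* d))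
           := (x₁ :* x) :* acc :* (d :+ k :* :1) :+ (r :+ (x :* k) :* c)) ≋-refl
           (X^ j) (constP c) (X^ 1) acc (reverse ds) (X^ (length ds)) (reverse r) ⟩
    X^ 1 ⊛ X^ j ⊛ acc ⊛ (reverse ds ⊕ X^ (length ds) ⊛ oneP) ⊕ (reverse r ⊕ X^ j ⊛ X^ (length ds) ⊛ constP c)
      ≈⟨ +-cong (⊛-cong (*-congʳ {acc} (X^-suc j)) D≋)
           (≋-trans (reverse-∷≋ c r) (+-congˡ {reverse r} (*-congʳ
             (≋-trans (X^-cong r≡) (X^-+ j (length ds)))))) ⟨
    X^ (suc j) ⊛ acc ⊛ D ⊕ reverse (c ∷ r) ∎
    where
    D = reverse (1ℚ ∷ ds)
    D≋ = reverse-∷≋ 1ℚ ds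

  divide : ∀ ds acc j r f → length r ≡ f → f ≡ j ℕ.+ length ds → let D = reverse (1ℚ ∷ ds) in
    Division D (length ds) (X^ j ⊛ acc ⊛ D ⊕ reverse r) (quotLoop acc f ds r []) acc
  divide ds acc zero r f r≡f f≡ = Division-resp (halts r f r≡f ≡.refl) record
    { remainder = reverse r
    ; exact     = +-congʳ (*-congʳ (≋-sym (⊛-identityˡ acc)))
    ; small     = λ i k≤i → coef-≥length (reverse r)
        (≡.subst (ℕ._≤ i) (≡.sym (≡.trans (Listₚ.length-reverse r) (≡.trans r≡f f≡))) k≤i)
    ; digits    = [] , ≡.refl }
    where
    -- With no digit left to find, either the fuel is spent, when D is constant, or the rest of the
    -- list is shorter than the tail of D and the length test stops the loop.
    halts : ∀ r′ f′ → length r′ ≡ f′ → f′ ≡ f → quotLoop acc f′ ds r′ [] ≡ acc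
    halts []       zero     _ _ = ≡.refl
    halts (c ∷ r′) (suc f′) e e′ = quotLoop-stop acc f′ ds c r′
      (<ᵇ-true (ℕₚ.≤-reflexive (≡.trans e (≡.trans e′ f≡))))
  divide ds acc (suc j) (c ∷ r) (suc f) r≡f f≡ =
    Division-resp (quotLoop-step acc f ds c r k≤r) record
      { remainder = rec.remainder
      ; exact     = ≋-trans rec.exact (step-value ds j c acc r r≡)
      ; small     = rec.small
      ; digits    = proj₁ rec.digits ++ (c ∷ []) ,
          ≡.trans (proj₂ rec.digits) (≡.sym (Listₚ.++-assoc (proj₁ rec.digits) (c ∷ []) acc)) }
    where
    r≡ : length r ≡ j ℕ.+ length ds
    r≡ = ℕₚ.suc-injective (≡.trans r≡f f≡)
    ds≤r : length ds ℕ.≤ length r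
    ds≤r = ≡.subst (length ds ℕ.≤_) (≡.sym r≡) (ℕₚ.m≤n+m _ j)
    k≤r = <ᵇ-false ds≤r
    len : length (subFront r (scale c ds)) ≡ f
    len = ≡.trans (length-subFront r (scale c ds) (≡.subst (ℕ._≤ length r) (≡.sym (Listₚ.length-map _ ds)) ds≤r))
            (ℕₚ.suc-injective r≡f)
    module rec = Division (divide ds (c ∷ acc) j (subFront r (scale c ds)) f len (ℕₚ.suc-injective f≡))

  -- Division gives A = Q D + rem, so (x - Q) D = rem is a multiple of D of degree below that of D,
  -- and rem vanishes. If D had larger degree than A, the same argument would make x, hence A, zero.
  -- As A and D are monic, the first digit of Q is 1.
  monicQuot-exact : ∀ {A D} x → Monic A → Monic D → x ⊛ D ≋ A → (monicQuot A D ⊛ D ≋ A) × Monic (monicQuot A D)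
  monicQuot-exact {A} {D} x (lowA , ≡.refl) (lowD , ≡.refl) xD≋A = Q⊛D≋A , low , Q≡
    where
    ds r : List ℚ
    ds = reverse lowD
    r  = reverse lowA
    reverse-monic : ∀ low → reverse (low ++ (1ℚ ∷ [])) ≡ 1ℚ ∷ reverse low
    reverse-monic low = Listₚ.reverse-++ low (1ℚ ∷ [])
    D≡ : reverse (1ℚ ∷ ds) ≡ D
    D≡ = ≡.trans (≡.cong reverse (≡.sym (reverse-monic lowD))) (Listₚ.reverse-involutive D)
    D≤A : length lowD ℕ.≤ length lowA
    D≤A with length lowD ℕ.≤? length lowA
    ... | yes D≤A = D≤A
    ... | no  D≰A = ⊥-elim (1≢0 (≡.trans (≡.sym (coef-leading lowA)) (at A≋[] (length lowA))))
      where
      1≢0 : ¬ 1ℚ ≡ 0ℚ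
      1≢0 ()
      A≋[] : A ≋ []
      A≋[] = ≋-trans (≋-sym xD≋A) (⊛-zero {x} D (low-degree⇒zero lowD x λ i l≤i →
        ≡.trans (at xD≋A i) (coef-≥length A (≡.subst (ℕ._≤ i) (≡.sym (length-monic lowA))
          (ℕₚ.≤-trans (ℕₚ.≰⇒> D≰A) l≤i)))))
    j : ℕ
    j = length lowA ℕ.∸ length lowD
    len-ds : length ds ≡ length lowD
    len-ds = Listₚ.length-reverse lowD
    len-r : length r ≡ j ℕ.+ length ds
    len-r = ≡.trans (Listₚ.length-reverse lowA)
              (≡.trans (≡.sym (ℕₚ.m∸n+n≡m D≤A)) (≡.cong (j ℕ.+_) (≡.sym len-ds)))
    ds≤r : length ds ℕ.≤ length r
    ds≤r = ≡.subst (length ds ℕ.≤_) (≡.sym len-r) (ℕₚ.m≤n+m _ j)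
    len′ : length (subFront r (scale 1ℚ ds)) ≡ length r
    len′ = length-subFront r (scale 1ℚ ds) (≡.subst (ℕ._≤ length r) (≡.sym (Listₚ.length-map _ ds)) ds≤r)
    Q : Poly
    Q = monicQuot A D
    Q≡loop : Q ≡ quotLoop (1ℚ ∷ []) (length r) ds (subFront r (scale 1ℚ ds)) []
    Q≡loop = ≡.trans (monicQuot≡quot A D ds (reverse-monic lowD))
      (≡.trans (≡.cong₂ (λ l → quot l ds) (≡.trans (length-monic lowA) (≡.cong suc (≡.sym (Listₚ.length-reverse lowA))))
                 (reverse-monic lowA))
        (quot-1 (length r) ds r (<ᵇ-false ds≤r)))
    module division = Division (divide ds (1ℚ ∷ []) j (subFront r (scale 1ℚ ds)) (length r) len′ len-r)
    low : Poly
    low = proj₁ division.digits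
    Q≡ : Q ≡ low ++ (1ℚ ∷ [])
    Q≡ = ≡.trans Q≡loop (proj₂ division.digits)
    A≋ : reverse (1ℚ ∷ r) ≋ A
    A≋ = mk λ i → ≡.cong (λ p → coef p i)
      (≡.trans (≡.cong reverse (≡.sym (reverse-monic lowA))) (Listₚ.reverse-involutive A))
    rem : Poly
    rem = division.remainder
    QD+rem : Q ⊛ D ⊕ rem ≋ A
    QD+rem = begin
      Q ⊛ D ⊕ rem
        ≡⟨ ≡.cong₂ (λ x y → x ⊛ y ⊕ rem) Q≡loop (≡.sym D≡) ⟩
      quotLoop (1ℚ ∷ []) (length r) ds (subFront r (scale 1ℚ ds)) [] ⊛ reverse (1ℚ ∷ ds) ⊕ rem
        ≈⟨ division.exact ⟩
      X^ j ⊛ (1ℚ ∷ []) ⊛ reverse (1ℚ ∷ ds) ⊕ reverse (subFront r (scale 1ℚ ds))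
        ≈⟨ step-value ds j 1ℚ [] r len-r ⟩
      X^ (suc j) ⊛ [] ⊛ reverse (1ℚ ∷ ds) ⊕ reverse (1ℚ ∷ r)
        ≈⟨ +-congʳ (⊛-zero {X^ (suc j) ⊛ []} _ (⊛-zeroʳ (X^ (suc j)))) ⟩
      reverse (1ℚ ∷ r)
        ≈⟨ A≋ ⟩
      A ∎
    difference : (x ⊖ Q) ⊛ D ≋ rem
    difference = begin
      (x ⊖ Q) ⊛ D                    ≈⟨ solve 4 (λ x Q D r → (x :- Q) :* D := (x :* D) :- (Q :* D :+ r) :+ r) ≋-refl x Q D rem ⟩
      x ⊛ D ⊖ (Q ⊛ D ⊕ rem) ⊕ rem    ≈⟨ +-congʳ {rem} (+-cong xD≋A (-‿cong QD+rem)) ⟩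
      A ⊖ A ⊕ rem                    ≈⟨ solve 2 (λ A r → A :- A :+ r := r) ≋-refl A rem ⟩
      rem                            ∎
    rem≋[] : rem ≋ []
    rem≋[] = ≋-trans (≋-sym difference) (⊛-zero {x ⊖ Q} D (low-degree⇒zero lowD (x ⊖ Q) λ i l≤i →
      ≡.trans (at difference i) (division.small i (≡.subst (ℕ._≤ i) (≡.sym len-ds) l≤i))))
    Q⊛D≋A : Q ⊛ D ≋ A
    Q⊛D≋A = ≋-trans (≋-sym (⊕-identityʳ (Q ⊛ D))) (≋-trans (+-congˡ {Q ⊛ D} (≋-sym rem≋[])) QD+rem)

-- Cyclotomic polynomials: product formula and coprimality.

module Cyclotomic where
  open CommutativeRing ℚ[q] using (+-cong; +-congˡ; +-congʳ; *-congˡ; *-congʳ; -‿cong; setoid; *-identityʳ)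
  open IntegerSolver ℚ[q]
  open Coprimality ℚ[q]
  open MonicDivision
  open Relation.Binary.Reasoning.Setoid setoid

  Z : ℕ → Poly
  Z m = X^ m ⊖ oneP

  -- As for monicQuot, the private helper prodDivs of cycs is named through unification.
  mutual
    divisorProduct₁ : ℕ → List Poly → Poly
    divisorProduct₁ = _

    cycs-suc : ∀ m → cycs (suc m) ≡ cycs m ++ (monicQuot (Z (suc m)) (divisorProduct₁ m (cycs m)) ∷ [])
    cycs-suc m with cycs m | reverse {A = ℚ}
    ... | ps | φ = ≡.refl

  mutual
    divisorProduct : ℕ → ℕ → List Poly → Poly
    divisorProduct = _

    divisorProduct₁≡ : ∀ m ps → divisorProduct₁ m ps ≡ divisorProduct m 1 ps
    divisorProduct₁≡ m ps with 1
    ... | i = ≡.refl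

  last-∷ʳ : ∀ {a} {A : Set a} (xs : List A) x → List.last (xs ++ (x ∷ [])) ≡ just x
  last-∷ʳ []           x = ≡.refl
  last-∷ʳ (y ∷ [])     x = ≡.refl
  last-∷ʳ (y ∷ z ∷ xs) x = last-∷ʳ (z ∷ xs) x

  Φ-suc : ∀ m → Φ (suc m) ≡ monicQuot (Z (suc m)) (divisorProduct m 1 (cycs m))
  Φ-suc m with List.last (cycs (suc m)) | ≡.trans (≡.cong List.last (cycs-suc m)) (last-∷ʳ (cycs m) _)
  ... | _ | ≡.refl = ≡.cong (monicQuot (Z (suc m))) (divisorProduct₁≡ m (cycs m))

  cycs-∷ʳ : ∀ m → cycs (suc m) ≡ cycs m ++ (Φ (suc m) ∷ [])
  cycs-∷ʳ m = ≡.trans (cycs-suc m) (≡.cong (λ p → cycs m ++ (p ∷ []))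
    (≡.trans (≡.cong (monicQuot (Z (suc m))) (divisorProduct₁≡ m (cycs m))) (≡.sym (Φ-suc m))))

  length-cycs : ∀ m → length (cycs m) ≡ m
  length-cycs zero    = ≡.refl
  length-cycs (suc m) = ≡.trans (≡.cong length (cycs-suc m))
    (≡.trans (Listₚ.length-++ (cycs m)) (≡.trans (ℕₚ.+-comm _ 1) (≡.cong suc (length-cycs m))))

  choose : ℕ → ℕ → Poly → Poly
  choose n i p = if does (i ∣? n) then p else oneP

  choose-yes : ∀ n i p → i ∣ n → choose n i p ≡ p
  choose-yes n i p i∣n with i ∣? n
  ... | yes _   = ≡.refl
  ... | no  i∤n = ⊥-elim (i∤n i∣n)

  choose-elim : ∀ (P : Poly → Set) n i p → (i ∣ n → P p) → (¬ i ∣ n → P oneP) → P (choose n i p)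
  choose-elim P n i p y z with i ∣? n
  ... | yes i∣n = y i∣n
  ... | no  i∤n = z i∤n

  ∏ : ℕ → ℕ → Poly
  ∏ n zero    = oneP
  ∏ n (suc k) = ∏ n k ⊛ choose n (suc k) (Φ (suc k))

  -- `cycs` grows at its end, while the product is computed from the front with a running index; the
  -- new factor therefore meets the index `length ps + i`.
  divisorProduct-∷ʳ : ∀ m i ps p →
    divisorProduct m i (ps ++ (p ∷ [])) ≋ divisorProduct m i ps ⊛ choose (suc m) (length ps ℕ.+ i) p
  divisorProduct-∷ʳ m i []       p = ⊛-comm (choose (suc m) i p) oneP
  divisorProduct-∷ʳ m i (r ∷ ps) p = begin
    c ⊛ divisorProduct m (suc i) (ps ++ (p ∷ []))
      ≈⟨ *-congˡ {c} (divisorProduct-∷ʳ m (suc i) ps p) ⟩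
    c ⊛ (divisorProduct m (suc i) ps ⊛ choose (suc m) (length ps ℕ.+ suc i) p)
      ≈⟨ ⊛-assoc c (divisorProduct m (suc i) ps) _ ⟨
    c ⊛ divisorProduct m (suc i) ps ⊛ choose (suc m) (length ps ℕ.+ suc i) p
      ≡⟨ ≡.cong (λ j → c ⊛ divisorProduct m (suc i) ps ⊛ choose (suc m) j p) (ℕₚ.+-suc (length ps) i) ⟩
    c ⊛ divisorProduct m (suc i) ps ⊛ choose (suc m) (suc (length ps ℕ.+ i)) p ∎
    where c = choose (suc m) i r

  divisorProduct-cycs : ∀ m k → divisorProduct m 1 (cycs k) ≋ ∏ (suc m) k
  divisorProduct-cycs m zero    = ≋-refl
  divisorProduct-cycs m (suc k) = begin
    divisorProduct m 1 (cycs (suc k))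
      ≡⟨ ≡.cong (divisorProduct m 1) (cycs-∷ʳ k) ⟩
    divisorProduct m 1 (cycs k ++ (Φ (suc k) ∷ []))
      ≈⟨ divisorProduct-∷ʳ m 1 (cycs k) (Φ (suc k)) ⟩
    divisorProduct m 1 (cycs k) ⊛ choose (suc m) (length (cycs k) ℕ.+ 1) (Φ (suc k))
      ≡⟨ ≡.cong (λ j → divisorProduct m 1 (cycs k) ⊛ choose (suc m) j (Φ (suc k)))
           (≡.trans (≡.cong (ℕ._+ 1) (length-cycs k)) (ℕₚ.+-comm k 1)) ⟩
    divisorProduct m 1 (cycs k) ⊛ choose (suc m) (suc k) (Φ (suc k))
      ≈⟨ *-congʳ (divisorProduct-cycs m k) ⟩
    ∏ (suc m) (suc k) ∎

  ⊕-[] : ∀ p → p ⊕ [] ≡ p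
  ⊕-[] []      = ≡.refl
  ⊕-[] (a ∷ p) = ≡.refl

  scale-1≡ : ∀ p → scale 1ℚ p ≡ p
  scale-1≡ []      = ≡.refl
  scale-1≡ (a ∷ p) = ≡.cong₂ _∷_ (ℚₚ.*-identityˡ a) (scale-1≡ p)

  ⊕-monic : ∀ p low → length p ℕ.≤ length low →
    Σ Poly λ l → (p ⊕ (low ++ (1ℚ ∷ [])) ≡ l ++ (1ℚ ∷ [])) × (length l ≡ length low)
  ⊕-monic []      low       _           = low , ≡.refl , ≡.refl
  ⊕-monic (a ∷ p) (b ∷ low) (ℕ.s≤s p≤l) =
    let l , e , e′ = ⊕-monic p low p≤l in (a ℚ.+ b) ∷ l , ≡.cong (_ ∷_) e , ≡.cong suc e′

  ⊛-monic′ : ∀ low low′ → let r = low′ ++ (1ℚ ∷ []) in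
    Σ Poly λ l → ((low ++ (1ℚ ∷ [])) ⊛ r ≡ l ++ (1ℚ ∷ [])) × (length l ≡ length low ℕ.+ length low′)
  ⊛-monic′ [] low′ = low′ , ≡.trans (≡.cong (_⊕ (0ℚ ∷ [])) (scale-1≡ _)) (⊕-0∷[] low′) , ≡.refl
    where
    ⊕-0∷[] : ∀ low → (low ++ (1ℚ ∷ [])) ⊕ (0ℚ ∷ []) ≡ low ++ (1ℚ ∷ [])
    ⊕-0∷[] []        = ≡.refl
    ⊕-0∷[] (a ∷ low) = ≡.cong₂ _∷_ (ℚₚ.+-identityʳ a) (⊕-[] _)
  ⊛-monic′ (a ∷ low) low′ =
    let l , e , e′   = ⊛-monic′ low low′
        l″ , e″ , e‴ = ⊕-monic (scale a (low′ ++ (1ℚ ∷ []))) (0ℚ ∷ l) (short e′)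
    in l″ , ≡.trans (≡.cong (λ p → scale a (low′ ++ (1ℚ ∷ [])) ⊕ (0ℚ ∷ p)) e) e″ , ≡.trans e‴ (≡.cong suc e′)
    where
    short : ∀ {l} → l ≡ length low ℕ.+ length low′ → length (scale a (low′ ++ (1ℚ ∷ []))) ℕ.≤ suc l
    short ≡.refl rewrite Listₚ.length-map (a ℚ.*_) (low′ ++ (1ℚ ∷ [])) | length-monic low′ =
      ℕ.s≤s (ℕₚ.m≤n+m _ (length low))

  ⊛-monic : ∀ {p r} → Monic p → Monic r → Monic (p ⊛ r)
  ⊛-monic (low , ≡.refl) (low′ , ≡.refl) = let l , e , _ = ⊛-monic′ low low′ in l , e

  monic-1 : Monic oneP
  monic-1 = [] , ≡.refl

  monic-Z : ∀ m → Monic (Z (suc m))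
  monic-Z m = (0ℚ ℚ.- 1ℚ) ∷ List.replicate m 0ℚ , ≡.cong (_ ∷_) (⊕-[] _)

  monic-divisorProduct : ∀ m i ps → All Monic ps → Monic (divisorProduct m i ps)
  monic-divisorProduct m i []       []         = monic-1
  monic-divisorProduct m i (p ∷ ps) (mp ∷ mps) = ⊛-monic (chosen (does (i ∣? suc m))) (monic-divisorProduct m (suc i) ps mps)
    where
    chosen : ∀ b → Monic (if b then p else oneP)
    chosen true  = mp
    chosen false = monic-1

  -- The constant coefficient of x (c + q d) is that of x times c, so the lowest coefficient of x
  -- vanishes and can be stripped. The denominators 1 + q, 1 - q^m and their products all have
  -- nonzero constant coefficient.
  cancellable-∷ : ∀ c d → ¬ c ≡ 0ℚ → Cancellable (c ∷ d)
  cancellable-∷ c d c≢0 []      e = ≋-refl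
  cancellable-∷ c d c≢0 (a ∷ x) e = ≋-trans (∷-cong a≡0 (cancellable-∷ c d c≢0 x x⊛d)) (0∷[] ≋-refl)
    where
    instance _ = ℚ.≢-nonZero c≢0
    a≡0 : a ≡ 0ℚ
    a≡0 = E.begin
      a                              E.≡⟨ ℚₚ.*-identityʳ a ⟨
      a ℚ.* 1ℚ                       E.≡⟨ ≡.cong (a ℚ.*_) (ℚₚ.*-inverseʳ c) ⟨
      a ℚ.* (c ℚ.* (ℚ.1/ c))         E.≡⟨ ℚₚ.*-assoc a c (ℚ.1/ c) ⟨
      a ℚ.* c ℚ.* (ℚ.1/ c)           E.≡⟨ ≡.cong (ℚ._* (ℚ.1/ c)) (ℚₚ.+-identityʳ (a ℚ.* c)) ⟨
      (a ℚ.* c ℚ.+ 0ℚ) ℚ.* (ℚ.1/ c)  E.≡⟨ ≡.cong (ℚ._* (ℚ.1/ c)) (at e 0) ⟩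
      0ℚ ℚ.* (ℚ.1/ c)                E.≡⟨ ℚₚ.*-zeroˡ (ℚ.1/ c) ⟩
      0ℚ                             E.∎
      where module E = ≡.≡-Reasoning
    x⊛d : x ⊛ (c ∷ d) ≋ []
    x⊛d = ≋-trans (≋-sym (+-congʳ (≋-trans (scale-cong {a} {0ℚ} {d} a≡0 ≋-refl) (scale-0 d)))) (mk λ i → at e (suc i))

  -1≢0 : ¬ (0ℚ ℚ.- 1ℚ) ≡ 0ℚ
  -1≢0 ()

  cancellable-Z : ∀ m → Cancellable (Z (suc m))
  cancellable-Z m = cancellable-∷ (0ℚ ℚ.- 1ℚ) _ -1≢0

  Z-+ : ∀ i j → Z (i ℕ.+ j) ≋ Z i ⊕ X^ i ⊛ Z j
  Z-+ i j = ≋-trans (+-congʳ (X^-+ i j))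
    (solve 2 (λ x y → x :* y :- :1 := (x :- :1) :+ x :* (y :- :1)) ≋-refl (X^ i) (X^ j))

  geometric : ℕ → ℕ → Poly
  geometric g zero    = []
  geometric g (suc c) = oneP ⊕ X^ g ⊛ geometric g c

  Z-* : ∀ g c → Z (c ℕ.* g) ≋ geometric g c ⊛ Z g
  Z-* g zero    = negP-inverseʳ oneP
  Z-* g (suc c) = begin
    Z (g ℕ.+ c ℕ.* g)                  ≈⟨ Z-+ g (c ℕ.* g) ⟩
    Z g ⊕ X^ g ⊛ Z (c ℕ.* g)           ≈⟨ +-congˡ {Z g} (*-congˡ {X^ g} (Z-* g c)) ⟩
    Z g ⊕ X^ g ⊛ (geometric g c ⊛ Z g) ≈⟨ solve 3 (λ z x e → z :+ x :* (e :* z) := (:1 :+ x :* e) :* z) ≋-refl (Z g) (X^ g) (geometric g c) ⟩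
    geometric g (suc c) ⊛ Z g          ∎

  fromℕ : ℕ → ℚ
  fromℕ zero    = 0ℚ
  fromℕ (suc c) = 1ℚ ℚ.+ fromℕ c

  fromℕ-suc≢0 : ∀ c → ¬ fromℕ (suc c) ≡ 0ℚ
  fromℕ-suc≢0 c e = ℚₚ.<-irrefl (≡.sym e) (0<1+ c)
    where
    0<1+ : ∀ c → 0ℚ ℚ.< fromℕ (suc c)
    0<1+ zero    = ℚₚ.positive⁻¹ (fromℕ 1)
    0<1+ (suc c) = ℚₚ.+-mono-<-≤ (ℚₚ.positive⁻¹ 1ℚ) (ℚₚ.<⇒≤ (0<1+ c))

  -- Modulo X^g - 1 the cofactor (X^(cg) - 1)/(X^g - 1) is the constant c.
  geometric-mod : ∀ g c → Σ Poly λ r → geometric g c ≋ constP (fromℕ c) ⊕ r ⊛ Z g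
  geometric-mod g zero    = [] , mk λ { zero → ≡.refl ; (suc i) → ≡.refl }
  geometric-mod g (suc c) = let r , e = geometric-mod g c in constP (fromℕ c) ⊕ r ⊕ Z g ⊛ r , (begin
    oneP ⊕ X^ g ⊛ geometric g c
      ≈⟨ +-congˡ {oneP} (*-congˡ {X^ g} e) ⟩
    oneP ⊕ X^ g ⊛ (constP (fromℕ c) ⊕ r ⊛ Z g)
      ≈⟨ solve 3 (λ x k r → let z = x :- :1 in :1 :+ x :* (k :+ r :* z) := (:1 :+ k) :+ (k :+ r :+ z :* r) :* z) ≋-refl
           (X^ g) (constP (fromℕ c)) r ⟩
    (oneP ⊕ constP (fromℕ c)) ⊕ (constP (fromℕ c) ⊕ r ⊕ Z g ⊛ r) ⊛ Z g ∎)

  constP-inverse : ∀ {c} → ¬ c ≡ 0ℚ → Σ ℚ λ c⁻¹ → constP c⁻¹ ⊛ constP c ≋ oneP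
  constP-inverse {c} c≢0 = ℚ.1/ c , ∷-cong (≡.trans (ℚₚ.+-identityʳ _) (ℚₚ.*-inverseˡ c)) ≋-refl
    where instance _ = ℚ.≢-nonZero c≢0

  -- Modulo Z g the cofactor is the constant c + 1, which is invertible because the coefficients
  -- have characteristic 0.
  geometric-coprime : ∀ g c → Coprime (geometric g (suc c)) (Z g)
  geometric-coprime g c =
    let r , e   = geometric-mod g (suc c)
        k , k-1 = constP-inverse (fromℕ-suc≢0 c)
    in k-coprime (constP (fromℕ (suc c))) (constP k) r e k-1
    where
    k-coprime : ∀ κ k r → geometric g (suc c) ≋ κ ⊕ r ⊛ Z g → k ⊛ κ ≋ oneP → Coprime (geometric g (suc c)) (Z g)
    k-coprime κ k r e k-1 = k , negP (k ⊛ r) , (begin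
      k ⊛ geometric g (suc c) ⊕ negP (k ⊛ r) ⊛ Z g      ≈⟨ +-congʳ (*-congˡ {k} e) ⟩
      k ⊛ (κ ⊕ r ⊛ Z g) ⊕ negP (k ⊛ r) ⊛ Z g            ≈⟨ solve 4 (λ k κ r z → k :* (κ :+ r :* z) :+ (:- (k :* r)) :* z := k :* κ) ≋-refl k κ r (Z g) ⟩
      k ⊛ κ                                             ≈⟨ k-1 ⟩
      oneP                                              ∎)

  Z-∣ : ∀ e n → e ∣ n → Z e ∣ᴿ Z n
  Z-∣ e n (divides c ≡.refl) = geometric e c , ≋-sym (Z-* e c)

  -- `coprime` covers all exponents m at once. This implies coprimality to every Φ_e with e < d, and
  -- it is the form in which both the induction and the denominators of the theorem use it.
  record IsCyclotomic (d : ℕ) : Set where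
    field
      monic   : Monic (Φ d)
      product : ∏ d d ≋ Z d
      coprime : ∀ m → ¬ d ∣ m → Coprime (Z m) (Φ d)

  open IsCyclotomic

  Φ∣Z : ∀ {d} → IsCyclotomic d → Φ d ∣ᴿ Z d
  Φ∣Z {zero}  _  = Z 0 , *-identityʳ (Z 0)
  Φ∣Z {suc k} cd = ∏ (suc k) k ,
    ≋-trans (*-congˡ {∏ (suc k) k} (mk λ i → ≡.cong (λ p → coef p i) (≡.sym (choose-yes (suc k) (suc k) (Φ (suc k)) Div.∣-refl)))) (product cd)

  ∏-mono : ∀ {g n} j k → g ∣ n → ∏ g j ∣ᴿ ∏ n (k ℕ.+ j)
  ∏-mono {g} {n} zero    zero    g∣n = ∣-refl
  ∏-mono {g} {n} (suc j) zero    g∣n = ∣-*-mono (∏-mono j 0 g∣n) chosen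
    where
    chosen : choose g (suc j) (Φ (suc j)) ∣ᴿ choose n (suc j) (Φ (suc j))
    chosen = choose-elim (_∣ᴿ choose n (suc j) (Φ (suc j))) g (suc j) (Φ (suc j))
      (λ j∣g → ∣-resp ≋-refl (mk λ i → ≡.cong (λ p → coef p i) (≡.sym (choose-yes n (suc j) (Φ (suc j)) (Div.∣-trans j∣g g∣n)))) ∣-refl)
      (λ _ → choose n (suc j) (Φ (suc j)) , *-identityʳ _)
  ∏-mono {g} {n} j       (suc k) g∣n = ∣-resp ≋-refl (⊛-comm _ (∏ n (k ℕ.+ j)))
    (∣-*ˡ (choose n (suc (k ℕ.+ j)) (Φ (suc (k ℕ.+ j)))) (∏-mono j k g∣n))

  module Step (m : ℕ) (smaller : ∀ e → 1 ℕ.≤ e → e ℕ.≤ m → IsCyclotomic e) where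
    d = suc m

    -- Each factor Φ_i with i at most k divides Z i, and k + 1 does not divide i, so the coprimality
    -- of Z i and Φ_(k+1) passes to Φ_i.
    ∏-coprime : ∀ k → suc k ℕ.≤ m → ∀ j → j ℕ.≤ k → Coprime (∏ d j) (Φ (suc k))
    ∏-coprime k k<m zero    _   = coprime-1
    ∏-coprime k k<m (suc j) j≤k = coprime-* (∏-coprime k k<m j (ℕₚ.<⇒≤ j≤k)) chosen
      where
      chosen : Coprime (choose d (suc j) (Φ (suc j))) (Φ (suc k))
      chosen = choose-elim (λ p → Coprime p (Φ (suc k))) d (suc j) (Φ (suc j))
        (λ _ → coprime-∣ (Φ∣Z (smaller (suc j) (ℕ.s≤s ℕ.z≤n) (ℕₚ.≤-trans j≤k (ℕₚ.<⇒≤ k<m))))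
          (coprime (smaller (suc k) (ℕ.s≤s ℕ.z≤n) k<m) (suc j) λ k∣j → ℕₚ.<⇒≱ (ℕ.s≤s j≤k) (Div.∣⇒≤ k∣j)))
        (λ _ → coprime-1)

    -- The factors divide Z d one by one and are coprime to each other, so their product divides Z
    -- d. This is the exactness required by `monicQuot-exact`.
    ∏∣Z : ∀ k → k ℕ.≤ m → ∏ d k ∣ᴿ Z d
    ∏∣Z zero    _   = Z d , *-identityʳ (Z d)
    ∏∣Z (suc k) k<m = choose-elim (λ p → ∏ d k ⊛ p ∣ᴿ Z d) d (suc k) (Φ (suc k))
      (λ k∣d → coprime-∣-* (∏-coprime k k<m k ℕₚ.≤-refl) (∏∣Z k (ℕₚ.<⇒≤ k<m))
                 (∣-trans (Φ∣Z (smaller (suc k) (ℕ.s≤s ℕ.z≤n) k<m)) (Z-∣ (suc k) d k∣d)))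
      (λ _ → ∣-resp (≋-sym (*-identityʳ (∏ d k))) ≋-refl (∏∣Z k (ℕₚ.<⇒≤ k<m)))

    monic-cycs : ∀ k → k ℕ.≤ m → All Monic (cycs k)
    monic-cycs zero    _   = []
    monic-cycs (suc k) k<m = ≡.subst (All Monic) (≡.sym (cycs-∷ʳ k))
      (Allₚ.++⁺ (monic-cycs k (ℕₚ.<⇒≤ k<m)) (monic (smaller (suc k) (ℕ.s≤s ℕ.z≤n) k<m) ∷ []))

    quotient : (monicQuot (Z d) (divisorProduct m 1 (cycs m)) ⊛ divisorProduct m 1 (cycs m) ≋ Z d)
             × Monic (monicQuot (Z d) (divisorProduct m 1 (cycs m)))
    quotient = let x , e = ∏∣Z m ℕₚ.≤-refl in
      monicQuot-exact x (monic-Z m) (monic-divisorProduct m 1 (cycs m) (monic-cycs m ℕₚ.≤-refl))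
        (≋-trans (*-congˡ {x} (divisorProduct-cycs m m)) e)

    Φ-monic : Monic (Φ d)
    Φ-monic = ≡.subst Monic (≡.sym (Φ-suc m)) (proj₂ quotient)

    Φ⊛∏ : Φ d ⊛ ∏ d m ≋ Z d
    Φ⊛∏ = begin
      Φ d ⊛ ∏ d m                          ≈⟨ *-congˡ {Φ d} (divisorProduct-cycs m m) ⟨
      Φ d ⊛ divisorProduct m 1 (cycs m)    ≡⟨ ≡.cong (_⊛ divisorProduct m 1 (cycs m)) (Φ-suc m) ⟩
      monicQuot (Z d) (divisorProduct m 1 (cycs m)) ⊛ divisorProduct m 1 (cycs m) ≈⟨ proj₁ quotient ⟩
      Z d                                  ∎

    product-d : ∏ d d ≋ Z d
    product-d = begin
      ∏ d m ⊛ choose d d (Φ d)   ≡⟨ ≡.cong (∏ d m ⊛_) (choose-yes d d (Φ d) Div.∣-refl) ⟩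
      ∏ d m ⊛ Φ d                ≈⟨ ⊛-comm (∏ d m) (Φ d) ⟩
      Φ d ⊛ ∏ d m                ≈⟨ Φ⊛∏ ⟩
      Z d                        ∎

    -- Z g is the product of the Φ_e with e ∣ g, all of which occur in `∏ d m`. Cancelling Z g from
    -- Φ_d `∏ d m` = Z d shows that Φ_d divides (q^d - 1)/(q^g - 1), and this is coprime to Z g by
    -- `geometric-coprime`.
    coprime-proper : ∀ g → g ∣ d → suc g ℕ.≤ d → Coprime (Z g) (Φ d)
    coprime-proper zero    (divides c e) _ with ≡.trans e (ℕₚ.*-zeroʳ c)
    ... | ()
    coprime-proper (suc g) (divides zero ()) _
    coprime-proper (suc g) g∣d@(divides (suc c) d≡) (ℕ.s≤s g<d) =
      coprime-sym (coprime-∣ Φ∣E (geometric-coprime (suc g) c))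
      where
      Zg∣∏ : Z (suc g) ∣ᴿ ∏ d m
      Zg∣∏ = ∣-resp (product (smaller (suc g) (ℕ.s≤s ℕ.z≤n) g<d))
        (mk λ i → ≡.cong (λ k → coef (∏ d k) i) (ℕₚ.m∸n+n≡m g<d)) (∏-mono (suc g) (m ℕ.∸ suc g) g∣d)
      Φ∣E : Φ d ∣ᴿ geometric (suc g) (suc c)
      Φ∣E = let B , e = Zg∣∏ in B , cancel (B ⊛ Φ d) (geometric (suc g) (suc c)) (cancellable-Z g) (begin
        B ⊛ Φ d ⊛ Z (suc g)                    ≈⟨ solve 3 (λ b f z → b :* f :* z := f :* (b :* z)) ≋-refl B (Φ d) (Z (suc g)) ⟩
        Φ d ⊛ (B ⊛ Z (suc g))                  ≈⟨ *-congˡ {Φ d} e ⟩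
        Φ d ⊛ ∏ d m                            ≈⟨ Φ⊛∏ ⟩
        Z d                                    ≡⟨ ≡.cong Z d≡ ⟩
        Z (suc c ℕ.* suc g)                    ≈⟨ Z-* (suc g) (suc c) ⟩
        geometric (suc g) (suc c) ⊛ Z (suc g)  ∎)

    -- The ideal of X^d - 1 and X^m - 1 contains X^gcd - 1, by Bézout on the exponents.
    Φ-coprime : ∀ n → ¬ d ∣ n → Coprime (Z n) (Φ d)
    Φ-coprime n d∤n = combine (GCD.Bézout.identity (GCD.gcd-GCD d n))
      where
      g = GCD.gcd d n
      g∣d = GCD.gcd[m,n]∣m d n
      Zg : Coprime (Z g) (Φ d)
      Zg = coprime-proper g g∣d (ℕₚ.≤∧≢⇒< (Div.∣⇒≤ g∣d)
             λ g≡d → d∤n (≡.subst (_∣ n) g≡d (GCD.gcd[m,n]∣n d n)))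
      Zg≋ : ∀ j → Z g ≋ Z (g ℕ.+ j) ⊖ X^ g ⊛ Z j
      Zg≋ j = begin
        Z g                                ≈⟨ solve 2 (λ z w → z := (z :+ w) :- w) ≋-refl (Z g) (X^ g ⊛ Z j) ⟩
        (Z g ⊕ X^ g ⊛ Z j) ⊖ X^ g ⊛ Z j    ≈⟨ +-congʳ (Z-+ g j) ⟨
        Z (g ℕ.+ j) ⊖ X^ g ⊛ Z j           ∎
      ZΦ : Σ Poly λ B → B ⊛ Φ d ≋ Z d
      ZΦ = ∏ d m , ≋-trans (⊛-comm (∏ d m) (Φ d)) Φ⊛∏
      B = proj₁ ZΦ
      Z-xd : ∀ x → Z (x ℕ.* d) ≋ (geometric d x ⊛ B) ⊛ Φ d
      Z-xd x = ≋-trans (Z-* d x) (≋-trans (*-congˡ {geometric d x} (≋-sym (proj₂ ZΦ))) (≋-sym (⊛-assoc (geometric d x) B (Φ d))))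
      combine : GCD.Bézout.Identity g d n → Coprime (Z n) (Φ d)
      combine (GCD.Bézout.+- x y eq) = coprime-combination (negP (X^ g ⊛ geometric n y)) (geometric d x ⊛ B) (begin
        Z g                                        ≈⟨ Zg≋ (y ℕ.* n) ⟩
        Z (g ℕ.+ y ℕ.* n) ⊖ X^ g ⊛ Z (y ℕ.* n)     ≡⟨ ≡.cong (λ k → Z k ⊖ X^ g ⊛ Z (y ℕ.* n)) eq ⟩
        Z (x ℕ.* d) ⊖ X^ g ⊛ Z (y ℕ.* n)           ≈⟨ +-cong (Z-xd x) (-‿cong (*-congˡ {X^ g} (Z-* n y))) ⟩
        (geometric d x ⊛ B) ⊛ Φ d ⊖ X^ g ⊛ (geometric n y ⊛ Z n)
          ≈⟨ solve 5 (λ a f x e z → a :* f :- x :* (e :* z) := (:- (x :* e)) :* z :+ a :* f) ≋-refl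
               (geometric d x ⊛ B) (Φ d) (X^ g) (geometric n y) (Z n) ⟩
        negP (X^ g ⊛ geometric n y) ⊛ Z n ⊕ (geometric d x ⊛ B) ⊛ Φ d ∎) Zg
      combine (GCD.Bézout.-+ x y eq) = coprime-combination (geometric n y) (negP (X^ g ⊛ (geometric d x ⊛ B))) (begin
        Z g                                        ≈⟨ Zg≋ (x ℕ.* d) ⟩
        Z (g ℕ.+ x ℕ.* d) ⊖ X^ g ⊛ Z (x ℕ.* d)     ≡⟨ ≡.cong (λ k → Z k ⊖ X^ g ⊛ Z (x ℕ.* d)) eq ⟩
        Z (y ℕ.* n) ⊖ X^ g ⊛ Z (x ℕ.* d)           ≈⟨ +-cong (Z-* n y) (-‿cong (*-congˡ {X^ g} (Z-xd x))) ⟩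
        geometric n y ⊛ Z n ⊖ X^ g ⊛ ((geometric d x ⊛ B) ⊛ Φ d)
          ≈⟨ solve 4 (λ w x a f → w :- x :* (a :* f) := w :+ (:- (x :* a)) :* f) ≋-refl
               (geometric n y ⊛ Z n) (X^ g) (geometric d x ⊛ B) (Φ d) ⟩
        geometric n y ⊛ Z n ⊕ negP (X^ g ⊛ (geometric d x ⊛ B)) ⊛ Φ d ∎) Zg

    isCyclotomic : IsCyclotomic d
    isCyclotomic = record { monic = Φ-monic ; product = product-d ; coprime = Φ-coprime }

  isCyclotomic : ∀ N d → 1 ℕ.≤ d → d ℕ.≤ N → IsCyclotomic d
  isCyclotomic zero    zero    ()  _
  isCyclotomic (suc N) d       1≤d d≤N with ℕₚ.m≤n⇒m<n∨m≡n d≤N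
  ... | inj₁ (ℕ.s≤s d≤N′) = isCyclotomic N d 1≤d d≤N′
  ... | inj₂ ≡.refl       = Step.isCyclotomic N (isCyclotomic N)

-- The substitution q ↦ -q as a ring homomorphism.

module SubstNeg where
  open CommutativeRing ℚ[q] using (+-cong; +-congˡ; +-congʳ; *-congˡ; *-congʳ; setoid)
  open IntegerSolver ℚ[q]
  open Coprimality ℚ[q]
  open MonicDivision
  open Cyclotomic
  open Relation.Binary.Reasoning.Setoid setoid

  -- Trades the alternating Boolean state for a negation; every later fact about `substNeg` goes
  -- through this equation.
  substNeg-∷ : ∀ a p → substNeg (a ∷ p) ≋ a ∷ negP (substNeg p)
  substNeg-∷ a []      = ≋-refl
  substNeg-∷ a (b ∷ p) = ∷-cong ≡.refl (begin
    (ℚ.- b) ∷ substNeg p                 ≈⟨ ∷-cong ≡.refl (solve 1 (λ p → p := :- :- p) ≋-refl (substNeg p)) ⟩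
    (ℚ.- b) ∷ negP (negP (substNeg p))   ≈⟨ negP-cong (substNeg-∷ b p) ⟨
    negP (substNeg (b ∷ p))              ∎)

  -X : Poly
  -X = negP (X^ 1)

  substNeg-∷≋ : ∀ a p → substNeg (a ∷ p) ≋ constP a ⊕ -X ⊛ substNeg p
  substNeg-∷≋ a p = begin
    substNeg (a ∷ p)                      ≈⟨ substNeg-∷ a p ⟩
    a ∷ negP (substNeg p)                 ≈⟨ ∷≋ a (negP (substNeg p)) ⟩
    constP a ⊕ X^ 1 ⊛ negP (substNeg p)   ≈⟨ +-congˡ {constP a} (solve 2 (λ x p → x :* (:- p) := (:- x) :* p) ≋-refl (X^ 1) (substNeg p)) ⟩
    constP a ⊕ -X ⊛ substNeg p            ∎

  substNeg-zero : ∀ p → p ≋ [] → substNeg p ≋ []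
  substNeg-zero []      e = ≋-refl
  substNeg-zero (a ∷ p) e = ≋-trans (substNeg-∷ a p)
    (≋-trans (∷-cong (at e 0) (negP-cong (substNeg-zero p (mk λ i → at e (suc i))))) (0∷[] ≋-refl))

  substNeg-cong : ∀ p r → p ≋ r → substNeg p ≋ substNeg r
  substNeg-cong []      r       e = ≋-sym (substNeg-zero r (≋-sym e))
  substNeg-cong (a ∷ p) []      e = substNeg-zero (a ∷ p) e
  substNeg-cong (a ∷ p) (b ∷ r) e = begin
    substNeg (a ∷ p)       ≈⟨ substNeg-∷ a p ⟩
    a ∷ negP (substNeg p)  ≈⟨ ∷-cong (at e 0) (negP-cong (substNeg-cong p r (tail e))) ⟩
    b ∷ negP (substNeg r)  ≈⟨ substNeg-∷ b r ⟨
    substNeg (b ∷ r)       ∎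

  substNeg-⊕ : ∀ p r → substNeg (p ⊕ r) ≋ substNeg p ⊕ substNeg r
  substNeg-⊕ []      r       = ≋-refl
  substNeg-⊕ (a ∷ p) []      = ≋-sym (⊕-identityʳ (substNeg (a ∷ p)))
  substNeg-⊕ (a ∷ p) (b ∷ r) = begin
    substNeg ((a ℚ.+ b) ∷ p ⊕ r)
      ≈⟨ substNeg-∷≋ (a ℚ.+ b) (p ⊕ r) ⟩
    (constP a ⊕ constP b) ⊕ -X ⊛ substNeg (p ⊕ r)
      ≈⟨ +-congˡ {constP a ⊕ constP b} (*-congˡ { -X} (substNeg-⊕ p r)) ⟩
    (constP a ⊕ constP b) ⊕ -X ⊛ (substNeg p ⊕ substNeg r)
      ≈⟨ solve 5 (λ a b x p r → (a :+ b) :+ x :* (p :+ r) := (a :+ x :* p) :+ (b :+ x :* r)) ≋-refl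
           (constP a) (constP b) -X (substNeg p) (substNeg r) ⟩
    (constP a ⊕ -X ⊛ substNeg p) ⊕ (constP b ⊕ -X ⊛ substNeg r)
      ≈⟨ +-cong (substNeg-∷≋ a p) (substNeg-∷≋ b r) ⟨
    substNeg (a ∷ p) ⊕ substNeg (b ∷ r) ∎

  substNeg-scale : ∀ c p → substNeg (scale c p) ≋ constP c ⊛ substNeg p
  substNeg-scale c []      = ≋-sym (⊛-zeroʳ (constP c))
  substNeg-scale c (a ∷ p) = begin
    substNeg (c ℚ.* a ∷ scale c p)
      ≈⟨ substNeg-∷≋ (c ℚ.* a) (scale c p) ⟩
    constP (c ℚ.* a) ⊕ -X ⊛ substNeg (scale c p)
      ≈⟨ +-cong (≋-sym (⊛-constˡ c (constP a))) (*-congˡ { -X} (substNeg-scale c p)) ⟩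
    constP c ⊛ constP a ⊕ -X ⊛ (constP c ⊛ substNeg p)
      ≈⟨ solve 4 (λ c a x p → c :* a :+ x :* (c :* p) := c :* (a :+ x :* p)) ≋-refl
           (constP c) (constP a) -X (substNeg p) ⟩
    constP c ⊛ (constP a ⊕ -X ⊛ substNeg p)
      ≈⟨ *-congˡ {constP c} (substNeg-∷≋ a p) ⟨
    constP c ⊛ substNeg (a ∷ p) ∎

  substNeg-⊛ : ∀ p r → substNeg (p ⊛ r) ≋ substNeg p ⊛ substNeg r
  substNeg-⊛ []      r = ≋-refl
  substNeg-⊛ (a ∷ p) r = begin
    substNeg (scale a r ⊕ (0ℚ ∷ p ⊛ r))
      ≈⟨ substNeg-⊕ (scale a r) (0ℚ ∷ p ⊛ r) ⟩
    substNeg (scale a r) ⊕ substNeg (0ℚ ∷ p ⊛ r)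
      ≈⟨ +-cong (substNeg-scale a r) (substNeg-∷≋ 0ℚ (p ⊛ r)) ⟩
    constP a ⊛ substNeg r ⊕ (constP 0ℚ ⊕ -X ⊛ substNeg (p ⊛ r))
      ≈⟨ +-congˡ {constP a ⊛ substNeg r} (+-cong (0∷[] {[]} ≋-refl) (*-congˡ { -X} (substNeg-⊛ p r))) ⟩
    constP a ⊛ substNeg r ⊕ -X ⊛ (substNeg p ⊛ substNeg r)
      ≈⟨ solve 4 (λ a x p r → a :* r :+ x :* (p :* r) := (a :+ x :* p) :* r) ≋-refl
           (constP a) -X (substNeg p) (substNeg r) ⟩
    (constP a ⊕ -X ⊛ substNeg p) ⊛ substNeg r
      ≈⟨ *-congʳ (substNeg-∷≋ a p) ⟨
    substNeg (a ∷ p) ⊛ substNeg r ∎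

  substNeg-X^suc : ∀ m → substNeg (X^ (suc m)) ≋ -X ⊛ substNeg (X^ m)
  substNeg-X^suc m = ≋-trans (substNeg-∷≋ 0ℚ (X^ m)) (+-cong (0∷[] {[]} ≋-refl) ≋-refl)

  substNeg-X^even : ∀ j → substNeg (X^ (j ℕ.+ j)) ≋ X^ (j ℕ.+ j)
  substNeg-X^even zero    = ≋-refl
  substNeg-X^even (suc j) rewrite ℕₚ.+-suc j j = begin
    substNeg (X^ (suc (suc (j ℕ.+ j))))
      ≈⟨ ≋-trans (substNeg-X^suc (suc (j ℕ.+ j))) (*-congˡ { -X} (substNeg-X^suc (j ℕ.+ j))) ⟩
    -X ⊛ (-X ⊛ substNeg (X^ (j ℕ.+ j)))
      ≈⟨ *-congˡ { -X} (*-congˡ { -X} (substNeg-X^even j)) ⟩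
    -X ⊛ (-X ⊛ X^ (j ℕ.+ j))
      ≈⟨ solve 2 (λ x y → (:- x) :* ((:- x) :* y) := x :* (x :* y)) ≋-refl (X^ 1) (X^ (j ℕ.+ j)) ⟩
    X^ 1 ⊛ (X^ 1 ⊛ X^ (j ℕ.+ j))
      ≈⟨ ≋-trans (X^-suc (suc (j ℕ.+ j))) (*-congˡ {X^ 1} (X^-suc (j ℕ.+ j))) ⟨
    X^ (suc (suc (j ℕ.+ j))) ∎

  substNeg-X^odd : ∀ j → substNeg (X^ (suc (j ℕ.+ j))) ≋ negP (X^ (suc (j ℕ.+ j)))
  substNeg-X^odd j = begin
    substNeg (X^ (suc (j ℕ.+ j)))   ≈⟨ substNeg-X^suc (j ℕ.+ j) ⟩
    -X ⊛ substNeg (X^ (j ℕ.+ j))    ≈⟨ *-congˡ { -X} (substNeg-X^even j) ⟩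
    -X ⊛ X^ (j ℕ.+ j)               ≈⟨ solve 2 (λ x y → (:- x) :* y := :- (x :* y)) ≋-refl (X^ 1) (X^ (j ℕ.+ j)) ⟩
    negP (X^ 1 ⊛ X^ (j ℕ.+ j))      ≈⟨ negP-cong (X^-suc (j ℕ.+ j)) ⟨
    negP (X^ (suc (j ℕ.+ j)))       ∎

  substNeg-Zeven : ∀ j → substNeg (Z (j ℕ.+ j)) ≋ Z (j ℕ.+ j)
  substNeg-Zeven j = ≋-trans (substNeg-⊕ (X^ (j ℕ.+ j)) (negP oneP)) (+-congʳ (substNeg-X^even j))

-- Used at Φ n and at its image under q ↦ -q.
record IsModulus (n : ℕ) (P : Poly) : Set where
  open Coprimality ℚ[q]
  open Cyclotomic using (Z)
  field
    divides-Z : P ∣ᴿ Z (n ℕ.+ n)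
    coprime-Z : ∀ j → ¬ n ∣ j → Coprime (Z (j ℕ.+ j)) P

-- The moduli Φ_n(q) and Φ_n(-q).

module Moduli (h : ℕ) where
  open CommutativeRing ℚ[q] using (+-cong; +-congʳ; *-congˡ; setoid)
  open IntegerSolver ℚ[q]
  open Coprimality ℚ[q]
  open MonicDivision
  open Cyclotomic
  open SubstNeg
  open Relation.Binary.Reasoning.Setoid setoid

  n : ℕ
  n = suc (h ℕ.+ h)

  Φ⁺ Φ⁻ : Poly
  Φ⁺ = Φ n
  Φ⁻ = substNeg Φ⁺

  Φn : IsCyclotomic n
  Φn = isCyclotomic n n (ℕ.s≤s ℕ.z≤n) ℕₚ.≤-refl

  ∣-double : ∀ j → n ∣ j ℕ.+ j → n ∣ j
  ∣-double j n∣2j = ℕCoprimality.coprime-divisor n⊥2 (≡.subst (n ∣_) (≡.cong (j ℕ.+_) (≡.sym (ℕₚ.+-identityʳ j))) n∣2j)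
    where
    n⊥2 : ℕCoprimality.Coprime n 2
    n⊥2 {d} (d∣n , d∣2) = Div.∣1⇒≡1 (Div.∣m+n∣m⇒∣n (≡.subst (d ∣_) (≡.sym (ℕₚ.+-comm (h ℕ.+ h) 1)) d∣n)
      (≡.subst (λ m → d ∣ h ℕ.+ m) (ℕₚ.+-identityʳ h) (Div.∣m⇒∣m*n h d∣2)))

  -- Putting -q for q in Φ_n(q) ∣ q^n - 1 gives a divisor of -q^n - 1, because n is odd.
  Φ⁻∣X^n+1 : Φ⁻ ∣ᴿ X^ n ⊕ oneP
  Φ⁻∣X^n+1 = let r , e = Φ∣Z Φn in negP (substNeg r) , (begin
    negP (substNeg r) ⊛ Φ⁻            ≈⟨ solve 2 (λ r p → (:- r) :* p := :- (r :* p)) ≋-refl (substNeg r) Φ⁻ ⟩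
    negP (substNeg r ⊛ Φ⁻)            ≈⟨ negP-cong (substNeg-⊛ r Φ⁺) ⟨
    negP (substNeg (r ⊛ Φ⁺))          ≈⟨ negP-cong (substNeg-cong (r ⊛ Φ⁺) (Z n) e) ⟩
    negP (substNeg (Z n))             ≈⟨ negP-cong (substNeg-⊕ (X^ n) (negP oneP)) ⟩
    negP (substNeg (X^ n) ⊖ oneP)     ≈⟨ negP-cong (+-congʳ {negP oneP} (substNeg-X^odd h)) ⟩
    negP (negP (X^ n) ⊖ oneP)         ≈⟨ solve 1 (λ x → :- (:- x :- :1) := x :+ :1) ≋-refl (X^ n) ⟩
    X^ n ⊕ oneP                       ∎)

  Z-double : ∀ j → Z (j ℕ.+ j) ≋ (X^ j ⊕ oneP) ⊛ Z j
  Z-double j = ≋-trans (Z-+ j j) (solve 1 (λ x → (x :- :1) :+ x :* (x :- :1) := (x :+ :1) :* (x :- :1)) ≋-refl (X^ j))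

  isModulus⁺ : IsModulus n Φ⁺
  isModulus⁺ = record
    { divides-Z = ∣-trans (Φ∣Z Φn) (X^ n ⊕ oneP , ≋-sym (Z-double n))
    ; coprime-Z = λ j n∤j → IsCyclotomic.coprime Φn (j ℕ.+ j) λ n∣2j → n∤j (∣-double j n∣2j) }

  isModulus⁻ : IsModulus n Φ⁻
  isModulus⁻ = record
    { divides-Z = ∣-trans Φ⁻∣X^n+1 (Z n , ≋-trans (⊛-comm (Z n) (X^ n ⊕ oneP)) (≋-sym (Z-double n)))
    ; coprime-Z = λ j n∤j → σ-coprime j (IsModulus.coprime-Z isModulus⁺ j n∤j) }
    where
    -- Even powers of q are fixed by q ↦ -q, so the Bézout relation for Φ_n(q) is carried over as it
    -- stands.
    σ-coprime : ∀ j → Coprime (Z (j ℕ.+ j)) Φ⁺ → Coprime (Z (j ℕ.+ j)) Φ⁻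
    σ-coprime j (s , t , e) = substNeg s , substNeg t , (begin
      substNeg s ⊛ Z (j ℕ.+ j) ⊕ substNeg t ⊛ Φ⁻
        ≈⟨ +-congʳ (*-congˡ {substNeg s} (substNeg-Zeven j)) ⟨
      substNeg s ⊛ substNeg (Z (j ℕ.+ j)) ⊕ substNeg t ⊛ Φ⁻
        ≈⟨ +-cong (substNeg-⊛ s (Z (j ℕ.+ j))) (substNeg-⊛ t Φ⁺) ⟨
      substNeg (s ⊛ Z (j ℕ.+ j)) ⊕ substNeg (t ⊛ Φ⁺)
        ≈⟨ substNeg-⊕ (s ⊛ Z (j ℕ.+ j)) (t ⊛ Φ⁺) ⟨
      substNeg (s ⊛ Z (j ℕ.+ j) ⊕ t ⊛ Φ⁺)
        ≈⟨ substNeg-cong (s ⊛ Z (j ℕ.+ j) ⊕ t ⊛ Φ⁺) oneP e ⟩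
      oneP ∎)

  -- Modulo P the element a is 0, so b is the unit -2.
  coprime-2 : ∀ {a b P} → P ∣ᴿ a → a ⊖ b ≋ constP (fromℕ 2) → Coprime b P
  coprime-2 {a} {b} {P} (r , rP≋a) a-b≋2 = let k , k⊛2≋1 = constP-inverse (fromℕ-suc≢0 1) in
    negP (constP k) , constP k ⊛ r , (begin
      negP (constP k) ⊛ b ⊕ (constP k ⊛ r) ⊛ P
        ≈⟨ solve 4 (λ k b r P → (:- k) :* b :+ (k :* r) :* P := k :* (r :* P :- b)) ≋-refl (constP k) b r P ⟩
      constP k ⊛ (r ⊛ P ⊖ b)
        ≈⟨ *-congˡ {constP k} (≋-trans (+-congʳ rP≋a) a-b≋2) ⟩
      constP k ⊛ constP (fromℕ 2)
        ≈⟨ k⊛2≋1 ⟩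
      oneP ∎)

  Zn⊥Φ⁻ : Coprime (Z n) Φ⁻
  Zn⊥Φ⁻ = coprime-2 Φ⁻∣X^n+1 (≋-trans
    (solve 1 (λ x → (x :+ :1) :- (x :- :1) := :1 :+ :1) ≋-refl (X^ n)) ≋-refl)

  Φ⁻⊥Φ⁺ : Coprime Φ⁻ Φ⁺
  Φ⁻⊥Φ⁺ = coprime-sym (coprime-∣ (Φ∣Z Φn) Zn⊥Φ⁻)

-- Rings of fractions.

-- The later modules take this interface as a parameter, so the concrete fractions stay opaque to
-- them; the construction is supplied only in the theorem itself.
record FractionRing {c ℓ : Level} (R : CommutativeRing c ℓ) : Set (Level.suc (c Level.⊔ ℓ)) where
  open Coprimality R
  private module R = CommutativeRing R
  field K : CommutativeRing (c Level.⊔ ℓ) ℓ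
  open CommutativeRing K
  field
    ι           : R.Carrier → Carrier
    ι-cong      : ∀ {a b} → a R.≈ b → ι a ≈ ι b
    ι-injective : ∀ {a b} → ι a ≈ ι b → a R.≈ b
    ι-+         : ∀ a b → ι (a R.+ b) ≈ ι a + ι b
    ι-*         : ∀ a b → ι (a R.* b) ≈ ι a * ι b
    ι-neg       : ∀ a → ι (R.- a) ≈ - ι a
    ι-0         : ι R.0# ≈ 0#
    ι-1         : ι R.1# ≈ 1#
    1/          : ∀ {a} → Cancellable a → Carrier
    1/-inverse  : ∀ {a} (ra : Cancellable a) → ι a * 1/ ra ≈ 1#

module Fractions {c ℓ : Level} (R : CommutativeRing c ℓ) where
  open CommutativeRing R hiding (zero)
  open IntegerSolver R
  open Coprimality R
  open Relation.Binary.Reasoning.Setoid setoid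

  record Fraction : Set (c Level.⊔ ℓ) where
    constructor frac
    field
      num den : Carrier
      regular : Cancellable den
  open Fraction public

  infix 4 _≃_
  record _≃_ (x y : Fraction) : Set ℓ where
    constructor cross
    field equal : num x * den y ≈ num y * den x
  open _≃_ public

  private
    infixl 6 _+ᶠ_
    infixl 7 _*ᶠ_
    _+ᶠ_ _*ᶠ_ : Fraction → Fraction → Fraction
    x +ᶠ y = frac (num x * den y + num y * den x) (den x * den y) (cancellable-* (regular x) (regular y))
    x *ᶠ y = frac (num x * num y) (den x * den y) (cancellable-* (regular x) (regular y))

    -ᶠ_ : Fraction → Fraction
    -ᶠ x = frac (- num x) (den x) (regular x)

    ≃-trans : ∀ {x y z} → x ≃ y → y ≃ z → x ≃ z
    ≃-trans {frac a b _} {frac c d rd} {frac e f _} (cross ad≈cb) (cross cf≈ed) =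
      cross (cancel (a * f) (e * b) rd (begin
        a * f * d     ≈⟨ solve 3 (λ a f d → a :* f :* d := (a :* d) :* f) refl a f d ⟩
        (a * d) * f   ≈⟨ *-congʳ ad≈cb ⟩
        (c * b) * f   ≈⟨ solve 3 (λ c b f → (c :* b) :* f := (c :* f) :* b) refl c b f ⟩
        (c * f) * b   ≈⟨ *-congʳ cf≈ed ⟩
        (e * d) * b   ≈⟨ solve 3 (λ e d b → (e :* d) :* b := e :* b :* d) refl e d b ⟩
        e * b * d     ∎))

    +-congᶠ : ∀ {x x′ y y′} → x ≃ x′ → y ≃ y′ → x +ᶠ y ≃ x′ +ᶠ y′
    +-congᶠ {frac a b _} {frac a′ b′ _} {frac c d _} {frac c′ d′ _} (cross e) (cross e′) = cross (begin
      (a * d + c * b) * (b′ * d′)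
        ≈⟨ solve 6 (λ a b b′ c d d′ → (a :* d :+ c :* b) :* (b′ :* d′)
             := (a :* b′) :* (d :* d′) :+ (c :* d′) :* (b :* b′)) refl a b b′ c d d′ ⟩
      (a * b′) * (d * d′) + (c * d′) * (b * b′)
        ≈⟨ +-cong (*-congʳ e) (*-congʳ e′) ⟩
      (a′ * b) * (d * d′) + (c′ * d) * (b * b′)
        ≈⟨ solve 6 (λ a′ b b′ c′ d d′ → (a′ :* b) :* (d :* d′) :+ (c′ :* d) :* (b :* b′)
             := (a′ :* d′ :+ c′ :* b′) :* (b :* d)) refl a′ b b′ c′ d d′ ⟩
      (a′ * d′ + c′ * b′) * (b * d) ∎)

    *-congᶠ : ∀ {x x′ y y′} → x ≃ x′ → y ≃ y′ → x *ᶠ y ≃ x′ *ᶠ y′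
    *-congᶠ {frac a b _} {frac a′ b′ _} {frac c d _} {frac c′ d′ _} (cross e) (cross e′) = cross (begin
      a * c * (b′ * d′)        ≈⟨ solve 4 (λ a c b d → a :* c :* (b :* d) := (a :* b) :* (c :* d)) refl a c b′ d′ ⟩
      (a * b′) * (c * d′)      ≈⟨ *-cong e e′ ⟩
      (a′ * b) * (c′ * d)      ≈⟨ solve 4 (λ a c b d → (a :* b) :* (c :* d) := a :* c :* (b :* d)) refl a′ c′ b d ⟩
      a′ * c′ * (b * d)        ∎)

  ι : Carrier → Fraction
  ι a = frac a 1# cancellable-1

  fractions : CommutativeRing (c Level.⊔ ℓ) ℓ
  fractions = record
    { Carrier = Fraction ; _≈_ = _≃_ ; _+_ = _+ᶠ_ ; _*_ = _*ᶠ_ ; -_ = -ᶠ_ ; 0# = ι 0# ; 1# = ι 1#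
    ; isCommutativeRing = record
      { isRing = record
        { +-isAbelianGroup = record
          { isGroup = record
            { isMonoid = record
              { isSemigroup = record
                { isMagma = record
                  { isEquivalence = record
                    { refl = cross refl ; sym = λ (cross e) → cross (sym e) ; trans = ≃-trans }
                  ; ∙-cong = +-congᶠ }
                ; assoc = λ (frac a b _) (frac c d _) (frac e f _) → cross
                    (solve 6 (λ a b c d e f → ((a :* d :+ c :* b) :* f :+ e :* (b :* d)) :* (b :* (d :* f))
                      := (a :* (d :* f) :+ (c :* f :+ e :* d) :* b) :* (b :* d :* f)) refl a b c d e f) }
              ; identity = (λ (frac a b _) → cross
                    (solve 2 (λ a b → (con (+ 0) :* b :+ a :* :1) :* b := a :* (:1 :* b)) refl a b))
                , (λ (frac a b _) → cross
                    (solve 2 (λ a b → (a :* :1 :+ con (+ 0) :* b) :* b := a :* (b :* :1)) refl a b)) }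
            ; inverse = (λ (frac a b _) → cross
                  (solve 2 (λ a b → ((:- a) :* b :+ a :* b) :* :1 := con (+ 0) :* (b :* b)) refl a b))
              , (λ (frac a b _) → cross
                  (solve 2 (λ a b → (a :* b :+ (:- a) :* b) :* :1 := con (+ 0) :* (b :* b)) refl a b))
            ; ⁻¹-cong = λ { {frac a b _} {frac c d _} (cross e) → cross (begin
                - a * d     ≈⟨ solve 2 (λ a d → (:- a) :* d := :- (a :* d)) refl a d ⟩
                - (a * d)   ≈⟨ -‿cong e ⟩
                - (c * b)   ≈⟨ solve 2 (λ a d → :- (a :* d) := (:- a) :* d) refl c b ⟩
                - c * b     ∎) } }
          ; comm = λ (frac a b _) (frac c d _) → cross
              (solve 4 (λ a b c d → (a :* d :+ c :* b) :* (d :* b) := (c :* b :+ a :* d) :* (b :* d)) refl a b c d) }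
        ; *-cong = *-congᶠ
        ; *-assoc = λ (frac a b _) (frac c d _) (frac e f _) → cross
            (solve 6 (λ a b c d e f → (a :* c :* e) :* (b :* (d :* f)) := (a :* (c :* e)) :* (b :* d :* f)) refl a b c d e f)
        ; *-identity = (λ (frac a b _) → cross (solve 2 (λ a b → (:1 :* a) :* b := a :* (:1 :* b)) refl a b))
            , (λ (frac a b _) → cross (solve 2 (λ a b → (a :* :1) :* b := a :* (b :* :1)) refl a b))
        ; distrib =
            (λ (frac a b _) (frac c d _) (frac e f _) → cross
              (solve 6 (λ a b c d e f → a :* (c :* f :+ e :* d) :* (b :* d :* (b :* f))
                := (a :* c :* (b :* f) :+ a :* e :* (b :* d)) :* (b :* (d :* f))) refl a b c d e f))
            , (λ (frac a b _) (frac c d _) (frac e f _) → cross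
              (solve 6 (λ a b c d e f → (c :* f :+ e :* d) :* a :* (d :* b :* (f :* b))
                := (c :* a :* (f :* b) :+ e :* a :* (d :* b)) :* (d :* f :* b)) refl a b c d e f)) }
      ; *-comm = λ (frac a b _) (frac c d _) → cross
          (solve 4 (λ a b c d → (a :* c) :* (d :* b) := (c :* a) :* (b :* d)) refl a b c d) } }

  fractionRing : FractionRing R
  fractionRing = record
    { K           = fractions
    ; ι           = ι
    ; ι-cong      = λ e → cross (*-congʳ e)
    ; ι-injective = λ { {a} {b} (cross e) → trans (sym (*-identityʳ a)) (trans e (*-identityʳ b)) }
    ; ι-+         = λ a b → cross (solve 2 (λ a b → (a :+ b) :* (:1 :* :1) := (a :* :1 :+ b :* :1) :* :1) refl a b)
    ; ι-*         = λ a b → cross (solve 2 (λ a b → (a :* b) :* (:1 :* :1) := (a :* b) :* :1) refl a b)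
    ; ι-neg       = λ a → cross refl
    ; ι-0         = cross refl
    ; ι-1         = cross refl
    ; 1/          = λ {a} ra → frac 1# a ra
    ; 1/-inverse  = λ {a} ra → cross (solve 1 (λ a → (a :* :1) :* :1 := :1 :* (:1 :* a)) refl a)
    }

-- The local ring at a polynomial.

module LocalRing {c ℓ : Level} (R : CommutativeRing c ℓ) (F : FractionRing R) where
  private module R = CommutativeRing R
  open FractionRing F
  open Coprimality R
  open CommutativeRing K hiding (zero)
  open IntegerSolver K
  open Relation.Binary.Reasoning.Setoid setoid

  -- Membership in the local ring at P.
  record Local (P : R.Carrier) (x : Carrier) : Set (c Level.⊔ ℓ) where
    constructor local
    field
      U V     : R.Carrier
      coprime : Coprime V P
      equal   : x * ι V ≈ ι U

  module _ {P : R.Carrier} where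
    local-cong : ∀ {x y} → x ≈ y → Local P x → Local P y
    local-cong x≈y (local U V V⊥P e) = local U V V⊥P (trans (*-congʳ (sym x≈y)) e)

    local-ι : ∀ a → Local P (ι a)
    local-ι a = local a R.1# coprime-1 (trans (*-congˡ ι-1) (*-identityʳ (ι a)))

    local-+ : ∀ {x y} → Local P x → Local P y → Local P (x + y)
    local-+ {x} {y} (local U V V⊥P e) (local U′ V′ V′⊥P e′) = local (U R.* V′ R.+ U′ R.* V) (V R.* V′) (coprime-* V⊥P V′⊥P) (begin
      (x + y) * ι (V R.* V′)                 ≈⟨ *-congˡ (ι-* V V′) ⟩
      (x + y) * (ι V * ι V′)                 ≈⟨ solve 4 (λ x y v w → (x :+ y) :* (v :* w) := (x :* v) :* w :+ (y :* w) :* v) refl x y (ι V) (ι V′) ⟩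
      (x * ι V) * ι V′ + (y * ι V′) * ι V    ≈⟨ +-cong (*-congʳ e) (*-congʳ e′) ⟩
      ι U * ι V′ + ι U′ * ι V                ≈⟨ +-cong (ι-* U V′) (ι-* U′ V) ⟨
      ι (U R.* V′) + ι (U′ R.* V)            ≈⟨ ι-+ _ _ ⟨
      ι (U R.* V′ R.+ U′ R.* V)              ∎)

    local-* : ∀ {x y} → Local P x → Local P y → Local P (x * y)
    local-* {x} {y} (local U V V⊥P e) (local U′ V′ V′⊥P e′) = local (U R.* U′) (V R.* V′) (coprime-* V⊥P V′⊥P) (begin
      x * y * ι (V R.* V′)         ≈⟨ *-congˡ (ι-* V V′) ⟩
      x * y * (ι V * ι V′)         ≈⟨ solve 4 (λ x y v w → x :* y :* (v :* w) := (x :* v) :* (y :* w)) refl x y (ι V) (ι V′) ⟩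
      (x * ι V) * (y * ι V′)       ≈⟨ *-cong e e′ ⟩
      ι U * ι U′                   ≈⟨ ι-* U U′ ⟨
      ι (U R.* U′)                 ∎)

    local-neg : ∀ {x} → Local P x → Local P (- x)
    local-neg {x} (local U V V⊥P e) = local (R.- U) V V⊥P (begin
      - x * ι V     ≈⟨ solve 2 (λ x v → (:- x) :* v := :- (x :* v)) refl x (ι V) ⟩
      - (x * ι V)   ≈⟨ -‿cong e ⟩
      - ι U         ≈⟨ ι-neg U ⟨
      ι (R.- U)     ∎)

    local-inverse : ∀ {V x} → Coprime V P → ι V * x ≈ 1# → Local P x
    local-inverse {V} {x} V⊥P e = local R.1# V V⊥P (trans (*-comm x (ι V)) (trans e (sym ι-1)))

  ∈-power : ∀ {P Q x z} → (∀ {V} → Coprime V P → Coprime V Q) → Local P z → x ≈ ι Q * z →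
    Σ R.Carrier λ U → Σ R.Carrier λ V → Coprime V Q × (x * ι V ≈ ι (Q R.* U))
  ∈-power {P} {Q} {x} {z} P⇒Q (local U V V⊥P e) x≈ = U , V , P⇒Q V⊥P , (begin
    x * ι V           ≈⟨ *-congʳ x≈ ⟩
    ι Q * z * ι V     ≈⟨ *-assoc _ _ _ ⟩
    ι Q * (z * ι V)   ≈⟨ *-congˡ e ⟩
    ι Q * ι U         ≈⟨ ι-* Q U ⟨
    ι (Q R.* U)       ∎)

  -- Since s Q + t Q′ = 1, the new denominator W = s Q V′ + t Q′ V is congruent to V modulo Q and to
  -- V′ modulo Q′, hence coprime to both. In x W each of the two terms acquires the factor Q Q′.
  combine : ∀ {Q Q′ x} → Coprime Q Q′ →
    (Σ R.Carrier λ U → Σ R.Carrier λ V → Coprime V Q × (x * ι V ≈ ι (Q R.* U))) →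
    (Σ R.Carrier λ U → Σ R.Carrier λ V → Coprime V Q′ × (x * ι V ≈ ι (Q′ R.* U))) →
    Σ R.Carrier λ U → Σ R.Carrier λ V → Coprime V (Q R.* Q′) × (x * ι V ≈ ι (U R.* (Q R.* Q′)))
  combine {Q} {Q′} {x} (s , t , e) (U , V , V⊥Q , xV) (U′ , V′ , V′⊥Q′ , xV′) =
    s R.* U′ R.+ t R.* U , W , coprime-sym (coprime-* (coprime-sym W⊥Q) (coprime-sym W⊥Q′)) , (begin
      x * ι (s R.* Q R.* V′ R.+ t R.* Q′ R.* V)
        ≈⟨ *-congˡ (trans (ι-+ _ _) (+-cong (ι-* (s R.* Q) V′) (ι-* (t R.* Q′) V))) ⟩
      x * (ι (s R.* Q) * ι V′ + ι (t R.* Q′) * ι V)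
        ≈⟨ solve 5 (λ x a b c d → x :* (a :* b :+ c :* d) := a :* (x :* b) :+ c :* (x :* d)) refl x _ (ι V′) _ (ι V) ⟩
      ι (s R.* Q) * (x * ι V′) + ι (t R.* Q′) * (x * ι V)
        ≈⟨ +-cong (*-congˡ xV′) (*-congˡ xV) ⟩
      ι (s R.* Q) * ι (Q′ R.* U′) + ι (t R.* Q′) * ι (Q R.* U)
        ≈⟨ trans (ι-+ _ _) (+-cong (ι-* _ _) (ι-* _ _)) ⟨
      ι (s R.* Q R.* (Q′ R.* U′) R.+ t R.* Q′ R.* (Q R.* U))
        ≈⟨ ι-cong (S.solve 6 (λ s t Q Q′ U U′ → s S.:* Q S.:* (Q′ S.:* U′) S.:+ t S.:* Q′ S.:* (Q S.:* U)
             S.:= (s S.:* U′ S.:+ t S.:* U) S.:* (Q S.:* Q′)) R.refl s t Q Q′ U U′) ⟩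
      ι ((s R.* U′ R.+ t R.* U) R.* (Q R.* Q′)) ∎)
    where
    module S = IntegerSolver R
    W = s R.* Q R.* V′ R.+ t R.* Q′ R.* V
    W⊥Q : Coprime W Q
    W⊥Q = coprime-combination R.1# (s R.* (V R.- V′))
      (R.trans (R.sym (R.*-identityˡ V)) (R.trans (R.*-congʳ (R.sym e))
        (S.solve 6 (λ s t Q Q′ V V′ → (s S.:* Q S.:+ t S.:* Q′) S.:* V
          S.:= S.:1 S.:* (s S.:* Q S.:* V′ S.:+ t S.:* Q′ S.:* V) S.:+ (s S.:* (V S.:- V′)) S.:* Q) R.refl s t Q Q′ V V′))) V⊥Q
    W⊥Q′ : Coprime W Q′
    W⊥Q′ = coprime-combination R.1# (t R.* (V′ R.- V))
      (R.trans (R.sym (R.*-identityˡ V′)) (R.trans (R.*-congʳ (R.sym e))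
        (S.solve 6 (λ s t Q Q′ V V′ → (s S.:* Q S.:+ t S.:* Q′) S.:* V′
          S.:= S.:1 S.:* (s S.:* Q S.:* V′ S.:+ t S.:* Q′ S.:* V) S.:+ (t S.:* (V′ S.:- V)) S.:* Q′) R.refl s t Q Q′ V V′))) V′⊥Q′

-- Subrings, units and congruences with quotient in a subring.

record IsSubring {c ℓ o : Level} (K : CommutativeRing c ℓ) (O : CommutativeRing.Carrier K → Set o) : Set (c Level.⊔ ℓ Level.⊔ o) where
  open CommutativeRing K
  field
    O-resp : ∀ {x y} → x ≈ y → O x → O y
    O-1    : O 1#
    O-+    : ∀ {x y} → O x → O y → O (x + y)
    O-*    : ∀ {x y} → O x → O y → O (x * y)
    O-neg  : ∀ {x} → O x → O (- x)

  O-0 : O 0#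
  O-0 = O-resp (-‿inverseʳ 1#) (O-+ O-1 (O-neg O-1))

  O-- : ∀ {x y} → O x → O y → O (x - y)
  O-- Ox Oy = O-+ Ox (O-neg Oy)

module Units {c ℓ o : Level} (K : CommutativeRing c ℓ) (O : CommutativeRing.Carrier K → Set o) (subring : IsSubring K O) where
  open CommutativeRing K hiding (zero)
  open IntegerSolver K
  open IsSubring subring
  open Algebra.Properties.Semiring.Exp semiring using (_^_)

  record IsUnit (x : Carrier) : Set (c Level.⊔ ℓ Level.⊔ o) where
    constructor unit
    field
      inv     : Carrier
      O-x     : O x
      O-inv   : O inv
      inverse : x * inv ≈ 1#

  unit-1 : IsUnit 1#
  unit-1 = unit 1# O-1 O-1 (*-identityʳ 1#)

  unit-* : ∀ {x y} → IsUnit x → IsUnit y → IsUnit (x * y)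
  unit-* {x} {y} (unit x⁻¹ Ox Ox⁻¹ e) (unit y⁻¹ Oy Oy⁻¹ e′) = unit (x⁻¹ * y⁻¹) (O-* Ox Oy) (O-* Ox⁻¹ Oy⁻¹)
    (trans (solve 4 (λ x y z w → x :* y :* (z :* w) := (x :* z) :* (y :* w)) refl x y x⁻¹ y⁻¹)
      (trans (*-cong e e′) (*-identityʳ 1#)))

  unit-neg : ∀ {x} → IsUnit x → IsUnit (- x)
  unit-neg {x} (unit x⁻¹ Ox Ox⁻¹ e) = unit (- x⁻¹) (O-neg Ox) (O-neg Ox⁻¹)
    (trans (solve 2 (λ x y → (:- x) :* (:- y) := x :* y) refl x x⁻¹) e)

  unit-^ : ∀ {x} n → IsUnit x → IsUnit (x ^ n)
  unit-^ zero    ux = unit-1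
  unit-^ (suc n) ux = unit-* ux (unit-^ n ux)

module Congruence {c ℓ o : Level} (K : CommutativeRing c ℓ) (O : CommutativeRing.Carrier K → Set o) (subring : IsSubring K O)
                  (θ : CommutativeRing.Carrier K) where
  open CommutativeRing K hiding (zero)
  open IntegerSolver K
  open IsSubring subring
  open Units K O subring
  open FiniteSums K
  open Algebra.Properties.Semiring.Exp semiring using (_^_)

  infix 4 _≡θ_
  record _≡θ_ (x y : Carrier) : Set (c Level.⊔ ℓ Level.⊔ o) where
    constructor mod
    field
      quotient   : Carrier
      O-quotient : O quotient
      equation   : x - y ≈ θ * quotient

  ≈⇒≡θ : ∀ {x y} → x ≈ y → x ≡θ y
  ≈⇒≡θ {x} {y} e = mod 0# O-0 (trans (+-congʳ e) (trans (-‿inverseʳ y) (sym (zeroʳ θ))))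

  ≡θ-refl : ∀ {x} → x ≡θ x
  ≡θ-refl = ≈⇒≡θ refl

  ≡θ-sym : ∀ {x y} → x ≡θ y → y ≡θ x
  ≡θ-sym {x} {y} (mod z Oz e) = mod (- z) (O-neg Oz)
    (trans (solve 2 (λ x y → y :- x := :- (x :- y)) refl x y)
      (trans (-‿cong e) (solve 2 (λ t z → :- (t :* z) := t :* (:- z)) refl θ z)))

  ≡θ-trans : ∀ {x y z} → x ≡θ y → y ≡θ z → x ≡θ z
  ≡θ-trans {x} {y} {z} (mod a Oa e) (mod b Ob e′) = mod (a + b) (O-+ Oa Ob)
    (trans (solve 3 (λ x y z → x :- z := (x :- y) :+ (y :- z)) refl x y z)
      (trans (+-cong e e′) (sym (distribˡ θ a b))))

  ≡θ-+ : ∀ {x x′ y y′} → x ≡θ x′ → y ≡θ y′ → x + y ≡θ x′ + y′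
  ≡θ-+ {x} {x′} {y} {y′} (mod a Oa e) (mod b Ob e′) = mod (a + b) (O-+ Oa Ob)
    (trans (solve 4 (λ x x′ y y′ → (x :+ y) :- (x′ :+ y′) := (x :- x′) :+ (y :- y′)) refl x x′ y y′)
      (trans (+-cong e e′) (sym (distribˡ θ a b))))

  ≡θ-neg : ∀ {x y} → x ≡θ y → - x ≡θ - y
  ≡θ-neg {x} {y} (mod z Oz e) = mod (- z) (O-neg Oz)
    (trans (solve 2 (λ x y → (:- x) :- (:- y) := :- (x :- y)) refl x y)
      (trans (-‿cong e) (solve 2 (λ t z → :- (t :* z) := t :* (:- z)) refl θ z)))

  ≡θ-*ˡ : ∀ {a x y} → O a → x ≡θ y → a * x ≡θ a * y
  ≡θ-*ˡ {a} {x} {y} Oa (mod z Oz e) = mod (a * z) (O-* Oa Oz)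
    (trans (solve 3 (λ a x y → a :* x :- a :* y := a :* (x :- y)) refl a x y)
      (trans (*-congˡ e) (solve 3 (λ a t z → a :* (t :* z) := t :* (a :* z)) refl a θ z)))

  ≡θ-*ʳ : ∀ {a x y} → O a → x ≡θ y → x * a ≡θ y * a
  ≡θ-*ʳ Oa x≡y = ≡θ-trans (≈⇒≡θ (*-comm _ _)) (≡θ-trans (≡θ-*ˡ Oa x≡y) (≈⇒≡θ (*-comm _ _)))

  ≡θ-* : ∀ {x x′ y y′} → O x → O y′ → x ≡θ x′ → y ≡θ y′ → x * y ≡θ x′ * y′
  ≡θ-* Ox Oy′ x≡x′ y≡y′ = ≡θ-trans (≡θ-*ˡ Ox y≡y′) (≡θ-*ʳ Oy′ x≡x′)

  ≡θ-cancel : ∀ {a x y} → IsUnit a → a * x ≡θ a * y → x ≡θ y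
  ≡θ-cancel {a} (unit a⁻¹ Oa Oa⁻¹ e) ax≡ay =
    ≡θ-trans (≈⇒≡θ (sym (undo _))) (≡θ-trans (≡θ-*ˡ Oa⁻¹ ax≡ay) (≈⇒≡θ (undo _)))
    where
    undo : ∀ x → a⁻¹ * (a * x) ≈ x
    undo x = trans (solve 3 (λ a b x → b :* (a :* x) := (a :* b) :* x) refl a a⁻¹ x)
               (trans (*-congʳ e) (*-identityˡ x))

  ≡θ-^1 : ∀ {x} n → O x → x ≡θ 1# → x ^ n ≡θ 1#
  ≡θ-^1 zero    Ox x≡1 = ≡θ-refl
  ≡θ-^1 (suc n) Ox x≡1 = ≡θ-trans (≡θ-* Ox O-1 x≡1 (≡θ-^1 n Ox x≡1)) (≈⇒≡θ (*-identityʳ 1#))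

  ≡θ-diag : ∀ {T T′} M → (∀ m k → m ℕ.+ k ≡ M → T m k ≡θ T′ m k) → diag T M ≡θ diag T′ M
  ≡θ-diag zero    e = e 0 0 ≡.refl
  ≡θ-diag (suc M) e = ≡θ-+ (e (suc M) 0 (ℕₚ.+-identityʳ _))
    (≡θ-diag M λ m k m+k≡M → e m (suc k) (≡.trans (ℕₚ.+-suc m k) (≡.cong suc m+k≡M)))

-- Truncated squares of sums.

module DoubleSums {c ℓ : Level} (R : CommutativeRing c ℓ) where
  open CommutativeRing R hiding (zero)
  open IntegerSolver R
  open FiniteSums R
  open Relation.Binary.Reasoning.Setoid setoid

  sum : ℕ → (ℕ → Carrier) → Carrier
  sum zero    F = 0#
  sum (suc n) F = sum n F + F n

  sum-cong : ∀ n {F G} → (∀ k → k < n → F k ≈ G k) → sum n F ≈ sum n G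
  sum-cong zero    e = refl
  sum-cong (suc n) e = +-cong (sum-cong n λ k k<n → e k (ℕₚ.m≤n⇒m≤1+n k<n)) (e n ℕₚ.≤-refl)

  sum-front : ∀ n F → sum (suc n) F ≈ F 0 + sum n (λ k → F (suc k))
  sum-front zero    F = +-comm 0# (F 0)
  sum-front (suc n) F = trans (+-congʳ (sum-front n F)) (+-assoc _ _ _)

  sum-+ : ∀ m n F → sum (m ℕ.+ n) F ≈ sum m F + sum n (λ k → F (m ℕ.+ k))
  sum-+ m zero    F rewrite ℕₚ.+-identityʳ m = sym (+-identityʳ _)
  sum-+ m (suc n) F rewrite ℕₚ.+-suc m n = trans (+-congʳ (sum-+ m n F)) (+-assoc _ _ _)

  sum-diag : ∀ T M → sum (suc M) (λ k → T (M ℕ.∸ k) k) ≈ diag T M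
  sum-diag T zero    = +-identityˡ _
  sum-diag T (suc M) = trans (sum-front (suc M) _) (+-congˡ (sum-diag (λ m k → T m (suc k)) M))

  diag-swap : ∀ T M → diag (λ m k → T k m) M ≈ diag T M
  diag-swap T zero    = refl
  diag-swap T (suc M) = begin
    T 0 (suc M) + diag (λ m k → T (suc k) m) M    ≈⟨ +-congˡ (diag-swap (λ m k → T (suc m) k) M) ⟩
    T 0 (suc M) + diag (λ m k → T (suc m) k) M    ≈⟨ +-comm _ _ ⟩
    diag (λ m k → T (suc m) k) M + T 0 (suc M)    ≈⟨ diag-last T M ⟨
    diag T (suc M)                                ∎

  diag-sum : ∀ F M → diag (λ _ k → F k) M ≈ sum (suc M) F
  diag-sum F M = sym (sum-diag (λ _ k → F k) M)

  diag-+ : ∀ T T′ M → diag (λ m k → T m k + T′ m k) M ≈ diag T M + diag T′ M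
  diag-+ T T′ zero    = refl
  diag-+ T T′ (suc M) = trans (+-congˡ (diag-+ _ _ M))
    (solve 4 (λ x y z w → (x :+ y) :+ (z :+ w) := (x :+ z) :+ (y :+ w)) refl _ _ _ _)

  diag-split : ∀ T L h → diag T (suc L ℕ.+ h) ≈
    diag (λ m k → T (suc L ℕ.+ m) k) h + diag (λ m t → T m (suc h ℕ.+ t)) L
  diag-split T L zero    rewrite ℕₚ.+-identityʳ L = refl
  diag-split T L (suc h) rewrite ℕₚ.+-suc L h =
    trans (+-congˡ (diag-split (λ m k → T m (suc k)) L h)) (sym (+-assoc _ _ _))

  -- Summing a b over the triangle row by row or column by column.
  triangle : ∀ (a b : ℕ → Carrier) M → sum (suc M) (λ k → diag (λ m k → a k * b m) k) ≈ diag (λ m k → a k * sum (suc m) b) M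
  triangle a b zero    = trans (+-identityˡ _) (*-congˡ (sym (+-identityˡ _)))
  triangle a b (suc M) = begin
    sum (suc M) (λ k → diag (λ m k → a k * b m) k) + diag (λ m k → a k * b m) (suc M)
      ≈⟨ +-cong (triangle a b M) (diag-last (λ m k → a k * b m) M) ⟩
    diag (λ m k → a k * sum (suc m) b) M + (diag (λ m k → a k * b (suc m)) M + a (suc M) * b 0)
      ≈⟨ +-assoc _ _ _ ⟨
    (diag (λ m k → a k * sum (suc m) b) M + diag (λ m k → a k * b (suc m)) M) + a (suc M) * b 0
      ≈⟨ +-cong (trans (sym (diag-+ (λ m k → a k * sum (suc m) b) (λ m k → a k * b (suc m)) M)) (diag-cong M λ m k _ → sym (distribˡ (a k) _ _))) (*-congˡ (sym (+-identityˡ _))) ⟩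
    diag (λ m k → a k * sum (suc (suc m)) b) M + a (suc M) * sum 1 b
      ≈⟨ diag-last (λ m k → a k * sum (suc m) b) M ⟨
    diag (λ m k → a k * sum (suc m) b) (suc M) ∎

  -- The truncated square of a sum: besides the full square over i, j ≤ h only
  -- pairs with exactly one index above h occur, and they come in symmetric pairs.
  truncated-square : ∀ (a : ℕ → Carrier) h′ → let h = suc h′ in
    sum (suc (h ℕ.+ h)) (λ k → diag (λ m k → a k * a m) k) ≈
    sum (suc h) a * sum (suc h) a +
      (diag (λ m t → a (suc h ℕ.+ t) * sum (suc m) a) h′ + diag (λ m t → a (suc h ℕ.+ t) * sum (suc m) a) h′)
  truncated-square a h′ = begin
    sum (suc (h ℕ.+ h)) (λ k → diag (λ m k → a k * a m) k)
      ≈⟨ triangle a a (h ℕ.+ h) ⟩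
    diag (λ m k → a k * C (suc m)) (h ℕ.+ h)
      -- The cut is at k = h. Beyond it m = 2h - k is below h, so the inner sum involves no index
      -- above h.
      ≈⟨ diag-split (λ m k → a k * C (suc m)) h′ h ⟩
    diag (λ m k → a k * C (suc h ℕ.+ m)) h + X
      ≈⟨ +-congʳ (diag-cong h λ m k _ → trans (*-congˡ (sum-+ (suc h) m a)) (distribˡ (a k) _ _)) ⟩
    diag (λ m k → a k * C (suc h) + a k * sum m b) h + X
      ≈⟨ +-congʳ (diag-+ (λ m k → a k * C (suc h)) (λ m k → a k * sum m b) h) ⟩
    (diag (λ m k → a k * C (suc h)) h + diag (λ m k → a k * sum m b) h) + X
      ≈⟨ +-congʳ (+-cong square below) ⟩
    (C (suc h) * C (suc h) + X) + X
      ≈⟨ +-assoc _ _ _ ⟩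
    C (suc h) * C (suc h) + (X + X) ∎
    where
    h = suc h′
    C : ℕ → Carrier
    C n = sum n a
    b : ℕ → Carrier
    b t = a (suc h ℕ.+ t)
    X = diag (λ m t → b t * C (suc m)) h′
    square : diag (λ m k → a k * C (suc h)) h ≈ C (suc h) * C (suc h)
    square = trans (diag-cong h λ m k _ → *-comm (a k) (C (suc h)))
      (trans (diag-scale (C (suc h)) (λ _ k → a k) h) (*-congˡ (diag-sum a h)))
    -- Summing the triangle the other way round exchanges the two indices, which turns these pairs
    -- into those already collected in X.
    below : diag (λ m k → a k * sum m b) h ≈ X
    below = begin
      diag (λ m k → a k * sum m b) (suc h′)
        ≈⟨ diag-last (λ m k → a k * sum m b) h′ ⟩
      diag (λ m k → a k * sum (suc m) b) h′ + a h * 0#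
        ≈⟨ trans (+-congˡ (zeroʳ (a h))) (+-identityʳ _) ⟩
      diag (λ m k → a k * sum (suc m) b) h′
        ≈⟨ triangle a b h′ ⟨
      sum (suc h′) (λ k → diag (λ m k → a k * b m) k)
        ≈⟨ sum-cong (suc h′) (λ k _ → trans (sym (diag-swap (λ m j → a j * b m) k)) (diag-cong k λ m j _ → *-comm (a m) (b j))) ⟩
      sum (suc h′) (λ k → diag (λ m k → b k * a m) k)
        ≈⟨ triangle b a h′ ⟩
      X ∎

-- The congruence S ≡ R modulo (1 - u)².

-- For k > h the product `g k` contains 1 - s X h = 1 - u, and 1 - q^(4k+1) may share a factor with
-- the modulus when 4k + 1 = n. So `gi k` and `ci k` become local only after multiplication by 1 -
-- u, and w = 1/(1 - u) is asked to exist in K alone.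
record LocalInverses {c ℓ o : Level} (K : CommutativeRing c ℓ) (q : CommutativeRing.Carrier K) (inverses : QInverses K q)
                     (O : CommutativeRing.Carrier K → Set o) (h : ℕ) : Set (c Level.⊔ ℓ Level.⊔ o) where
  open CommutativeRing K
  open QPowers K q
  open QInverses inverses

  -- With n = 2h + 1, this is q^(2n).
  u : Carrier
  u = s * X h

  field
    q⁻¹ ε w : Carrier
    q*q⁻¹   : q * q⁻¹ ≈ 1#
    1+q*ε   : (1# + q) * ε ≈ 1#
    1-u*w   : (1# - u) * w ≈ 1#
    O-q     : O q
    O-q⁻¹   : O q⁻¹
    O-ε     : O ε
    O-fi    : ∀ k → k ℕ.≤ h ℕ.+ h → O (fi k)
    O-gi    : ∀ k → k ℕ.≤ h → O (gi k)
    O-gi′   : ∀ k → h < k → k ℕ.≤ suc (h ℕ.+ h) → O ((1# - u) * gi k)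
    O-ci    : ∀ k → k ℕ.≤ h → O ((1# - u) * ci k)

module LocalAnalysis {c ℓ o : Level} (K : CommutativeRing c ℓ) (q : CommutativeRing.Carrier K) (inverses : QInverses K q)
                     (O : CommutativeRing.Carrier K → Set o) (subring : IsSubring K O) (h : ℕ)
                     (localInverses : LocalInverses K q inverses O h) where
  open CommutativeRing K hiding (zero)
  open IntegerSolver K
  open FiniteSums K
  open DoubleSums K
  open QPowers K q
  open QInverses inverses
  open WatsonIdentity K q inverses hiding (Γ; a; b; u)
  open IsSubring subring
  open Units K O subring
  open LocalInverses localInverses
  open Algebra.Properties.CommutativeSemiring.Exp commutativeSemiring
  open Relation.Binary.Reasoning.Setoid setoid

  O-s : O s
  O-s = O-* O-q O-q

  O-X : ∀ k → O (X k)
  O-X zero    = O-1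
  O-X (suc k) = O-* (O-* O-s O-s) (O-X k)

  O-f : ∀ k → O (f k)
  O-f zero    = O-1
  O-f (suc k) = O-* (O-f k) (O-- O-1 (O-X (suc k)))

  O-g : ∀ k → O (g k)
  O-g zero    = O-1
  O-g (suc k) = O-* (O-g k) (O-- O-1 (O-* O-s (O-X k)))

  O-e : ∀ k → O (e k)
  O-e zero    = O-1
  O-e (suc k) = O-* (O-neg (O-* O-q (O-X k))) (O-e k)

  O-1-u : O (1# - u)
  O-1-u = O-- O-1 (O-* O-s (O-X h))

  O-sum : ∀ n F → (∀ k → k < n → O (F k)) → O (sum n F)
  O-sum zero    F OF = O-0
  O-sum (suc n) F OF = O-+ (O-sum n F λ k k<n → OF k (ℕₚ.m≤n⇒m≤1+n k<n)) (OF n ℕₚ.≤-refl)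

  O-diag : ∀ M T → (∀ m k → m ℕ.+ k ≡ M → O (T m k)) → O (diag T M)
  O-diag zero    T OT = OT 0 0 ≡.refl
  O-diag (suc M) T OT = O-+ (OT (suc M) 0 (ℕₚ.+-identityʳ _))
    (O-diag M _ λ m k m+k≡M → OT m (suc k) (≡.trans (ℕₚ.+-suc m k) (≡.cong suc m+k≡M)))

  unit-q : IsUnit q
  unit-q = unit q⁻¹ O-q O-q⁻¹ q*q⁻¹

  unit-s : IsUnit s
  unit-s = unit-* unit-q unit-q

  unit-X : ∀ k → IsUnit (X k)
  unit-X zero    = unit-1
  unit-X (suc k) = unit-* (unit-* unit-s unit-s) (unit-X k)

  unit-d : ∀ k → IsUnit (d k)
  unit-d zero    = unit-1
  unit-d (suc k) = unit-* (unit-neg (unit-* unit-s (unit-X k))) (unit-d k)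

  unit-u : IsUnit u
  unit-u = unit-* unit-s (unit-X h)

  O-unit : ∀ {x} → IsUnit x → O x
  O-unit = IsUnit.O-x

  dbl≡ : ∀ k → dbl k ≡ k ℕ.+ k
  dbl≡ zero    = ≡.refl
  dbl≡ (suc k) = ≡.cong suc (≡.trans (≡.cong suc (dbl≡ k)) (≡.sym (ℕₚ.+-suc k k)))

  +dbl : ∀ m k → m ℕ.+ k ≡ h → m ℕ.+ dbl k ≡ h ℕ.+ k
  +dbl m k m+k≡h = ≡.trans (≡.cong (m ℕ.+_) (dbl≡ k)) (≡.trans (≡.sym (ℕₚ.+-assoc m k k)) (≡.cong (ℕ._+ k) m+k≡h))

  k≤h : ∀ m k → m ℕ.+ k ≡ h → k ℕ.≤ h
  k≤h m k ≡.refl = ℕₚ.m≤n+m k m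

  m≤h : ∀ m k → m ℕ.+ k ≡ h → m ℕ.≤ h
  m≤h m k ≡.refl = ℕₚ.m≤m+n m k

  h≤2h : ∀ {k} → k ℕ.≤ h → k ℕ.≤ h ℕ.+ h
  h≤2h k≤h = ℕₚ.≤-trans k≤h (ℕₚ.m≤m+n h h)

  -- For m + k = h these are f (h+k)/f (h-k) and (1 - u) g (h-k)/g (h+k+1), the deformations of g k²
  -- and 1/f k² up to units; the factor 1 - u in σ clears the pole.
  ρ σ : ℕ → ℕ → Carrier
  ρ m k = f (m ℕ.+ dbl k) * fi m
  σ m k = g m * ((1# - u) * gi (suc (m ℕ.+ dbl k)))

  O-ρ : ∀ m k → m ℕ.+ k ≡ h → O (ρ m k)
  O-ρ m k m+k≡h = O-* (O-f (m ℕ.+ dbl k)) (O-fi m (h≤2h (m≤h m k m+k≡h)))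

  O-σ : ∀ m k → m ℕ.+ k ≡ h → O (σ m k)
  O-σ m k m+k≡h = O-* (O-g m) (O-gi′ (suc (m ℕ.+ dbl k)) (ℕ.s≤s (≡.subst (h ℕ.≤_) (≡.sym (+dbl m k m+k≡h)) (ℕₚ.m≤m+n h k)))
    (ℕ.s≤s (≡.subst (ℕ._≤ h ℕ.+ h) (≡.sym (+dbl m k m+k≡h)) (ℕₚ.+-monoʳ-≤ h (k≤h m k m+k≡h)))))

  u≈ : ∀ m k → m ℕ.+ suc k ≡ h → u ≈ s * (p * X m * X k)
  u≈ m k m+1+k≡h = *-congˡ (begin
    X h                  ≡⟨ ≡.cong X (≡.trans (≡.sym m+1+k≡h) (ℕₚ.+-suc m k)) ⟩
    X (suc m ℕ.+ k)      ≈⟨ X-+ (suc m) k ⟩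
    p * X m * X k        ∎)

  θ : Carrier
  θ = (1# - u) * (1# - u)

  θ-cong : ∀ {v} → u ≈ v → (1# - v) * (1# - v) ≈ θ
  θ-cong u≈v = *-cong (+-congˡ (-‿cong (sym u≈v))) (+-congˡ (-‿cong (sym u≈v)))

  open Congruence K O subring θ

  drop : ∀ {x y z} → O z → y ≈ x + θ * z → y ≡θ x
  drop {x} {y} {z} Oz e = mod z Oz (trans (+-congʳ e) (solve 2 (λ x t → (x :+ t) :- x := t) refl x (θ * z)))

  -- Both congruences rest on y (1 - u/y) (1 - u y) = -u (1 - y)² + y (1 - u)².
  ρ-congruence : ∀ k m → m ℕ.+ k ≡ h → d k * ρ m k ≡θ u ^ k * (g k * g k)
  ρ-congruence zero m _ rewrite ℕₚ.+-identityʳ m = ≈⇒≡θ (begin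
    1# * (f m * fi m)    ≈⟨ *-congˡ (f*fi m) ⟩
    1# * 1#              ≈⟨ *-congˡ (*-identityʳ 1#) ⟨
    1# * (1# * 1#)       ∎)
  ρ-congruence (suc k) m m+1+k≡h rewrite ℕₚ.+-suc m (suc (dbl k)) | ℕₚ.+-suc m (dbl k) =
    ≡θ-trans (drop O-remainder split) (≡θ-trans (≡θ-*ˡ O-factor (ρ-congruence k (suc m) m+k≡h)) (≈⇒≡θ regroup))
    where
    A = X m
    x = X k
    J = m ℕ.+ dbl k
    T = d k * ρ (suc m) k
    m+k≡h : suc m ℕ.+ k ≡ h
    m+k≡h = ≡.trans (≡.sym (ℕₚ.+-suc m k)) m+1+k≡h
    O-T : O T
    O-T = O-* (O-unit (unit-d k)) (O-ρ (suc m) k m+k≡h)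
    O-remainder : O (- (s * x * T))
    O-remainder = O-neg (O-* (O-* O-s (O-X k)) O-T)
    O-factor : O (u * ((1# - s * x) * (1# - s * x)))
    O-factor = O-* (O-unit unit-u) (O-* (O-- O-1 (O-* O-s (O-X k))) (O-- O-1 (O-* O-s (O-X k))))
    -- Here y = s X k: in passing from ρ (m+1) k to ρ m (k+1) the factors gained are 1 - p X m = 1 -
    -- u/y and 1 - u y, and d contributes -y.
    split : d (suc k) * (f (suc (suc J)) * fi m) ≈ u * ((1# - s * x) * (1# - s * x)) * T + θ * - (s * x * T)
    split = begin
      (- (s * x) * d k) * (f (suc J) * (1# - p * (p * X J)) * fi m)
        ≈⟨ *-congˡ (*-cong (*-congˡ (+-congˡ (-‿cong (*-congˡ (*-congˡ (X-J m k)))))) (fi-suc m)) ⟩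
      (- (s * x) * d k) * (f (suc J) * (1# - p * (p * (A * (x * x)))) * (fi (suc m) * (1# - p * A)))
        ≈⟨ solve 6 (λ s A x D F fi → let p = s :* s ; y = s :* x ; v = s :* (p :* A :* x) ; T = D :* (F :* fi) in
             (:- y :* D) :* (F :* (:1 :- p :* (p :* (A :* (x :* x)))) :* (fi :* (:1 :- p :* A)))
             := v :* ((:1 :- y) :* (:1 :- y)) :* T :+ ((:1 :- v) :* (:1 :- v)) :* (:- (y :* T)))
           refl s A x (d k) (f (suc J)) (fi (suc m)) ⟩
      s * (p * A * x) * ((1# - s * x) * (1# - s * x)) * T
        + ((1# - s * (p * A * x)) * (1# - s * (p * A * x))) * - (s * x * T)
        ≈⟨ +-cong (*-congʳ (*-congʳ (sym (u≈ m k m+1+k≡h)))) (*-congʳ (θ-cong (u≈ m k m+1+k≡h))) ⟩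
      u * ((1# - s * x) * (1# - s * x)) * T + θ * - (s * x * T) ∎
    regroup : u * ((1# - s * x) * (1# - s * x)) * (u ^ k * (g k * g k)) ≈ u ^ suc k * (g (suc k) * g (suc k))
    regroup = solve 4 (λ u y g w → u :* (y :* y) :* (w :* (g :* g)) := (u :* w) :* ((g :* y) :* (g :* y)))
      refl u (1# - s * x) (g k) (u ^ k)

  -- The closed form is (-1)^k q^(2k²+2k).
  δ : ℕ → Carrier
  δ zero    = 1#
  δ (suc k) = - X (suc k) * δ k

  σ-congruence : ∀ k m → m ℕ.+ k ≡ h → u ^ k * (f k * f k) * σ m k ≡θ δ k
  σ-congruence zero m m≡h rewrite ≡.trans (≡.sym (ℕₚ.+-identityʳ m)) m≡h | ℕₚ.+-identityʳ h = ≈⇒≡θ (begin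
    1# * (1# * 1#) * (g h * ((1# - u) * gi (suc h)))
      ≈⟨ solve 3 (λ g y z → :1 :* (:1 :* :1) :* (g :* (y :* z)) := (g :* y) :* z) refl (g h) (1# - u) (gi (suc h)) ⟩
    g (suc h) * gi (suc h)
      ≈⟨ g*gi (suc h) ⟩
    1# ∎)
  σ-congruence (suc k) m m+1+k≡h =
    ≡θ-trans (drop O-remainder split)
      (≡θ-*ˡ (O-neg (O-X (suc k))) (σ-congruence k (suc m) m+k≡h))
    where
    A = X m
    x = X k
    J = m ℕ.+ dbl k
    Y = u ^ k * (f k * f k)
    m+k≡h : suc m ℕ.+ k ≡ h
    m+k≡h = ≡.trans (≡.sym (ℕₚ.+-suc m k)) m+1+k≡h
    O-remainder : O (p * x * (Y * σ m (suc k)))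
    O-remainder = O-* (O-X (suc k)) (O-* (O-* (O-unit (unit-^ k unit-u)) (O-* (O-f k) (O-f k))) (O-σ m (suc k) m+1+k≡h))
    -- Now y = X (k + 1), and the identity is read backwards: u (1 - y)² is replaced by -y (1 -
    -- u/y)(1 - u y), whose two factors turn σ m (k+1) into σ (m+1) k.
    split : u * u ^ k * ((f k * (1# - p * x)) * (f k * (1# - p * x))) * σ m (suc k) ≈
            - (p * x) * (Y * σ (suc m) k) + θ * (p * x * (Y * σ m (suc k)))
    split rewrite ℕₚ.+-suc m (suc (dbl k)) | ℕₚ.+-suc m (dbl k) = begin
      u * u ^ k * ((f k * (1# - p * x)) * (f k * (1# - p * x))) * (g m * (1-u * gi″))
        ≈⟨ *-congʳ (*-congʳ (*-congʳ u≈′)) ⟩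
      u′ * u ^ k * ((f k * (1# - p * x)) * (f k * (1# - p * x))) * (g m * (1-u * gi″))
        ≈⟨ solve 8 (λ s A x w f g z gi → let p = s :* s ; v = s :* (p :* A :* x) ; Y = w :* (f :* f) in
             v :* w :* ((f :* (:1 :- p :* x)) :* (f :* (:1 :- p :* x))) :* (g :* (z :* gi))
             := :- (p :* x) :* (Y :* ((g :* (:1 :- s :* A)) :* (z :* (gi :* (:1 :- s :* (p :* (p :* (A :* (x :* x)))))))))
                :+ ((:1 :- v) :* (:1 :- v)) :* (p :* x :* (Y :* (g :* (z :* gi)))))
           refl s A x (u ^ k) (f k) (g m) 1-u gi″ ⟩
      - (p * x) * (Y * ((g m * (1# - s * A)) * (1-u * (gi″ * (1# - s * (p * (p * (A * (x * x)))))))))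
        + ((1# - u′) * (1# - u′)) * (p * x * (Y * (g m * (1-u * gi″))))
        ≈⟨ +-cong (*-congˡ (*-congˡ (*-congˡ (*-congˡ (sym gi′≈))))) (*-congʳ (θ-cong u≈′)) ⟩
      - (p * x) * (Y * (g (suc m) * (1-u * gi (suc (suc J))))) + θ * (p * x * (Y * (g m * (1-u * gi″)))) ∎
      where
      1-u = 1# - u
      gi″ = gi (suc (suc (suc J)))
      u′ = s * (p * A * x)
      u≈′ = u≈ m k m+1+k≡h
      gi′≈ : gi (suc (suc J)) ≈ gi″ * (1# - s * (p * (p * (A * (x * x)))))
      gi′≈ = trans (gi-suc (suc (suc J))) (*-congˡ (+-congˡ (-‿cong (*-congˡ (*-congˡ (*-congˡ (X-J m k)))))))

  δ≈ : ∀ k → δ k ≈ d k * s ^ k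
  δ≈ zero    = sym (*-identityʳ 1#)
  δ≈ (suc k) = begin
    - (p * X k) * δ k                   ≈⟨ *-congˡ (δ≈ k) ⟩
    - (p * X k) * (d k * s ^ k)         ≈⟨ solve 4 (λ s x d w → :- ((s :* s) :* x) :* (d :* w) := (:- (s :* x) :* d) :* (s :* w)) refl s (X k) (d k) (s ^ k) ⟩
    (- (s * X k) * d k) * (s * s ^ k)   ∎

  r : ℕ → Carrier
  r k = g k * fi k

  -- The two congruences are multiplied. As δ k = d k s^k, the units d k and u^k cancel, and f k² is
  -- moved across by its local inverse.
  ρσ-congruence : ∀ m k → m ℕ.+ k ≡ h → ρ m k * σ m k ≡θ s ^ k * (r k * r k)
  ρσ-congruence m k m+k≡h =
    ≡θ-trans (≈⇒≡θ (sym (clear (ρ m k * σ m k))))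
      (≡θ-trans (≡θ-*ˡ (O-* O-fik O-fik) cancelled)
        (≈⇒≡θ (solve 3 (λ w g z → (z :* z) :* (w :* (g :* g)) := w :* ((g :* z) :* (g :* z))) refl (s ^ k) (g k) (fi k))))
    where
    D = d k
    w′ = u ^ k
    O-fik = O-fi k (h≤2h (k≤h m k m+k≡h))
    clear : ∀ x → (fi k * fi k) * (x * (f k * f k)) ≈ x
    clear x = begin
      (fi k * fi k) * (x * (f k * f k))   ≈⟨ solve 3 (λ z x f → (z :* z) :* (x :* (f :* f)) := x :* ((f :* z) :* (f :* z))) refl (fi k) x (f k) ⟩
      x * ((f k * fi k) * (f k * fi k))   ≈⟨ *-congˡ (*-cong (f*fi k) (f*fi k)) ⟩
      x * (1# * 1#)                       ≈⟨ trans (*-congˡ (*-identityʳ 1#)) (*-identityʳ x) ⟩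
      x                                   ∎
    O-δ : O (δ k)
    O-δ = O-resp (sym (δ≈ k)) (O-* (O-unit (unit-d k)) (O-unit (unit-^ k unit-s)))
    cancelled : ρ m k * σ m k * (f k * f k) ≡θ s ^ k * (g k * g k)
    cancelled = ≡θ-cancel (unit-* (unit-d k) (unit-^ k unit-u))
      (≡θ-trans (≈⇒≡θ (solve 5 (λ D w R S f → (D :* w) :* (R :* S :* (f :* f)) := (D :* R) :* (w :* (f :* f) :* S))
                        refl D w′ (ρ m k) (σ m k) (f k)))
      (≡θ-trans (≡θ-* (O-* (O-unit (unit-d k)) (O-ρ m k m+k≡h)) O-δ (ρ-congruence k m m+k≡h) (σ-congruence k m m+k≡h))
      (≈⇒≡θ (trans (*-congˡ (δ≈ k))
        (solve 4 (λ w g D z → (w :* (g :* g)) :* (D :* z) := (D :* w) :* (z :* (g :* g))) refl w′ (g k) D (s ^ k))))))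

  -- b k = (-1)^k q^(2k²+k), and a k is the summand c_q(k) of the theorem.
  b a : ℕ → Carrier
  b k = e k * s ^ k
  a k = b k * (1# + q * X k) * ε * (r k * r k)

  -- R is a square root of the right-hand side: [n]_{q²}/[4k+1] equals ε (1 - u) `ci k`, and d h =
  -- (-1)^h q^(2h²) squares to q^((n-1)²). The sign of d h is the one for which S ≡ R.
  S R : Carrier
  S = sum (suc h) a
  R = sum (suc h) (λ k → ε * d h * (s ^ k * r k) * ((1# - u) * ci k))

  t-congruence : ∀ m k → m ℕ.+ k ≡ h → ε * (1# - u) * t m k ≡θ a k
  t-congruence m k m+k≡h =
    ≡θ-trans (≈⇒≡θ (solve 8 (λ ε z e y F G fi gi → ε :* z :* (e :* y :* F :* G :* fi :* gi)
                     := (e :* y :* ε) :* ((F :* fi) :* (G :* (z :* gi)))) refl ε (1# - u) (e k) (1# + q * X k) _ (g m) (fi m) _))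
    (≡θ-trans (≡θ-*ˡ (O-* (O-* (O-e k) (O-+ O-1 (O-* O-q (O-X k)))) O-ε) (ρσ-congruence m k m+k≡h))
    (≈⇒≡θ (solve 5 (λ e y ε w r → (e :* y :* ε) :* (w :* (r :* r)) := (e :* w) :* y :* ε :* (r :* r))
            refl (e k) (1# + q * X k) ε (s ^ k) (r k))))

  -- On exponents of q: 2(h-k)² + (4h+2)k = 2h² + 2k + 2k².
  d-u : ∀ k m → m ℕ.+ k ≡ h → d m * u ^ k ≈ d h * s ^ k * d k
  d-u zero    m m≡h rewrite ≡.trans (≡.sym (ℕₚ.+-identityʳ m)) m≡h = sym (*-identityʳ _)
  d-u (suc k) m m+1+k≡h = begin
    d m * (u * u ^ k)
      ≈⟨ *-congˡ (*-congʳ (u≈ m k m+1+k≡h)) ⟩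
    d m * (s * (p * X m * X k) * u ^ k)
      ≈⟨ solve 5 (λ s A x D w → D :* (s :* ((s :* s) :* A :* x) :* w)
           := :- (s :* (s :* x)) :* ((:- (s :* A) :* D) :* w)) refl s (X m) (X k) (d m) (u ^ k) ⟩
    - (s * (s * X k)) * (d (suc m) * u ^ k)
      ≈⟨ *-congˡ (d-u k (suc m) (≡.trans (≡.sym (ℕₚ.+-suc m k)) m+1+k≡h)) ⟩
    - (s * (s * X k)) * (d h * s ^ k * d k)
      ≈⟨ solve 5 (λ s x D w E → :- (s :* (s :* x)) :* (D :* w :* E) := D :* (s :* w) :* (:- (s :* x) :* E))
           refl s (X k) (d h) (s ^ k) (d k) ⟩
    d h * (s * s ^ k) * (- (s * X k) * d k) ∎

  v-congruence : ∀ m k → m ℕ.+ k ≡ h → ε * (1# - u) * v m k ≡θ ε * d h * (s ^ k * r k) * ((1# - u) * ci k)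
  v-congruence m k m+k≡h =
    ≡θ-trans (≈⇒≡θ (solve 8 (λ ε z D F fi fk gk ck → ε :* z :* (D :* F :* fi :* (fk :* gk) :* ck)
                     := (ε :* (fk :* gk) :* (z :* ck)) :* (D :* (F :* fi))) refl ε (1# - u) (d m) _ (fi m) (fi k) (gi k) (ci k)))
    (≡θ-trans (≡θ-*ˡ (O-* (O-* O-ε (O-* (O-fi k (h≤2h k≤)) (O-gi k k≤))) (O-ci k k≤)) dρ)
    (≈⇒≡θ (begin
      ε * (fi k * gi k) * ((1# - u) * ci k) * (d h * s ^ k * (g k * g k))
        ≈⟨ solve 7 (λ ε fk gk z D w G → ε :* (fk :* gk) :* z :* (D :* w :* (G :* G))
             := ε :* D :* (w :* (G :* fk)) :* z :* (G :* gk)) refl ε (fi k) (gi k) ((1# - u) * ci k) (d h) (s ^ k) (g k) ⟩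
      ε * d h * (s ^ k * r k) * ((1# - u) * ci k) * (g k * gi k)
        ≈⟨ trans (*-congˡ (g*gi k)) (*-identityʳ _) ⟩
      ε * d h * (s ^ k * r k) * ((1# - u) * ci k) ∎)))
    where
    k≤ = k≤h m k m+k≡h
    dρ : d m * ρ m k ≡θ d h * s ^ k * (g k * g k)
    dρ = ≡θ-cancel (unit-d k)
      (≡θ-trans (≈⇒≡θ (solve 3 (λ D E R → D :* (E :* R) := E :* (D :* R)) refl (d k) (d m) (ρ m k)))
      (≡θ-trans (≡θ-*ˡ (O-unit (unit-d m)) (ρ-congruence k m m+k≡h))
      (≈⇒≡θ (trans (sym (*-assoc (d m) (u ^ k) _)) (trans (*-congʳ (d-u k m m+k≡h))
        (solve 3 (λ x D G → x :* D :* G := D :* (x :* G)) refl (d h * s ^ k) (d k) (g k * g k)))))))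

  -- The exact identity `W h` = `V h` is first multiplied by ε (1 - u): the inverses
  -- `gi (suc (m + dbl k))` in t and `ci k` in v are local only with the factor 1 - u, so reduction
  -- term by term starts after that.
  S≡R : S ≡θ R
  S≡R = ≡θ-trans (≈⇒≡θ (sym (diag-sum a h)))
    (≡θ-trans (≡θ-sym (≡θ-diag h t-congruence))
    (≡θ-trans (≈⇒≡θ (trans (diag-scale (ε * (1# - u)) t h) (trans (*-congˡ (W≈V h)) (sym (diag-scale (ε * (1# - u)) v h)))))
    (≡θ-trans (≡θ-diag h v-congruence)
    (≈⇒≡θ (diag-sum _ h)))))

-- Reflection of the summands where q^n ≡ -1.

module Antisymmetry {c ℓ o : Level} (K : CommutativeRing c ℓ) (q : CommutativeRing.Carrier K) (inverses : QInverses K q)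
                    (O : CommutativeRing.Carrier K → Set o) (subring : IsSubring K O) (h : ℕ)
                    (localInverses : LocalInverses K q inverses O h) (π : CommutativeRing.Carrier K) where
  open CommutativeRing K hiding (zero)
  open IntegerSolver K
  open QPowers K q
  open QInverses inverses
  open WatsonIdentity K q inverses using (fi-suc)
  open IsSubring subring
  open Units K O subring
  open LocalInverses localInverses
  open LocalAnalysis K q inverses O subring h localInverses
  open Congruence K O subring π
  open Algebra.Properties.CommutativeSemiring.Exp commutativeSemiring
  open Relation.Binary.Reasoning.Setoid setoid

  X≈ : ∀ k → X k ≈ s ^ k * s ^ k
  X≈ zero    = sym (*-identityʳ 1#)
  X≈ (suc k) = trans (*-congˡ (X≈ k))
    (solve 2 (λ s w → (s :* s) :* (w :* w) := (s :* w) :* (s :* w)) refl s (s ^ k))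

  -- The form of a k-th power lets the reflection use the symmetry of (s^i)^j in i and j.
  b≈ : ∀ k → b k ≈ (- (q * s ^ k)) ^ k
  b≈ zero    = *-identityʳ 1#
  b≈ (suc k) = begin
    (- (q * X k) * e k) * (s * s ^ k)
      ≈⟨ solve 5 (λ q x e s w → (:- (q :* x) :* e) :* (s :* w) := :- (q :* s :* x) :* (e :* w)) refl q (X k) (e k) s (s ^ k) ⟩
    - (q * s * X k) * b k
      ≈⟨ *-cong (-‿cong (*-congˡ (X≈ k))) (b≈ k) ⟩
    - (q * s * (s ^ k * s ^ k)) * (- (q * s ^ k)) ^ k
      ≈⟨ solve 4 (λ q s w z → :- (q :* s :* (w :* w)) :* z := :- (q :* (s :* w)) :* (z :* w)) refl q s (s ^ k) ((- (q * s ^ k)) ^ k) ⟩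
    - (q * (s * s ^ k)) * ((- (q * s ^ k)) ^ k * s ^ k)
      ≈⟨ *-congˡ (^-distrib-* (- (q * s ^ k)) s k) ⟨
    - (q * (s * s ^ k)) * (- (q * s ^ k) * s) ^ k
      ≈⟨ *-congˡ (^-congˡ k (solve 3 (λ q s w → :- (q :* w) :* s := :- (q :* (s :* w))) refl q s (s ^ k))) ⟩
    - (q * (s * s ^ k)) * (- (q * (s * s ^ k))) ^ k ∎

  -- Reflection k ↦ M - k of the summands on a window lo ≤ k ≤ lo + L, M = 2 lo + L,
  -- provided q^(2M+1) ≡ -1.
  module Window (κ : Carrier) (lo L : ℕ) (q^[2M+1]≡-1 : q * s ^ (lo ℕ.+ lo ℕ.+ L) ≡θ - 1#)
                (unit-r : ∀ a → a ℕ.≤ L → IsUnit (g (lo ℕ.+ a) * κ * fi (lo ℕ.+ a)))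
                (unit-X′ : ∀ a → a < L → IsUnit (1# - X (suc (lo ℕ.+ a)))) where

    M : ℕ
    M = lo ℕ.+ lo ℕ.+ L

    -- κ is 1 on the window k ≤ h and 1/(1 - u) on the window beyond h, where it removes the factor
    -- 1 - u from g and so keeps Q a unit.
    Q : ℕ → Carrier
    Q a = g (lo ℕ.+ a) * κ * fi (lo ℕ.+ a)

    O-Q : ∀ a → a ℕ.≤ L → O (Q a)
    O-Q a a≤L = O-unit (unit-r a a≤L)

    Q-suc : ∀ a → Q (suc a) * (1# - X (suc (lo ℕ.+ a))) ≈ Q a * (1# - s * X (lo ℕ.+ a))
    Q-suc a rewrite ℕₚ.+-suc lo a = begin
      g k * (1# - s * X k) * κ * fi (suc k) * (1# - p * X k)
        ≈⟨ solve 5 (λ g y κ fi x → g :* y :* κ :* fi :* x := g :* κ :* (fi :* x) :* y) refl (g k) _ κ (fi (suc k)) (1# - p * X k) ⟩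
      g k * κ * (fi (suc k) * (1# - p * X k)) * (1# - s * X k)
        ≈⟨ *-congʳ (*-congˡ (fi-suc k)) ⟨
      g k * κ * fi k * (1# - s * X k) ∎
      where k = lo ℕ.+ a

    O-s^ : ∀ k → O (s ^ k)
    O-s^ k = O-unit (unit-^ k unit-s)

    O-z : O (q * s ^ M)
    O-z = O-* O-q (O-s^ M)

    z²≡1 : (q * s ^ M) * (q * s ^ M) ≡θ 1#
    z²≡1 = ≡θ-trans (≡θ-* O-z (O-neg O-1) q^[2M+1]≡-1 q^[2M+1]≡-1)
      (≈⇒≡θ (solve 0 ((:- :1) :* (:- :1) := :1) refl))

    s*X≡1 : ∀ i j → i ℕ.+ j ≡ M → s * (X i * X j) ≡θ 1#
    s*X≡1 i j i+j≡M = ≡θ-trans (≈⇒≡θ (begin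
      s * (X i * X j)                  ≈⟨ *-congˡ (X-+ i j) ⟨
      s * X (i ℕ.+ j)                  ≡⟨ ≡.cong (λ k → s * X k) i+j≡M ⟩
      s * X M                          ≈⟨ *-congˡ (X≈ M) ⟩
      q * q * (s ^ M * s ^ M)          ≈⟨ solve 2 (λ q w → q :* q :* (w :* w) := (q :* w) :* (q :* w)) refl q (s ^ M) ⟩
      (q * s ^ M) * (q * s ^ M)        ∎)) z²≡1

    window-+ : ∀ a b → a ℕ.+ b ≡ L → (lo ℕ.+ a) ℕ.+ (lo ℕ.+ b) ≡ M
    window-+ a b ≡.refl = solveℕ 3 (λ l a b → (l +ₙ a) +ₙ (l +ₙ b) =ₙ l +ₙ l +ₙ (a +ₙ b)) ≡.refl lo a b

    -- With i = lo + a and j = lo + b one has i + j + 1 = M, so X (i+1) and s X j are inverse to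
    -- each other modulo π. This turns the factor (1 - s X i)/(1 - X (i+1)) of Q (a+1)/Q a into the
    -- inverse of the corresponding factor at j, up to s.
    Q-reflect : ∀ a b → suc (a ℕ.+ b) ≡ L → s * (Q (suc a) * Q (suc b)) ≡θ Q a * Q b
    Q-reflect a b 1+a+b≡L = ≡θ-cancel (unit-X′ a a<L)
      (≡θ-trans (≈⇒≡θ (begin
        (1# - X (suc i)) * (s * (Q (suc a) * Q (suc b)))
          ≈⟨ solve 4 (λ x s Q R → x :* (s :* (Q :* R)) := s :* (Q :* x) :* R) refl (1# - X (suc i)) s (Q (suc a)) (Q (suc b)) ⟩
        s * (Q (suc a) * (1# - X (suc i))) * Q (suc b)
          ≈⟨ *-congʳ (*-congˡ (Q-suc a)) ⟩
        s * (Q a * (1# - s * X i)) * Q (suc b)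
          ≈⟨ solve 4 (λ s Q x R → s :* (Q :* (:1 :- s :* x)) :* R := Q :* (s :* (:1 :- s :* x) :* R)) refl s (Q a) (X i) (Q (suc b)) ⟩
        Q a * (s * (1# - s * X i) * Q (suc b)) ∎))
      (≡θ-trans (≡θ-*ˡ (O-Q a (ℕₚ.<⇒≤ a<L)) key)
      (≈⇒≡θ (solve 3 (λ x Q R → Q :* (x :* R) := x :* (Q :* R)) refl (1# - X (suc i)) (Q a) (Q b)))))
      where
      i = lo ℕ.+ a
      j = lo ℕ.+ b
      v y : Carrier
      v = X (suc i)
      y = s * X j
      a<L : a < L
      a<L = ≡.subst (suc a ℕ.≤_) 1+a+b≡L (ℕ.s≤s (ℕₚ.m≤m+n a b))
      b<L : b < L
      b<L = ≡.subst (suc b ℕ.≤_) 1+a+b≡L (ℕ.s≤s (ℕₚ.m≤n+m b a))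
      O-Qb′ = O-Q (suc b) b<L
      O-Qb = O-Q b (ℕₚ.<⇒≤ b<L)
      vy≡1 : v * y ≡θ 1#
      vy≡1 = ≡θ-trans (≈⇒≡θ (solve 3 (λ s v x → v :* (s :* x) := s :* (v :* x)) refl s v (X j)))
        (s*X≡1 (suc i) j (≡.trans (≡.cong (ℕ._+ j) (≡.sym (ℕₚ.+-suc lo a)))
          (window-+ (suc a) b 1+a+b≡L)))
      key : s * (1# - s * X i) * Q (suc b) ≡θ (1# - v) * Q b
      key = ≡θ-trans (≈⇒≡θ (solve 3 (λ s x R → s :* (:1 :- s :* x) :* R := (s :* :1 :- (s :* s) :* x) :* R) refl s (X i) (Q (suc b))))
        (≡θ-trans (≡θ-*ʳ O-Qb′ (≡θ-+ (≡θ-*ˡ O-s (≡θ-sym vy≡1)) ≡θ-refl))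
        (≡θ-trans (≈⇒≡θ (begin
          (s * (v * y) - v) * Q (suc b)
            ≈⟨ solve 4 (λ s v x R → (s :* (v :* (s :* x)) :- v) :* R := :- v :* (R :* (:1 :- (s :* s) :* x))) refl s v (X j) (Q (suc b)) ⟩
          - v * (Q (suc b) * (1# - X (suc j)))
            ≈⟨ *-congˡ (Q-suc b) ⟩
          - v * (Q b * (1# - s * X j))
            ≈⟨ solve 3 (λ v Q y → :- v :* (Q :* (:1 :- y)) := (v :* y :- v) :* Q) refl v (Q b) y ⟩
          (v * y - v) * Q b ∎))
        (≡θ-*ʳ O-Qb (≡θ-+ vy≡1 ≡θ-refl))))

    -- Iterated reflection: along a + b = L the quotient Q b / Q a gains one factor s each time a
    -- increases, starting from Q L / Q 0.
    Q-climb : ∀ a b → a ℕ.+ b ≡ L → Q b * Q 0 ≡θ s ^ a * (Q L * Q a)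
    Q-climb zero    b ≡.refl = ≈⇒≡θ (sym (*-identityˡ _))
    Q-climb (suc a) b 1+a+b≡L = ≡θ-cancel (unit-r a (ℕₚ.<⇒≤ a<L))
      (≡θ-trans (≈⇒≡θ (sym (*-assoc (Q a) (Q b) (Q 0))))
      (≡θ-trans (≡θ-*ʳ (O-Q 0 ℕ.z≤n) (≡θ-sym (Q-reflect a b 1+a+b≡L)))
      (≡θ-trans (≈⇒≡θ (solve 4 (λ s Q R T → s :* (Q :* R) :* T := s :* Q :* (R :* T)) refl s (Q (suc a)) (Q (suc b)) (Q 0)))
      (≡θ-trans (≡θ-*ˡ (O-* O-s (O-Q (suc a) a<L)) (Q-climb a (suc b) (≡.trans (ℕₚ.+-suc a b) 1+a+b≡L)))
      (≈⇒≡θ (solve 5 (λ s R w T Q → s :* R :* (w :* (T :* Q)) := Q :* (s :* w :* (T :* R))) refl s (Q (suc a)) (s ^ a) (Q L) (Q a)))))))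
      where
      a<L : a < L
      a<L = ≡.subst (suc a ℕ.≤_) 1+a+b≡L (ℕ.s≤s (ℕₚ.m≤m+n a b))

    -- `Q-climb` at a = L shows that the ratio Q L / Q 0 has square s^(-L); this suffices, since Q
    -- enters the summands squared.
    Q-square : ∀ a b → a ℕ.+ b ≡ L → s ^ L * (Q b * Q b) ≡θ s ^ a * s ^ a * (Q a * Q a)
    Q-square a b a+b≡L = ≡θ-cancel (unit-* (unit-r 0 ℕ.z≤n) (unit-r 0 ℕ.z≤n))
      (≡θ-trans (≈⇒≡θ (solve 3 (λ T w R → (T :* T) :* (w :* (R :* R)) := w :* ((R :* T) :* (R :* T))) refl (Q 0) (s ^ L) (Q b)))
      (≡θ-trans (≡θ-*ˡ (O-s^ L) (≡θ-* (O-* (O-Q b b≤L) O-Q0) (O-* (O-s^ a) (O-* (O-Q L ℕₚ.≤-refl) O-Qa)) climb climb))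
      (≡θ-trans (≈⇒≡θ (solve 4 (λ w z T R → w :* ((z :* (T :* R)) :* (z :* (T :* R))) := (w :* (T :* T)) :* (z :* z :* (R :* R)))
                        refl (s ^ L) (s ^ a) (Q L) (Q a)))
      (≡θ-*ʳ (O-* (O-* (O-s^ a) (O-s^ a)) (O-* O-Qa O-Qa)) (≡θ-sym (Q-climb L 0 (ℕₚ.+-identityʳ L)))))))
      where
      climb = Q-climb a b a+b≡L
      b≤L : b ℕ.≤ L
      b≤L = ≡.subst (b ℕ.≤_) a+b≡L (ℕₚ.m≤n+m b a)
      O-Q0 = O-Q 0 ℕ.z≤n
      O-Qa = O-Q a (≡.subst (a ℕ.≤_) a+b≡L (ℕₚ.m≤m+n a b))

    -- (s^i)^j b j = (- q s^M)^j ≡ 1, and the prefactor is symmetric in i and j.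
    b-reflect : ∀ i j → i ℕ.+ j ≡ M → b j ≡θ b i
    b-reflect i j i+j≡M = ≡θ-cancel (unit-^ j (unit-^ i unit-s))
      (≡θ-trans (power i j i+j≡M) (≡θ-sym (≡θ-trans (≈⇒≡θ (*-congʳ swap)) (power j i (≡.trans (ℕₚ.+-comm j i) i+j≡M)))))
      where
      swap : (s ^ i) ^ j ≈ (s ^ j) ^ i
      swap = trans (^-assocʳ s i j) (trans (^-congʳ s (ℕₚ.*-comm i j)) (sym (^-assocʳ s j i)))
      power : ∀ i j → i ℕ.+ j ≡ M → (s ^ i) ^ j * b j ≡θ 1#
      power i j i+j≡M = ≡θ-trans (≈⇒≡θ (begin
        (s ^ i) ^ j * b j                         ≈⟨ *-congˡ (b≈ j) ⟩
        (s ^ i) ^ j * (- (q * s ^ j)) ^ j         ≈⟨ ^-distrib-* (s ^ i) (- (q * s ^ j)) j ⟨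
        (s ^ i * - (q * s ^ j)) ^ j               ≈⟨ ^-congˡ j (solve 3 (λ w q z → w :* (:- (q :* z)) := :- (q :* (w :* z))) refl (s ^ i) q (s ^ j)) ⟩
        (- (q * (s ^ i * s ^ j))) ^ j             ≈⟨ ^-congˡ j (-‿cong (*-congˡ (trans (sym (^-homo-* s i j)) (^-congʳ s i+j≡M)))) ⟩
        (- (q * s ^ M)) ^ j                       ∎))
        (≡θ-^1 j (O-neg O-z) (≡θ-trans (≡θ-neg q^[2M+1]≡-1) (≈⇒≡θ (solve 0 (:- (:- :1) := :1) refl))))

    summand : ℕ → Carrier
    summand a = b (lo ℕ.+ a) * (1# + q * X (lo ℕ.+ a)) * ε * (Q a * Q a)

    O-b : ∀ k → O (b k)
    O-b k = O-* (O-e k) (O-s^ k)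

    -- Both b j ≡ b i and q X i (1 + q X j) ≡ 1 + q X i preserve the sign. The sign change comes
    -- from the squares of Q: q X i s^L = q s^M s^(2a) ≡ - s^(2a).
    antisymmetric : ∀ a b → a ℕ.+ b ≡ L → summand b ≡θ - summand a
    antisymmetric a b′ a+b≡L = ≡θ-cancel (unit-* (unit-* unit-q (unit-X i)) (unit-^ L unit-s))
      (≡θ-trans (≈⇒≡θ (solve 7 (λ q x w B x′ ε R → ((q :* x) :* w) :* (B :* (:1 :+ q :* x′) :* ε :* R)
                        := B :* (q :* x :+ (q :* q) :* (x :* x′)) :* (ε :* (w :* R)))
                        refl q (X i) (s ^ L) (b j) (X j) ε (Q b′ * Q b′)))
      (≡θ-trans (≡θ-* (O-* (O-b j) (O-+ O-qX (O-* O-s (O-* (O-X i) (O-X j)))))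
                      (O-* O-ε (O-* (O-* (O-s^ a) (O-s^ a)) (O-* O-Qa O-Qa)))
                      (≡θ-* (O-b j) (O-+ O-qX O-1) (b-reflect i j i+j≡M) (≡θ-+ ≡θ-refl (s*X≡1 i j i+j≡M)))
                      (≡θ-*ˡ O-ε (Q-square a b′ a+b≡L)))
      (≡θ-trans (≈⇒≡θ (solve 6 (λ q B x ε z R → B :* (q :* x :+ :1) :* (ε :* (z :* z :* R))
                        := (z :* z) :* (B :* (:1 :+ q :* x) :* ε :* R)) refl q (b i) (X i) ε (s ^ a) (Q a * Q a)))
      (≡θ-trans (≡θ-*ʳ O-summand (≡θ-sym (≡θ-trans (≈⇒≡θ exponents) (≡θ-trans (≡θ-*ʳ O-s^a² (≡θ-neg q^[2M+1]≡-1))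
                  (≈⇒≡θ (solve 1 (λ z → :- (:- :1) :* z := z) refl (s ^ a * s ^ a)))))))
      (≈⇒≡θ (solve 2 (λ x y → (:- x) :* y := x :* (:- y)) refl (q * X i * s ^ L) (summand a)))))))
      where
      i = lo ℕ.+ a
      j = lo ℕ.+ b′
      i+j≡M = window-+ a b′ a+b≡L
      O-qX : O (q * X i)
      O-qX = O-* O-q (O-X i)
      O-s^a² = O-* (O-s^ a) (O-s^ a)
      O-Qa = O-Q a (≡.subst (a ℕ.≤_) a+b≡L (ℕₚ.m≤m+n a b′))
      O-summand : O (summand a)
      O-summand = O-* (O-* (O-* (O-b i) (O-+ O-1 O-qX)) O-ε) (O-* O-Qa O-Qa)
      exponents : - (q * X i * s ^ L) ≈ - (q * s ^ M) * (s ^ a * s ^ a)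
      exponents = begin
        - (q * X i * s ^ L)
          ≈⟨ -‿cong (*-congʳ (*-congˡ (trans (X≈ i) (*-cong (^-homo-* s lo a) (^-homo-* s lo a))))) ⟩
        - (q * ((s ^ lo * s ^ a) * (s ^ lo * s ^ a)) * s ^ L)
          ≈⟨ solve 4 (λ q l z w → :- (q :* ((l :* z) :* (l :* z)) :* w) := :- (q :* (l :* l :* w)) :* (z :* z)) refl q (s ^ lo) (s ^ a) (s ^ L) ⟩
        - (q * (s ^ lo * s ^ lo * s ^ L)) * (s ^ a * s ^ a)
          ≈⟨ *-congʳ (-‿cong (*-congˡ (trans (^-homo-* s (lo ℕ.+ lo) L) (*-congʳ (^-homo-* s lo lo))))) ⟨
        - (q * s ^ M) * (s ^ a * s ^ a) ∎

-- The double sum against R², modulo (1 - u)² and modulo π³.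

module SquareCongruence {c ℓ o : Level} (K : CommutativeRing c ℓ) (q : CommutativeRing.Carrier K) (inverses : QInverses K q)
                        (O : CommutativeRing.Carrier K → Set o) (subring : IsSubring K O) (h′ : ℕ)
                        (localInverses : LocalInverses K q inverses O (suc h′)) where
  open CommutativeRing K hiding (zero)
  open IntegerSolver K
  open FiniteSums K
  open DoubleSums K
  open QPowers K q
  open QInverses inverses
  open WatsonIdentity K q inverses using (fi-suc)
  open IsSubring subring
  open Units K O subring
  open LocalInverses localInverses
  private
    h : ℕ
    h = suc h′
  open LocalAnalysis K q inverses O subring h localInverses
  open Algebra.Properties.CommutativeSemiring.Exp commutativeSemiring
  open Relation.Binary.Reasoning.Setoid setoid

  double-sum : Carrier
  double-sum = sum (suc (h ℕ.+ h)) (λ k → diag (λ m k → a k * a m) k)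

  -- The factor that takes g h to g (h + 1) is 1 - u itself, which cancels w; the further factors
  -- are local.
  O-gw : ∀ t → O (g (suc h ℕ.+ t) * w)
  O-gw zero rewrite ℕₚ.+-identityʳ h′ = O-resp (sym (begin
    g h * (1# - u) * w       ≈⟨ *-assoc _ _ _ ⟩
    g h * ((1# - u) * w)     ≈⟨ *-congˡ 1-u*w ⟩
    g h * 1#                 ≈⟨ *-identityʳ (g h) ⟩
    g h                      ∎)) (O-g h)
  O-gw (suc t) rewrite ℕₚ.+-suc h′ t =
    O-resp (solve 3 (λ g w x → g :* w :* x := g :* x :* w) refl (g k) w (1# - s * X k))
      (O-* (O-gw t) (O-- O-1 (O-* O-s (O-X k))))
    where k = suc h ℕ.+ t

  -- The summands beyond h, divided by (1 - u)².
  a~ : ℕ → Carrier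
  a~ t = b k * (1# + q * X k) * ε * ((g k * w * fi k) * (g k * w * fi k))
    where k = suc h ℕ.+ t

  a≈θ*a~ : ∀ t → a (suc h ℕ.+ t) ≈ θ * a~ t
  a≈θ*a~ t = sym (begin
    (1-u * 1-u) * (b k * (1# + q * X k) * ε * ((g k * w * fi k) * (g k * w * fi k)))
      ≈⟨ solve 5 (λ z B G w F → (z :* z) :* (B :* ((G :* w :* F) :* (G :* w :* F))) := ((z :* w) :* (z :* w)) :* (B :* ((G :* F) :* (G :* F))))
           refl 1-u (b k * (1# + q * X k) * ε) (g k) w (fi k) ⟩
    ((1-u * w) * (1-u * w)) * a k
      ≈⟨ *-congʳ (*-cong 1-u*w 1-u*w) ⟩
    (1# * 1#) * a k
      ≈⟨ trans (*-congʳ (*-identityʳ 1#)) (*-identityˡ (a k)) ⟩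
    a k ∎)
    where
    k = suc h ℕ.+ t
    1-u = 1# - u

  suc-h+≤2h : ∀ t → t ℕ.≤ h′ → suc h ℕ.+ t ℕ.≤ h ℕ.+ h
  suc-h+≤2h t t≤h′ = ≡.subst (ℕ._≤ h ℕ.+ h) (ℕₚ.+-suc h t) (ℕₚ.+-monoʳ-≤ h (ℕ.s≤s t≤h′))

  O-prefix : ∀ k → O (b k * (1# + q * X k) * ε)
  O-prefix k = O-* (O-* (O-* (O-e k) (O-unit (unit-^ k unit-s))) (O-+ O-1 (O-* O-q (O-X k)))) O-ε

  O-a~ : ∀ t → t ℕ.≤ h′ → O (a~ t)
  O-a~ t t≤h′ = O-* (O-prefix (suc h ℕ.+ t)) (O-* O-r~ O-r~)
    where O-r~ = O-* (O-gw t) (O-fi (suc h ℕ.+ t) (suc-h+≤2h t t≤h′))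

  O-a : ∀ k → k ℕ.≤ h → O (a k)
  O-a k k≤h = O-* (O-prefix k) (O-* O-r O-r)
    where O-r = O-* (O-g k) (O-fi k (h≤2h k≤h))

  A : ℕ → Carrier
  A m = sum (suc m) a

  O-A : ∀ m → m ℕ.≤ h → O (A m)
  O-A m m≤h = O-sum (suc m) a λ k k≤m → O-a k (ℕₚ.≤-trans (ℕₚ.≤-pred k≤m) m≤h)

  mixed : Carrier
  mixed = diag (λ m t → a~ t * A m) h′

  O-mixed : O mixed
  O-mixed = O-diag h′ _ λ { m t ≡.refl → O-* (O-a~ t (ℕₚ.m≤n+m t m)) (O-A m (ℕₚ.m≤n⇒m≤1+n (ℕₚ.m≤m+n m t))) }

  double-sum≈ : double-sum ≈ S * S + θ * (mixed + mixed)
  double-sum≈ = begin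
    double-sum                  ≈⟨ truncated-square a h′ ⟩
    S * S + (Y + Y)             ≈⟨ +-congˡ (+-cong Y≈ Y≈) ⟩
    S * S + (θ * mixed + θ * mixed) ≈⟨ +-congˡ (distribˡ θ mixed mixed) ⟨
    S * S + θ * (mixed + mixed) ∎
    where
    Y = diag (λ m t → a (suc h ℕ.+ t) * A m) h′
    Y≈ : Y ≈ θ * mixed
    Y≈ = trans (diag-cong h′ λ m t _ → trans (*-congʳ (a≈θ*a~ t)) (*-assoc θ (a~ t) (A m)))
               (diag-scale θ (λ m t → a~ t * A m) h′)

  O-R : O R
  O-R = O-sum (suc h) _ λ k k≤h → let k≤ = ℕₚ.≤-pred k≤h in
    O-* (O-* (O-* O-ε (O-unit (unit-d h))) (O-* (O-unit (unit-^ k unit-s)) (O-* (O-g k) (O-fi k (h≤2h k≤))))) (O-ci k k≤)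

  module _ where
    open Congruence K O subring θ

    difference : double-sum - R * R ≈ θ * (_≡θ_.quotient S≡R * (S + R) + (mixed + mixed))
    difference = begin
      double-sum - R * R
        ≈⟨ +-congʳ double-sum≈ ⟩
      (S * S + θ * (mixed + mixed)) - R * R
        ≈⟨ solve 4 (λ S R t m → (S :* S :+ t :* m) :- R :* R := (S :- R) :* (S :+ R) :+ t :* m) refl S R θ (mixed + mixed) ⟩
      (S - R) * (S + R) + θ * (mixed + mixed)
        ≈⟨ +-congʳ (*-congʳ (_≡θ_.equation S≡R)) ⟩
      θ * _≡θ_.quotient S≡R * (S + R) + θ * (mixed + mixed)
        ≈⟨ solve 4 (λ t z w m → t :* z :* w :+ t :* m := t :* (z :* w :+ m)) refl θ _ (S + R) (mixed + mixed) ⟩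
      θ * (_≡θ_.quotient S≡R * (S + R) + (mixed + mixed)) ∎

    square-congruence : double-sum ≡θ R * R
    square-congruence = mod _
      (O-+ (O-* (_≡θ_.O-quotient S≡R) (O-+ (O-A h ℕₚ.≤-refl) O-R)) (O-+ O-mixed O-mixed)) difference

    z₀ : Carrier
    z₀ = _≡θ_.quotient S≡R

    O-z₀ : O z₀
    O-z₀ = _≡θ_.O-quotient S≡R

    S≈ : S ≈ R + θ * z₀
    S≈ = trans (solve 2 (λ S R → S := R :+ (S :- R)) refl S R) (+-congˡ (_≡θ_.equation S≡R))

  -- If moreover q^n ≡ -1 modulo a divisor π of 1 - u, then S, R and the mixed terms
  -- vanish modulo π, which gains one more factor π.
  module Cube (π y : Carrier) (1-u≈π*y : 1# - u ≈ π * y) (O-π : O π) (O-y : O y) (O-ci₀ : ∀ k → k ℕ.≤ h → O (ci k))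
              (q^n≡-1 : Congruence._≡θ_ K O subring π (q * s ^ h) (- 1#)) where
    open Congruence K O subring π
    open Antisymmetry K q inverses O subring h localInverses π

    unit-r₁ : ∀ k → k ℕ.≤ h → IsUnit (g (0 ℕ.+ k) * 1# * fi (0 ℕ.+ k))
    unit-r₁ k k≤h = unit (f k * gi k) (O-* (O-* (O-g k) O-1) (O-fi k (h≤2h k≤h))) (O-* (O-f k) (O-gi k k≤h))
      (trans (solve 4 (λ G F f g → G :* :1 :* F :* (f :* g) := (f :* F) :* (G :* g)) refl (g k) (fi k) (f k) (gi k))
        (trans (*-cong (f*fi k) (g*gi k)) (*-identityʳ 1#)))

    unit-1-X : ∀ k → suc k ℕ.≤ h ℕ.+ h → IsUnit (1# - X (suc k))
    unit-1-X k k<2h = unit (f k * fi (suc k)) (O-- O-1 (O-X (suc k))) (O-* (O-f k) (O-fi (suc k) k<2h))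
      (trans (solve 3 (λ x f F → x :* (f :* F) := (f :* x) :* F) refl (1# - X (suc k)) (f k) (fi (suc k))) (f*fi (suc k)))

    module W₁ = Window 1# 0 h q^n≡-1 unit-r₁ (λ k k<h → unit-1-X k (h≤2h k<h))

    a-antisymmetric : ∀ i j → i ℕ.+ j ≡ h → a j ≡θ - a i
    a-antisymmetric i j i+j≡h = ≡θ-trans (≈⇒≡θ (a≈ j)) (≡θ-trans (W₁.antisymmetric i j i+j≡h) (≈⇒≡θ (-‿cong (sym (a≈ i)))))
      where
      a≈ : ∀ k → a k ≈ W₁.summand k
      a≈ k = *-congˡ (*-cong (*-congʳ (sym (*-identityʳ (g k)))) (*-congʳ (sym (*-identityʳ (g k)))))

    unit-r₂ : ∀ t → t ℕ.≤ h′ → IsUnit (g (suc h ℕ.+ t) * w * fi (suc h ℕ.+ t))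
    unit-r₂ t t≤h′ = unit (f k * ((1# - u) * gi k))
      (O-* (O-gw t) (O-fi k k≤2h)) (O-* (O-f k) (O-gi′ k (ℕ.s≤s (ℕₚ.m≤m+n h t)) (ℕₚ.m≤n⇒m≤1+n k≤2h)))
      (trans (solve 6 (λ G w F f z g → G :* w :* F :* (f :* (z :* g)) := (f :* F) :* (z :* w) :* (G :* g)) refl (g k) w (fi k) (f k) (1# - u) (gi k))
        (trans (*-cong (*-cong (f*fi k) 1-u*w) (g*gi k)) (trans (*-identityʳ _) (*-identityʳ 1#))))
      where
      k = suc h ℕ.+ t
      k≤2h = suc-h+≤2h t t≤h′

    q^3n≡-1 : q * s ^ (suc h ℕ.+ suc h ℕ.+ h′) ≡θ - 1#
    q^3n≡-1 = ≡θ-trans (≈⇒≡θ (begin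
      q * s ^ (suc h ℕ.+ suc h ℕ.+ h′)
        ≡⟨ ≡.cong (λ k → q * s ^ k) (solveℕ 1 (λ n → conₙ 1 +ₙ (conₙ 1 +ₙ n) +ₙ (conₙ 1 +ₙ (conₙ 1 +ₙ n)) +ₙ n
             =ₙ conₙ 1 +ₙ ((conₙ 1 +ₙ n) +ₙ (conₙ 1 +ₙ n) +ₙ (conₙ 1 +ₙ n))) ≡.refl h′) ⟩
      q * (s * s ^ (h ℕ.+ h ℕ.+ h))
        ≈⟨ *-congˡ (*-congˡ (trans (^-homo-* s (h ℕ.+ h) h) (*-congʳ (^-homo-* s h h)))) ⟩
      q * (s * (s ^ h * s ^ h * s ^ h))
        ≈⟨ solve 2 (λ q w → q :* ((q :* q) :* (w :* w :* w)) := (q :* w) :* ((q :* w) :* (q :* w))) refl q (s ^ h) ⟩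
      (q * s ^ h) * ((q * s ^ h) * (q * s ^ h)) ∎))
      (≡θ-trans (≡θ-* O-z (O-* O-−1 O-−1) q^n≡-1 (≡θ-* O-z O-−1 q^n≡-1 q^n≡-1))
        (≈⇒≡θ (solve 0 ((:- :1) :* ((:- :1) :* (:- :1)) := :- :1) refl)))
      where
      O-z = O-* O-q (O-unit (unit-^ h unit-s))
      O-−1 = O-neg O-1

    module W₂ = Window w (suc h) h′ q^3n≡-1 unit-r₂
      (λ t t<h′ → unit-1-X (suc h ℕ.+ t) (≡.subst (ℕ._≤ h ℕ.+ h) (ℕₚ.+-suc (suc h) t) (suc-h+≤2h (suc t) t<h′)))

    -- Here the `ci k` are local by themselves, so the factor 1 - u comes out of R, which therefore
    -- vanishes modulo π.
    R₁ : Carrier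
    R₁ = sum (suc h) (λ k → ε * d h * (s ^ k * r k) * ci k)

    O-R₁ : O R₁
    O-R₁ = O-sum (suc h) _ λ k k≤h → let k≤ = ℕₚ.≤-pred k≤h in
      O-* (O-* (O-* O-ε (O-unit (unit-d h))) (O-* (O-unit (unit-^ k unit-s)) (O-* (O-g k) (O-fi k (h≤2h k≤))))) (O-ci₀ k k≤)

    R≈ : R ≈ (1# - u) * R₁
    R≈ = trans (sym (diag-sum _ h)) (trans (diag-cong h λ m k _ →
        solve 3 (λ x z c → x :* (z :* c) := z :* (x :* c)) refl (ε * d h * (s ^ k * r k)) (1# - u) (ci k))
      (trans (diag-scale (1# - u) (λ m k → ε * d h * (s ^ k * r k) * ci k) h) (*-congˡ (diag-sum _ h))))

    S≈′ : S ≈ π * (y * (R₁ + (1# - u) * z₀))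
    S≈′ = begin
      S                                             ≈⟨ S≈ ⟩
      R + θ * z₀                                    ≈⟨ +-congʳ R≈ ⟩
      1-u * R₁ + (1-u * 1-u) * z₀                   ≈⟨ solve 3 (λ z R w → z :* R :+ (z :* z) :* w := z :* (R :+ z :* w)) refl 1-u R₁ z₀ ⟩
      1-u * (R₁ + 1-u * z₀)                         ≈⟨ trans (*-congʳ 1-u≈π*y) (*-assoc π y _) ⟩
      π * (y * (R₁ + 1-u * z₀))                     ∎
      where 1-u = 1# - u

    S≡0 : S ≡θ 0#
    S≡0 = mod _ (O-* O-y (O-+ O-R₁ (O-* O-1-u O-z₀)))
      (trans (solve 1 (λ x → x :- con (+ 0) := x) refl S) S≈′)

    -- The reflection maps the tail of S beyond m to -A t, so S ≡ A m - A t, and S ≡ 0.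
    A-reflect : ∀ m t → m ℕ.+ t ≡ h′ → A m ≡θ A t
    A-reflect m t m+t≡h′ = ≡θ-trans (≈⇒≡θ (solve 2 (λ x y → x := (x :- y) :+ y) refl (A m) (A t)))
      (≡θ-trans (≡θ-+ (≡θ-trans (≡θ-sym S≡A-A) S≡0) ≡θ-refl) (≈⇒≡θ (+-identityˡ (A t))))
      where
      index : suc m ℕ.+ suc t ≡ suc h
      index = ≡.cong suc (≡.trans (ℕₚ.+-suc m t) (≡.cong suc m+t≡h′))
      rest : sum (suc t) (λ k → a (suc m ℕ.+ k)) ≡θ - A t
      rest = ≡θ-trans (≈⇒≡θ (trans (sym (diag-sum _ t)) (sym (diag-swap (λ _ k → a (suc m ℕ.+ k)) t))))
        (≡θ-trans (≡θ-diag t λ x i x+i≡t → a-antisymmetric i (suc m ℕ.+ x)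
          (≡.trans (ℕₚ.+-comm i (suc m ℕ.+ x)) (≡.cong suc (≡.trans (ℕₚ.+-assoc m x i) (≡.trans (≡.cong (m ℕ.+_) x+i≡t) m+t≡h′)))))
        (≈⇒≡θ (trans (diag-cong t λ _ i _ → solve 1 (λ x → :- x := (:- :1) :* x) refl (a i))
          (trans (diag-scale (- 1#) (λ _ i → a i) t) (trans (*-congˡ (diag-sum a t))
            (solve 1 (λ x → (:- :1) :* x := :- x) refl (A t)))))))
      S≡A-A : S ≡θ A m - A t
      S≡A-A = ≡θ-trans (≈⇒≡θ (trans (reflexive (≡.cong (λ n → sum n a) (≡.sym index))) (sum-+ (suc m) (suc t) a)))
        (≡θ-+ ≡θ-refl rest)

    -- Exchanging m and t changes the sign of `a~` and preserves A. What is used later is that mixed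
    -- + mixed is a multiple of π.
    mixed≡-mixed : mixed ≡θ - mixed
    mixed≡-mixed = ≡θ-trans (≈⇒≡θ (sym (diag-swap (λ m t → a~ t * A m) h′)))
      (≡θ-trans (≡θ-diag h′ λ m t m+t≡h′ →
        let m≤h′ = ≡.subst (m ℕ.≤_) m+t≡h′ (ℕₚ.m≤m+n m t)
        in ≡θ-trans (≡θ-* (O-a~ m m≤h′) (O-A m (ℕₚ.m≤n⇒m≤1+n m≤h′))
             (W₂.antisymmetric t m (≡.trans (ℕₚ.+-comm t m) m+t≡h′)) (≡θ-sym (A-reflect m t m+t≡h′)))
           (≈⇒≡θ (solve 2 (λ x y → (:- x) :* y := (:- :1) :* (x :* y)) refl (a~ t) (A m))))
      (≈⇒≡θ (trans (diag-scale (- 1#) (λ m t → a~ t * A m) h′) (solve 1 (λ x → (:- :1) :* x := :- x) refl mixed))))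

    cube-congruence : Σ Carrier λ z → O z × (double-sum - R * R ≈ π * (π * π) * z)
    cube-congruence = _ , O-+ (O-* (O-* O-y (O-* O-y O-y)) (O-* O-z₀ (O-+ O-R₁ (O-+ O-R₁ (O-* O-1-u O-z₀))))) (O-* (O-* O-y O-y) O-z₁) , (begin
      double-sum - R * R
        ≈⟨ difference ⟩
      θ * (z₀ * (S + R) + (mixed + mixed))
        -- θ already carries π². The third factor comes from S + R, in which both terms are
        -- multiples of 1 - u, and from mixed + mixed = π z₁.
        ≈⟨ *-congˡ (+-cong (*-congˡ (+-cong (trans S≈ (+-congʳ R≈)) R≈)) mixed²) ⟩
      θ * (z₀ * ((1-u * R₁ + θ * z₀) + 1-u * R₁) + π * z₁)
        ≈⟨ solve 5 (λ z R m p w → (z :* z) :* (m :* ((z :* R :+ (z :* z) :* m) :+ z :* R) :+ p :* w)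
             := (z :* (z :* z)) :* (m :* (R :+ (R :+ z :* m))) :+ p :* ((z :* z) :* w)) refl 1-u R₁ z₀ π z₁ ⟩
      (1-u * (1-u * 1-u)) * (z₀ * (R₁ + (R₁ + 1-u * z₀))) + π * ((1-u * 1-u) * z₁)
        ≈⟨ +-cong (*-congʳ (*-cong 1-u≈π*y (*-cong 1-u≈π*y 1-u≈π*y))) (*-congˡ (*-congʳ (*-cong 1-u≈π*y 1-u≈π*y))) ⟩
      ((π * y) * ((π * y) * (π * y))) * (z₀ * (R₁ + (R₁ + 1-u * z₀))) + π * (((π * y) * (π * y)) * z₁)
        ≈⟨ solve 4 (λ p y m w → ((p :* y) :* ((p :* y) :* (p :* y))) :* m :+ p :* (((p :* y) :* (p :* y)) :* w)
             := p :* (p :* p) :* ((y :* (y :* y)) :* m :+ (y :* y) :* w)) refl π y (z₀ * (R₁ + (R₁ + 1-u * z₀))) z₁ ⟩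
      π * (π * π) * ((y * (y * y)) * (z₀ * (R₁ + (R₁ + 1-u * z₀))) + (y * y) * z₁) ∎)
      where
      1-u = 1# - u
      open _≡θ_ mixed≡-mixed renaming (quotient to z₁; O-quotient to O-z₁; equation to e₁)
      mixed² : mixed + mixed ≈ π * z₁
      mixed² = trans (solve 1 (λ x → x :+ x := x :- :- x) refl mixed) e₁

-- From formal rational functions to elements of K.

module PolynomialFractions (F : FractionRing ℚ[q]) where
  open FractionRing F
  open CommutativeRing K hiding (zero)
  open IntegerSolver K
  open DoubleSums K
  open Coprimality ℚ[q]
  open MonicDivision
  open Cyclotomic
  open Algebra.Properties.CommutativeSemiring.Exp commutativeSemiring
  open Relation.Binary.Reasoning.Setoid setoid
  private module Poly = IntegerSolver ℚ[q]

  q : Carrier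
  q = ι (X^ 1)

  open QPowers K q

  ι-⊖ : ∀ a b → ι (a ⊖ b) ≈ ι a - ι b
  ι-⊖ a b = trans (ι-+ a (negP b)) (+-congˡ (ι-neg b))

  ι-X^ : ∀ m → ι (X^ m) ≈ q ^ m
  ι-X^ zero    = ι-1
  ι-X^ (suc m) = trans (ι-cong (X^-suc m)) (trans (ι-* (X^ 1) (X^ m)) (*-congˡ (ι-X^ m)))

  ι-1⊖X^ : ∀ m → ι (oneP ⊖ X^ m) ≈ 1# - q ^ m
  ι-1⊖X^ m = trans (ι-⊖ oneP (X^ m)) (+-cong ι-1 (-‿cong (ι-X^ m)))

  ι-1⊕X^ : ∀ m → ι (oneP ⊕ X^ m) ≈ 1# + q ^ m
  ι-1⊕X^ m = trans (ι-+ oneP (X^ m)) (+-cong ι-1 (ι-X^ m))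

  X≈q^ : ∀ k → X k ≈ q ^ (4 ℕ.* k)
  X≈q^ zero    = refl
  X≈q^ (suc k) = begin
    p * X k                  ≈⟨ *-cong (solve 1 (λ q → (q :* q) :* (q :* q) := q :* (q :* (q :* (q :* :1)))) refl q) (X≈q^ k) ⟩
    q ^ 4 * q ^ (4 ℕ.* k)    ≈⟨ ^-homo-* q 4 (4 ℕ.* k) ⟨
    q ^ (4 ℕ.+ 4 ℕ.* k)      ≈⟨ ^-congʳ q (ℕₚ.*-suc 4 k) ⟨
    q ^ (4 ℕ.* suc k)        ∎

  s≈q^2 : s ≈ q ^ 2
  s≈q^2 = solve 1 (λ q → q :* q := q :* (q :* :1)) refl q

  q*X≈ : ∀ k → q * X k ≈ q ^ (4 ℕ.* k ℕ.+ 1)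
  q*X≈ k = trans (*-congˡ (X≈q^ k)) (^-congʳ q (ℕₚ.+-comm 1 (4 ℕ.* k)))

  s*X≈ : ∀ k → s * X k ≈ q ^ (2 ℕ.+ 4 ℕ.* k)
  s*X≈ k = trans (*-cong s≈q^2 (X≈q^ k)) (sym (^-homo-* q 2 (4 ℕ.* k)))

  ι-f : ∀ k → ι (qpoch 4 4 k) ≈ f k
  ι-f zero    = ι-1
  ι-f (suc k) = trans (ι-* _ _) (*-cong (ι-f k) (trans (ι-1⊖X^ (4 ℕ.+ 4 ℕ.* k))
    (+-congˡ (-‿cong (trans (^-congʳ q (≡.sym (ℕₚ.*-suc 4 k))) (sym (X≈q^ (suc k))))))))

  ι-g : ∀ k → ι (qpoch 2 4 k) ≈ g k
  ι-g zero    = ι-1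
  ι-g (suc k) = trans (ι-* _ _) (*-cong (ι-g k) (trans (ι-1⊖X^ (2 ℕ.+ 4 ℕ.* k)) (+-congˡ (-‿cong (sym (s*X≈ k))))))

  cancellable-1⊖X^ : ∀ m → Cancellable (oneP ⊖ X^ (suc m))
  cancellable-1⊖X^ m = cancellable-∷ (1ℚ ℚ.- 0ℚ) _ λ ()

  cancellable-1⊕X : Cancellable (oneP ⊕ X^ 1)
  cancellable-1⊕X = cancellable-∷ (1ℚ ℚ.+ 0ℚ) _ λ ()

  cancellable-X : Cancellable (X^ 1)
  cancellable-X x x⊛X≋0 = mk λ i → at shifted (suc i)
    where
    shifted : 0ℚ ∷ x ≋ []
    shifted = ≋-trans (∷-cong ≡.refl (≋-sym (⊛-identityˡ x))) (≋-trans (≋-sym (shift-⊛ oneP x))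
      (≋-trans (⊛-comm (X^ 1) x) x⊛X≋0))

  cancellable-qpoch : ∀ e s k → Cancellable (qpoch (suc e) s k)
  cancellable-qpoch e s zero    = cancellable-1
  cancellable-qpoch e s (suc k) = cancellable-* (cancellable-qpoch e s k) (cancellable-1⊖X^ (e ℕ.+ s ℕ.* k))

  cancellable-1⊖X^4k+1 : ∀ k → Cancellable (oneP ⊖ X^ (4 ℕ.* k ℕ.+ 1))
  cancellable-1⊖X^4k+1 k rewrite ℕₚ.+-comm (4 ℕ.* k) 1 = cancellable-1⊖X^ (4 ℕ.* k)

  inverses : QInverses K q
  inverses = record
    { fi   = λ k → 1/ (cancellable-qpoch 3 4 k)
    ; gi   = λ k → 1/ (cancellable-qpoch 1 4 k)
    ; ci   = λ k → 1/ (cancellable-1⊖X^4k+1 k)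
    ; f*fi = λ k → trans (*-congʳ (sym (ι-f k))) (1/-inverse (cancellable-qpoch 3 4 k))
    ; g*gi = λ k → trans (*-congʳ (sym (ι-g k))) (1/-inverse (cancellable-qpoch 1 4 k))
    ; c*ci = λ k → trans (*-congʳ (trans (+-congˡ (-‿cong (q*X≈ k))) (sym (ι-1⊖X^ (4 ℕ.* k ℕ.+ 1)))))
                     (1/-inverse (cancellable-1⊖X^4k+1 k)) }

  open QInverses inverses

  -- Sums and products of `RatFun` pile up unreduced denominators; this relation forgets them and
  -- retains the value in K, with the regularity that makes the value unique.
  record Represents (r : RatFun) (x : Carrier) : Set where
    constructor represents
    field
      regular : Cancellable (den r)
      value   : x * ι (den r) ≈ ι (num r)

  rep-⊞ : ∀ {r t x y} → Represents r x → Represents t y → Represents (r ⊞ t) (x + y)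
  rep-⊞ {a // b} {c // d} {x} {y} (represents rb e) (represents rd e′) = represents (cancellable-* rb rd) (begin
    (x + y) * ι (b ⊛ d)                    ≈⟨ *-congˡ (ι-* b d) ⟩
    (x + y) * (ι b * ι d)                  ≈⟨ solve 4 (λ x y b d → (x :+ y) :* (b :* d) := (x :* b) :* d :+ (y :* d) :* b) refl x y (ι b) (ι d) ⟩
    (x * ι b) * ι d + (y * ι d) * ι b      ≈⟨ +-cong (*-congʳ e) (*-congʳ e′) ⟩
    ι a * ι d + ι c * ι b                  ≈⟨ trans (ι-+ _ _) (+-cong (ι-* a d) (ι-* c b)) ⟨
    ι (a ⊛ d ⊕ c ⊛ b)                      ∎)

  rep-⊠ : ∀ {r t x y} → Represents r x → Represents t y → Represents (r ⊠ t) (x * y)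
  rep-⊠ {a // b} {c // d} {x} {y} (represents rb e) (represents rd e′) = represents (cancellable-* rb rd) (begin
    x * y * ι (b ⊛ d)                      ≈⟨ *-congˡ (ι-* b d) ⟩
    x * y * (ι b * ι d)                    ≈⟨ solve 4 (λ x y b d → x :* y :* (b :* d) := (x :* b) :* (y :* d)) refl x y (ι b) (ι d) ⟩
    (x * ι b) * (y * ι d)                  ≈⟨ *-cong e e′ ⟩
    ι a * ι c                              ≈⟨ ι-* a c ⟨
    ι (a ⊛ c)                              ∎)

  rep-polyR : ∀ p → Represents (polyR p) (ι p)
  rep-polyR p = represents cancellable-1 (trans (*-congˡ ι-1) (*-identityʳ (ι p)))

  rep-sumR : ∀ n {G : ℕ → RatFun} {H : ℕ → Carrier} → (∀ k → Represents (G k) (H k)) → Represents (sumR n G) (sum n H)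
  rep-sumR zero    e = represents cancellable-1 (trans (zeroˡ _) (sym ι-0))
  rep-sumR (suc n) e = rep-⊞ (rep-sumR n e) (e n)

  rep-resp : ∀ {r x y} → x ≈ y → Represents r x → Represents r y
  rep-resp x≈y (represents rr e) = represents rr (trans (*-congʳ (sym x≈y)) e)

  congMod : ∀ {r t x y P} → Represents r x → Represents t y →
    (Σ Poly λ U → Σ Poly λ V → Coprime V P × ((x - y) * ι V ≈ ι (U ⊛ P))) → CongMod r t P
  congMod {a // b} {c // d} {x} {y} {P} (represents _ e) (represents _ e′) (U , V , (s , t , V⊥P) , xV) =
    U ⊛ P , V , (U , ≋⇒≈P (≋-refl {U ⊛ P})) , (s , t , ≋⇒≈P V⊥P) , ≋⇒≈P (ι-injective (begin
      ι ((a ⊛ d ⊖ c ⊛ b) ⊛ V)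
        ≈⟨ trans (ι-* _ V) (*-congʳ (trans (ι-⊖ (a ⊛ d) (c ⊛ b)) (+-cong (ι-* a d) (-‿cong (ι-* c b))))) ⟩
      (ι a * ι d - ι c * ι b) * ι V
        ≈⟨ *-congʳ (+-cong (*-congʳ (sym e)) (-‿cong (*-congʳ (sym e′)))) ⟩
      (x * ι b * ι d - y * ι d * ι b) * ι V
        ≈⟨ solve 5 (λ x y b d v → (x :* b :* d :- y :* d :* b) :* v := ((x :- y) :* v) :* (b :* d)) refl x y (ι b) (ι d) (ι V) ⟩
      ((x - y) * ι V) * (ι b * ι d)
        ≈⟨ *-cong xV (sym (ι-* b d)) ⟩
      ι (U ⊛ P) * ι (b ⊛ d)
        ≈⟨ ι-* (U ⊛ P) (b ⊛ d) ⟨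
      ι ((U ⊛ P) ⊛ (b ⊛ d)) ∎))

  ι-square : ∀ p → ι (p ^P 2) ≈ ι p * ι p
  ι-square p = trans (ι-* p (p ⊛ oneP)) (*-congˡ (trans (ι-* p oneP) (trans (*-congˡ ι-1) (*-identityʳ (ι p)))))

  -- (-1)^k q^(2k²+k), the power of q in c_q(k).
  signed-power : ∀ k → e k * s ^ k ≈ ι (signP k) * q ^ (2 ℕ.* k ℕ.* k ℕ.+ k)
  signed-power zero    = *-congʳ (sym ι-1)
  signed-power (suc k) = begin
    (- (q * X k) * e k) * (s * s ^ k)
      ≈⟨ solve 5 (λ q x e s w → (:- (q :* x) :* e) :* (s :* w) := (:- (q :* (s :* x))) :* (e :* w)) refl q (X k) (e k) s (s ^ k) ⟩
    - (q * (s * X k)) * (e k * s ^ k)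
      ≈⟨ *-cong (-‿cong (*-congˡ (s*X≈ k))) (signed-power k) ⟩
    - (q ^ (3 ℕ.+ 4 ℕ.* k)) * (ι (signP k) * q ^ (2 ℕ.* k ℕ.* k ℕ.+ k))
      ≈⟨ solve 3 (λ x i y → (:- x) :* (i :* y) := (:- i) :* (x :* y)) refl (q ^ (3 ℕ.+ 4 ℕ.* k)) (ι (signP k)) _ ⟩
    - ι (signP k) * (q ^ (3 ℕ.+ 4 ℕ.* k) * q ^ (2 ℕ.* k ℕ.* k ℕ.+ k))
      ≈⟨ *-cong (sym (ι-neg (signP k))) (trans (sym (^-homo-* q (3 ℕ.+ 4 ℕ.* k) _)) (^-congʳ q
           (solveℕ 1 (λ k → (conₙ 3 +ₙ conₙ 4 *ₙ k) +ₙ (conₙ 2 *ₙ k *ₙ k +ₙ k)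
             =ₙ conₙ 2 *ₙ (conₙ 1 +ₙ k) *ₙ (conₙ 1 +ₙ k) +ₙ (conₙ 1 +ₙ k)) ≡.refl k))) ⟩
    ι (signP (suc k)) * q ^ (2 ℕ.* suc k ℕ.* suc k ℕ.+ suc k) ∎

  ε : Carrier
  ε = 1/ cancellable-1⊕X

  1+q*ε : (1# + q) * ε ≈ 1#
  1+q*ε = trans (*-congʳ (sym (trans (ι-1⊕X^ 1) (+-congˡ (*-identityʳ q))))) (1/-inverse cancellable-1⊕X)

  rep-cq : ∀ k → Represents (cq k) (e k * s ^ k * (1# + q * X k) * ε * ((g k * fi k) * (g k * fi k)))
  rep-cq k = represents (cancellable-* cancellable-1⊕X
      (cancellable-* (cancellable-qpoch 3 4 k) (cancellable-* (cancellable-qpoch 3 4 k) cancellable-1))) (begin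
    e k * s ^ k * (1# + q * X k) * ε * ((g k * fi k) * (g k * fi k)) * ι ((oneP ⊕ X^ 1) ⊛ (qpoch 4 4 k ^P 2))
      ≈⟨ *-congˡ (trans (ι-* _ _) (*-cong (trans (ι-1⊕X^ 1) (+-congˡ (*-identityʳ q)))
           (trans (ι-square (qpoch 4 4 k)) (*-cong (ι-f k) (ι-f k))))) ⟩
    e k * s ^ k * (1# + q * X k) * ε * ((g k * fi k) * (g k * fi k)) * ((1# + q) * (f k * f k))
      ≈⟨ solve 7 (λ B y ε G F z f → B :* y :* ε :* ((G :* F) :* (G :* F)) :* (z :* (f :* f))
           := (z :* ε) :* ((f :* F) :* (f :* F)) :* (B :* y :* (G :* G))) refl (e k * s ^ k) (1# + q * X k) ε (g k) (fi k) (1# + q) (f k) ⟩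
    ((1# + q) * ε) * ((f k * fi k) * (f k * fi k)) * (e k * s ^ k * (1# + q * X k) * (g k * g k))
      ≈⟨ *-cong (trans (*-cong 1+q*ε (*-cong (f*fi k) (f*fi k))) (solve 0 (:1 :* (:1 :* :1) := :1) refl))
           (*-congʳ (*-cong (signed-power k) (+-congˡ (q*X≈ k)))) ⟩
    1# * (ι (signP k) * q ^ N * (1# + q ^ (4 ℕ.* k ℕ.+ 1)) * (g k * g k))
      ≈⟨ solve 4 (λ i x y G → :1 :* (i :* x :* y :* (G :* G)) := i :* y :* (G :* G) :* x) refl (ι (signP k)) (q ^ N) _ (g k) ⟩
    ι (signP k) * (1# + q ^ (4 ℕ.* k ℕ.+ 1)) * (g k * g k) * q ^ N
      ≈⟨ trans (ι-* _ _) (*-cong (trans (ι-* _ _) (*-cong (trans (ι-* _ _) (*-congˡ (ι-1⊕X^ (4 ℕ.* k ℕ.+ 1))))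
           (trans (ι-square (qpoch 2 4 k)) (*-cong (ι-g k) (ι-g k))))) (ι-X^ N)) ⟨
    ι (signP k ⊛ (oneP ⊕ X^ (4 ℕ.* k ℕ.+ 1)) ⊛ (qpoch 2 4 k ^P 2) ⊛ X^ N) ∎)
    where N = 2 ℕ.* k ℕ.* k ℕ.+ k

  qint-geometric : ∀ r m → (oneP ⊖ X^ r) ⊛ qint r m ≋ oneP ⊖ X^ (r ℕ.* m)
  qint-geometric r zero rewrite ℕₚ.*-zeroʳ r = ≋-trans (⊛-zeroʳ (oneP ⊖ X^ r)) (≋-sym (negP-inverseʳ oneP))
  qint-geometric r (suc m) = ≋-trans
    (≋-trans (⊛-distribˡ (oneP ⊖ X^ r) (qint r m) (X^ (r ℕ.* m))) (⊕-cong (qint-geometric r m) ≋-refl))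
    (≋-trans (Poly.solve 2 (λ x y → (Poly.:1 Poly.:- y) Poly.:+ (Poly.:1 Poly.:- x) Poly.:* y Poly.:= Poly.:1 Poly.:- x Poly.:* y)
               ≋-refl (X^ r) (X^ (r ℕ.* m)))
      (⊕-cong (≋-refl {oneP}) (negP-cong (≋-trans (≋-sym (X^-+ r (r ℕ.* m))) (X^-cong (≡.sym (ℕₚ.*-suc r m)))))))

  ι-qint : ∀ r m → ι (qint r m) * (1# - q ^ r) ≈ 1# - q ^ (r ℕ.* m)
  ι-qint r m = begin
    ι (qint r m) * (1# - q ^ r)         ≈⟨ trans (*-congˡ (sym (ι-1⊖X^ r))) (*-comm _ _) ⟩
    ι (oneP ⊖ X^ r) * ι (qint r m)      ≈⟨ ι-* _ _ ⟨
    ι ((oneP ⊖ X^ r) ⊛ qint r m)        ≈⟨ ι-cong (qint-geometric r m) ⟩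
    ι (oneP ⊖ X^ (r ℕ.* m))             ≈⟨ ι-1⊖X^ (r ℕ.* m) ⟩
    1# - q ^ (r ℕ.* m)                  ∎

  s^≈q^ : ∀ k → s ^ k ≈ q ^ (2 ℕ.* k)
  s^≈q^ k = trans (^-congˡ k s≈q^2) (^-assocʳ q 2 k)

  rep-inner : ∀ k → Represents ((qpoch 2 4 k ⊛ X^ (2 ℕ.* k)) // (qint 1 (4 ℕ.* k ℕ.+ 1) ⊛ qpoch 4 4 k))
                      ((1# - q) * (s ^ k * (g k * fi k) * ci k))
  rep-inner k = represents (cancellable-* (cancellable-∣ (oneP ⊖ X^ 1 , qint-geometric 1 m)
      (≡.subst (λ j → Cancellable (oneP ⊖ X^ j)) (≡.sym (ℕₚ.*-identityˡ m)) (cancellable-1⊖X^4k+1 k))) (cancellable-qpoch 3 4 k)) (begin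
    (1# - q) * (s ^ k * (g k * fi k) * ci k) * ι (qint 1 m ⊛ qpoch 4 4 k)
      ≈⟨ *-congˡ (trans (ι-* _ _) (*-congˡ (ι-f k))) ⟩
    (1# - q) * (s ^ k * (g k * fi k) * ci k) * (ι (qint 1 m) * f k)
      ≈⟨ solve 7 (λ z w G F c i f → z :* (w :* (G :* F) :* c) :* (i :* f) := ((i :* z) :* c) :* (f :* F) :* (G :* w))
           refl (1# - q) (s ^ k) (g k) (fi k) (ci k) (ι (qint 1 m)) (f k) ⟩
    ((ι (qint 1 m) * (1# - q)) * ci k) * (f k * fi k) * (g k * s ^ k)
      ≈⟨ *-congʳ (*-cong (trans (*-congʳ numerator) (c*ci k)) (f*fi k)) ⟩
    1# * 1# * (g k * s ^ k)
      ≈⟨ trans (*-congʳ (*-identityʳ 1#)) (*-identityˡ _) ⟩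
    g k * s ^ k
      ≈⟨ trans (ι-* _ _) (*-cong (ι-g k) (trans (ι-X^ (2 ℕ.* k)) (sym (s^≈q^ k)))) ⟨
    ι (qpoch 2 4 k ⊛ X^ (2 ℕ.* k)) ∎)
    where
    m = 4 ℕ.* k ℕ.+ 1
    numerator : ι (qint 1 m) * (1# - q) ≈ 1# - q * X k
    numerator = begin
      ι (qint 1 m) * (1# - q)       ≈⟨ *-congˡ (+-congˡ (-‿cong (*-identityʳ q))) ⟨
      ι (qint 1 m) * (1# - q ^ 1)   ≈⟨ ι-qint 1 m ⟩
      1# - q ^ (1 ℕ.* m)            ≈⟨ +-congˡ (-‿cong (^-congʳ q (ℕₚ.*-identityˡ m))) ⟩
      1# - q ^ m                    ≈⟨ +-congˡ (-‿cong (q*X≈ k)) ⟨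
      1# - q * X k                  ∎

  d²≈ : ∀ k → d k * d k ≈ q ^ ((k ℕ.+ k) ℕ.* (k ℕ.+ k))
  d²≈ zero    = *-identityʳ 1#
  d²≈ (suc k) = begin
    (- (s * X k) * d k) * (- (s * X k) * d k)
      ≈⟨ solve 2 (λ x d → (:- x :* d) :* (:- x :* d) := (x :* x) :* (d :* d)) refl (s * X k) (d k) ⟩
    ((s * X k) * (s * X k)) * (d k * d k)
      ≈⟨ *-cong (trans (*-cong (s*X≈ k) (s*X≈ k)) (sym (^-homo-* q N N))) (d²≈ k) ⟩
    q ^ (N ℕ.+ N) * q ^ ((k ℕ.+ k) ℕ.* (k ℕ.+ k))
      ≈⟨ ^-homo-* q (N ℕ.+ N) _ ⟨
    q ^ (N ℕ.+ N ℕ.+ (k ℕ.+ k) ℕ.* (k ℕ.+ k))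
      ≈⟨ ^-congʳ q (solveℕ 1 (λ k → let N = conₙ 2 +ₙ conₙ 4 *ₙ k in
           N +ₙ N +ₙ (k +ₙ k) *ₙ (k +ₙ k) =ₙ ((conₙ 1 +ₙ k) +ₙ (conₙ 1 +ₙ k)) *ₙ ((conₙ 1 +ₙ k) +ₙ (conₙ 1 +ₙ k))) ≡.refl k) ⟩
    q ^ ((suc k ℕ.+ suc k) ℕ.* (suc k ℕ.+ suc k)) ∎
    where N = 2 ℕ.+ 4 ℕ.* k

-- Which inverses are local, and the conclusion.

module Assembly (F : FractionRing ℚ[q]) (h′ : ℕ) where
  open FractionRing F
  open CommutativeRing K hiding (zero)
  open IntegerSolver K
  open FiniteSums K
  open DoubleSums K
  open Coprimality ℚ[q]
  open MonicDivision
  open Cyclotomic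
  open LocalRing ℚ[q] F
  open PolynomialFractions F
  open QPowers K q
  open QInverses inverses
  open WatsonIdentity K q inverses using (gi-suc)
  open Algebra.Properties.CommutativeSemiring.Exp commutativeSemiring
  open Relation.Binary.Reasoning.Setoid setoid

  h : ℕ
  h = suc h′

  open Moduli h using (n; ∣-double; Z-double)

  n∤small : ∀ j → 1 ℕ.≤ j → j < n → ¬ n ∣ j
  n∤small (suc j) _ j<n n∣j = ℕₚ.<⇒≱ j<n (Div.∣⇒≤ n∣j)

  -- The exponents 2k + 1 and 4k + 1 to be tested lie strictly between 0 and 2n, so divisibility by
  -- n singles out one value of k at most.
  ∣⇒≡ : ∀ j → 1 ℕ.≤ j → j < n ℕ.+ n → n ∣ j → j ≡ n
  ∣⇒≡ j 1≤j j<2n (divides zero          ≡.refl) = ⊥-elim (ℕₚ.<⇒≱ 1≤j ℕ.z≤n)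
  ∣⇒≡ j 1≤j j<2n (divides (suc zero)    ≡.refl) = ℕₚ.*-identityˡ n
  ∣⇒≡ j 1≤j j<2n (divides (suc (suc c)) ≡.refl) = ⊥-elim (ℕₚ.<⇒≱ j<2n
    (ℕₚ.+-monoʳ-≤ n (ℕₚ.m≤m+n n (c ℕ.* n))))

  coprime-neg : ∀ {a P} → Coprime a P → Coprime (negP a) P
  coprime-neg {a} {P} = coprime-combination (negP oneP) []
    (S.solve 2 (λ a P → a S.:= (S.:- S.:1) S.:* (S.:- a) S.:+ S.con (+ 0) S.:* P) ≋-refl a P)
    where module S = IntegerSolver ℚ[q]

  Z-neg : ∀ m → negP (Z m) ≋ oneP ⊖ X^ m
  Z-neg m = S.solve 1 (λ x → S.:- (x S.:- S.:1) S.:= S.:1 S.:- x) ≋-refl (X^ m)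
    where module S = IntegerSolver ℚ[q]

  coprime-1⊖X^ : ∀ {P} m → Coprime (Z m) P → Coprime (oneP ⊖ X^ m) P
  coprime-1⊖X^ m Zm⊥P = coprime-resp (Z-neg m) (coprime-neg Zm⊥P)

  u : Carrier
  u = s * X h

  u≈q^2n : u ≈ q ^ (n ℕ.+ n)
  u≈q^2n = trans (s*X≈ h) (^-congʳ q (solveℕ 1 (λ h → conₙ 2 +ₙ conₙ 4 *ₙ h
    =ₙ (conₙ 1 +ₙ (h +ₙ h)) +ₙ (conₙ 1 +ₙ (h +ₙ h))) ≡.refl h))

  1-u≈ : 1# - u ≈ ι (oneP ⊖ X^ (n ℕ.+ n))
  1-u≈ = trans (+-congˡ (-‿cong u≈q^2n)) (sym (ι-1⊖X^ (n ℕ.+ n)))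

  subring : ∀ P → IsSubring K (Local P)
  subring P = record
    { O-resp = local-cong ; O-1 = local-cong ι-1 (local-ι oneP) ; O-+ = local-+ ; O-* = local-* ; O-neg = local-neg }

  module AtModulus (P : Poly) (isModulus : IsModulus n P) where
    open IsModulus isModulus
    open IsSubring (subring P)

    coprime-double : ∀ m j → m ≡ j ℕ.+ j → ¬ n ∣ j → Coprime (oneP ⊖ X^ m) P
    coprime-double m j ≡.refl n∤j = coprime-1⊖X^ (j ℕ.+ j) (coprime-Z j n∤j)

    coprime-4k : ∀ k → k < h ℕ.+ h → Coprime (oneP ⊖ X^ (4 ℕ.+ 4 ℕ.* k)) P
    coprime-4k k k<2h = coprime-double _ (suc k ℕ.+ suc k)
      (solveℕ 1 (λ k → conₙ 4 +ₙ conₙ 4 *ₙ k =ₙ ((conₙ 1 +ₙ k) +ₙ (conₙ 1 +ₙ k)) +ₙ ((conₙ 1 +ₙ k) +ₙ (conₙ 1 +ₙ k))) ≡.refl k)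
      (λ n∣ → n∤small (suc k) (ℕ.s≤s ℕ.z≤n) (ℕ.s≤s k<2h) (∣-double (suc k) n∣))

    -- 4k + 2 is twice 2k + 1, which is below 2n; n divides it only when 2k + 1 = n, that is, k = h.
    coprime-4k+2 : ∀ k → ¬ k ≡ h → k ℕ.≤ h ℕ.+ h → Coprime (oneP ⊖ X^ (2 ℕ.+ 4 ℕ.* k)) P
    coprime-4k+2 k k≢h k≤2h = coprime-double _ (suc (k ℕ.+ k))
      (solveℕ 1 (λ k → conₙ 2 +ₙ conₙ 4 *ₙ k =ₙ (conₙ 1 +ₙ (k +ₙ k)) +ₙ (conₙ 1 +ₙ (k +ₙ k))) ≡.refl k)
      λ n∣ → k≢h (double-injective k h (ℕₚ.suc-injective (∣⇒≡ _ (ℕ.s≤s ℕ.z≤n) small n∣)))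
      where
      small : suc (k ℕ.+ k) < n ℕ.+ n
      small = ℕ.s≤s (≡.subst (suc (k ℕ.+ k) ℕ.≤_) (≡.sym (ℕₚ.+-suc (h ℕ.+ h) (h ℕ.+ h))) (ℕ.s≤s (ℕₚ.+-mono-≤ k≤2h k≤2h)))
      double-injective : ∀ i j → i ℕ.+ i ≡ j ℕ.+ j → i ≡ j
      double-injective zero    zero    _ = ≡.refl
      double-injective (suc i) (suc j) e = ≡.cong suc (double-injective i j
        (ℕₚ.suc-injective (≡.trans (≡.sym (ℕₚ.+-suc i i)) (≡.trans (ℕₚ.suc-injective e) (ℕₚ.+-suc j j)))))

    coprime-qpoch : ∀ e k → (∀ i → i < k → Coprime (oneP ⊖ X^ (e ℕ.+ 4 ℕ.* i)) P) → Coprime (qpoch e 4 k) P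
    coprime-qpoch e zero    _   = coprime-1
    coprime-qpoch e (suc k) cop = coprime-* (coprime-qpoch e k λ i i<k → cop i (ℕₚ.m≤n⇒m≤1+n i<k)) (cop k ℕₚ.≤-refl)

    ι-inverse : ∀ {V} (rV : Cancellable V) → Coprime V P → Local P (1/ rV)
    ι-inverse rV V⊥P = local-inverse V⊥P (1/-inverse rV)

    Local-fi : ∀ k → k ℕ.≤ h ℕ.+ h → Local P (fi k)
    Local-fi k k≤2h = ι-inverse (cancellable-qpoch 3 4 k)
      (coprime-qpoch 4 k λ i i<k → coprime-4k i (ℕₚ.≤-trans i<k k≤2h))

    Local-gi : ∀ k → k ℕ.≤ h → Local P (gi k)
    Local-gi k k≤h = ι-inverse (cancellable-qpoch 1 4 k)
      (coprime-qpoch 2 k λ i i<k → coprime-4k+2 i (ℕₚ.<⇒≢ (ℕₚ.≤-trans i<k k≤h))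
        (ℕₚ.≤-trans (ℕₚ.<⇒≤ (ℕₚ.≤-trans i<k k≤h)) (ℕₚ.m≤m+n h h)))

    -- The base case is (1 - u) / g (h+1) = 1 / g h; every factor of g after that is coprime to P
    -- and is inverted in turn.
    Local-gi′ : ∀ t → suc h ℕ.+ t ℕ.≤ suc (h ℕ.+ h) → Local P ((1# - u) * gi (suc h ℕ.+ t))
    Local-gi′ zero _ rewrite ℕₚ.+-identityʳ h′ = local-cong (trans (gi-suc h) (*-comm _ _)) (Local-gi h ℕₚ.≤-refl)
    Local-gi′ (suc t) k<  rewrite ℕₚ.+-suc h′ t = local-cong (begin
      (1# - u) * gi k * 1/ c
        ≈⟨ *-congʳ (*-congˡ (gi-suc k)) ⟩
      (1# - u) * (gi (suc k) * (1# - s * X k)) * 1/ c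
        ≈⟨ solve 4 (λ z g x y → z :* (g :* x) :* y := z :* g :* (x :* y)) refl (1# - u) (gi (suc k)) (1# - s * X k) (1/ c) ⟩
      (1# - u) * gi (suc k) * ((1# - s * X k) * 1/ c)
        ≈⟨ *-congˡ (trans (*-congʳ (sym (trans (ι-1⊖X^ (2 ℕ.+ 4 ℕ.* k)) (+-congˡ (-‿cong (sym (s*X≈ k))))))) (1/-inverse c)) ⟩
      (1# - u) * gi (suc k) * 1#
        ≈⟨ *-identityʳ _ ⟩
      (1# - u) * gi (suc k) ∎)
      (local-* (Local-gi′ t (ℕₚ.<⇒≤ k<)) (ι-inverse c (coprime-4k+2 k (λ k≡h → ℕₚ.<⇒≢ (ℕ.s≤s (ℕₚ.m≤m+n h t)) (≡.sym k≡h)) (ℕₚ.≤-pred k<))))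
      where
      k = suc h ℕ.+ t
      c : Cancellable (oneP ⊖ X^ (2 ℕ.+ 4 ℕ.* k))
      c = cancellable-1⊖X^ (1 ℕ.+ 4 ℕ.* k)

    4k+1<2n : ∀ k → k ℕ.≤ h → 4 ℕ.* k ℕ.+ 1 < n ℕ.+ n
    4k+1<2n k k≤h = ≡.subst₂ _<_ ≡.refl
      (solveℕ 1 (λ h → conₙ 1 +ₙ (conₙ 4 *ₙ h +ₙ conₙ 1) =ₙ (conₙ 1 +ₙ (h +ₙ h)) +ₙ (conₙ 1 +ₙ (h +ₙ h))) ≡.refl h)
      (ℕ.s≤s (ℕₚ.+-monoˡ-≤ 1 (ℕₚ.*-monoʳ-≤ 4 k≤h)))

    Local-ci-coprime : ∀ k → ¬ n ∣ 4 ℕ.* k ℕ.+ 1 → Local P (ci k)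
    Local-ci-coprime k n∤m = ι-inverse (cancellable-1⊖X^4k+1 k) (coprime-1⊖X^ m
      (coprime-∣ (X^ m ⊕ oneP , ≋-sym (Z-double m)) (coprime-Z m n∤m)))
      where m = 4 ℕ.* k ℕ.+ 1

    1-u≈1-q^n : 1# - u ≈ (1# - q ^ n) * (1# + q ^ n)
    1-u≈1-q^n = trans (+-congˡ (-‿cong (trans u≈q^2n (^-homo-* q n n))))
      (solve 1 (λ x → :1 :- x :* x := (:1 :- x) :* (:1 :+ x)) refl (q ^ n))

    Local-q : Local P q
    Local-q = local-ι (X^ 1)

    Local-q^ : ∀ m → Local P (q ^ m)
    Local-q^ m = local-cong (ι-X^ m) (local-ι (X^ m))

    Local-1-u : Local P (1# - u)
    Local-1-u = local-cong (sym 1-u≈) (local-ι _)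

    -- When 4k + 1 = n the denominator 1 - q^n divides 1 - u = (1 - q^n)(1 + q^n), and the product
    -- is 1 + q^n.
    Local-ci : ∀ k → k ℕ.≤ h → Local P ((1# - u) * ci k)
    Local-ci k k≤h with n ∣? 4 ℕ.* k ℕ.+ 1
    ... | no  n∤m = local-* Local-1-u (Local-ci-coprime k n∤m)
    ... | yes n∣m = local-cong (sym (begin
      (1# - u) * ci k                              ≈⟨ *-congʳ 1-u≈1-q^n ⟩
      (1# - q ^ n) * (1# + q ^ n) * ci k           ≈⟨ solve 3 (λ x y c → x :* y :* c := y :* (x :* c)) refl _ _ (ci k) ⟩
      (1# + q ^ n) * ((1# - q ^ n) * ci k)         ≈⟨ *-congˡ (*-congʳ (+-congˡ (-‿cong
                                                        (trans (q*X≈ k) (^-congʳ q (∣⇒≡ _ (ℕₚ.m≤n+m 1 (4 ℕ.* k)) (4k+1<2n k k≤h) n∣m)))))) ⟨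
      (1# + q ^ n) * ((1# - q * X k) * ci k)       ≈⟨ trans (*-congˡ (c*ci k)) (*-identityʳ _) ⟩
      1# + q ^ n                                   ∎))
      (O-+ O-1 (Local-q^ n))

    coprime-X : Coprime (X^ 1) P
    coprime-X = coprime-sym (coprime-∣ divides-Z (coprime-sym (X^ m , negP oneP , ≋-trans
      (⊕-cong (≋-trans (⊛-comm (X^ m) (X^ 1)) (≋-sym (X^-suc m))) (≋-refl {negP oneP ⊛ Z (n ℕ.+ n)}))
      (S.solve 1 (λ x → x S.:+ (S.:- S.:1) S.:* (x S.:- S.:1) S.:= S.:1) ≋-refl (X^ (n ℕ.+ n))))))
      where
      module S = IntegerSolver ℚ[q]
      m = h ℕ.+ h ℕ.+ n

    localInverses : LocalInverses K q inverses (Local P) h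
    localInverses = record
      { q⁻¹    = 1/ cancellable-X
      ; ε      = ε
      ; w      = 1/ c
      ; q*q⁻¹  = 1/-inverse cancellable-X
      ; 1+q*ε  = 1+q*ε
      ; 1-u*w  = trans (*-congʳ 1-u≈) (1/-inverse c)
      ; O-q    = Local-q
      ; O-q⁻¹  = ι-inverse cancellable-X coprime-X
      ; O-ε    = ι-inverse cancellable-1⊕X (coprime-resp (⊕-comm (X^ 1) oneP)
                   (coprime-∣ (Z 1 , ≋-trans (⊛-comm (Z 1) (X^ 1 ⊕ oneP)) (≋-sym (Z-double 1)))
                     (coprime-Z 1 (n∤small 1 ℕₚ.≤-refl (ℕ.s≤s (ℕ.s≤s ℕ.z≤n))))))
      ; O-fi   = Local-fi
      ; O-gi   = Local-gi
      ; O-gi′  = λ k h<k k≤ → ≡.subst (λ k → Local P ((1# - u) * gi k)) (ℕₚ.m+[n∸m]≡n h<k)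
                   (Local-gi′ (k ℕ.∸ suc h) (≡.subst (ℕ._≤ suc (h ℕ.+ h)) (≡.sym (ℕₚ.m+[n∸m]≡n h<k)) k≤))
      ; O-ci   = Local-ci
      }
      where
      c : Cancellable (oneP ⊖ X^ (n ℕ.+ n))
      c = cancellable-1⊖X^ (h ℕ.+ h ℕ.+ n)

    cofactor : Carrier
    cofactor = - ι (proj₁ divides-Z)

    Local-cofactor : Local P cofactor
    Local-cofactor = local-neg (local-ι _)

    1-u≈P*cofactor : 1# - u ≈ ι P * cofactor
    1-u≈P*cofactor = let r , rP≋Z = divides-Z in begin
      1# - u                              ≈⟨ 1-u≈ ⟩
      ι (oneP ⊖ X^ (n ℕ.+ n))             ≈⟨ ι-cong (Z-neg (n ℕ.+ n)) ⟨
      ι (negP (Z (n ℕ.+ n)))              ≈⟨ ι-neg _ ⟩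
      - ι (Z (n ℕ.+ n))                   ≈⟨ -‿cong (trans (ι-cong (≋-sym rP≋Z)) (ι-* r P)) ⟩
      - (ι r * ι P)                       ≈⟨ solve 2 (λ r p → :- (r :* p) := p :* (:- r)) refl (ι r) (ι P) ⟩
      ι P * - ι r                         ∎

    open SquareCongruence K q inverses (Local P) (subring P) h′ localInverses public using (square-congruence; module Cube)
    open LocalAnalysis K q inverses (Local P) (subring P) h localInverses public using (θ)

  coprime-^P : ∀ {a P} k → Coprime a P → Coprime a (P ^P k)
  coprime-^P {a} {P} k a⊥P = coprime-sym (power k)
    where
    power : ∀ k → Coprime (P ^P k) a
    power zero    = coprime-1
    power (suc k) = coprime-* (coprime-sym a⊥P) (power k)

  -- a₀ k is c_q(k), and R² is the right-hand side.
  a₀ : ℕ → Carrier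
  a₀ k = e k * s ^ k * (1# + q * X k) * ε * ((g k * fi k) * (g k * fi k))

  double-sum R : Carrier
  double-sum = sum (suc (h ℕ.+ h)) (λ k → diag (λ m k → a₀ k * a₀ m) k)
  R = sum (suc h) (λ k → ε * d h * (s ^ k * (g k * fi k)) * ((1# - u) * ci k))

  module SquareModulus (P : Poly) (isModulus : IsModulus n P) where
    open AtModulus P isModulus
    open Congruence._≡θ_ square-congruence

    square-divides : Σ Poly λ U → Σ Poly λ V → Coprime V (P ^P 2) × ((double-sum - R * R) * ι V ≈ ι ((P ^P 2) ⊛ U))
    square-divides = ∈-power {P = P} {Q = P ^P 2} (coprime-^P 2) (local-* (local-* Local-cofactor Local-cofactor) O-quotient) (begin
      double-sum - R * R
        ≈⟨ equation ⟩
      θ * quotient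
        ≈⟨ *-congʳ (*-cong 1-u≈P*cofactor 1-u≈P*cofactor) ⟩
      (ι P * cofactor) * (ι P * cofactor) * quotient
        ≈⟨ solve 3 (λ p y z → (p :* y) :* (p :* y) :* z := (p :* p) :* (y :* y :* z)) refl (ι P) cofactor quotient ⟩
      (ι P * ι P) * (cofactor * cofactor * quotient)
        ≈⟨ *-congʳ (ι-square P) ⟨
      ι (P ^P 2) * (cofactor * cofactor * quotient) ∎)

  module CubeModulus (P : Poly) (isModulus : IsModulus n P) (P∣X^n+1 : P ∣ᴿ X^ n ⊕ oneP) (Zn⊥P : Coprime (Z n) P) where
    open AtModulus P isModulus

    q^n≡-1 : Congruence._≡θ_ K (Local P) (subring P) (ι P) (q * s ^ h) (- 1#)
    q^n≡-1 = let r , rP≋ = P∣X^n+1 in Congruence.mod (ι r) (local-ι r) (begin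
      q * s ^ h - - 1#            ≈⟨ solve 1 (λ x → x :- :- :1 := x :+ :1) refl (q * s ^ h) ⟩
      q * s ^ h + 1#              ≈⟨ +-congʳ (*-congˡ (trans (s^≈q^ h) (^-congʳ q (≡.cong (h ℕ.+_) (ℕₚ.+-identityʳ h))))) ⟩
      q ^ n + 1#                  ≈⟨ trans (ι-+ (X^ n) oneP) (+-cong (ι-X^ n) ι-1) ⟨
      ι (X^ n ⊕ oneP)             ≈⟨ trans (ι-cong (≋-sym rP≋)) (ι-* r P) ⟩
      ι r * ι P                   ≈⟨ *-comm _ _ ⟩
      ι P * ι r                   ∎)

    -- When 4k + 1 = n the denominator is 1 - q^n, invertible by the assumed coprimality of Z n and
    -- P. That assumption holds at Φ_n(-q) and fails at Φ_n(q), a divisor of Z n.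
    Local-ci₀ : ∀ k → k ℕ.≤ h → Local P (ci k)
    Local-ci₀ k k≤h with n ∣? 4 ℕ.* k ℕ.+ 1
    ... | no  n∤m = Local-ci-coprime k n∤m
    ... | yes n∣m = ι-inverse (cancellable-1⊖X^4k+1 k) (coprime-1⊖X^ (4 ℕ.* k ℕ.+ 1)
      (≡.subst (λ m → Coprime (Z m) P) (≡.sym (∣⇒≡ (4 ℕ.* k ℕ.+ 1) (ℕₚ.m≤n+m 1 (4 ℕ.* k)) (4k+1<2n k k≤h) n∣m)) Zn⊥P))

    open Cube (ι P) cofactor 1-u≈P*cofactor (local-ι P) Local-cofactor Local-ci₀ q^n≡-1

    cube-divides : Σ Poly λ U → Σ Poly λ V → Coprime V (P ^P 3) × ((double-sum - R * R) * ι V ≈ ι ((P ^P 3) ⊛ U))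
    cube-divides = let z , Oz , e = cube-congruence in
      ∈-power {P = P} {Q = P ^P 3} (coprime-^P 3) Oz (trans e (*-congʳ (sym (trans (ι-* P (P ^P 2)) (*-congˡ (ι-square P))))))

  rep-lhs : Represents (lhs n) double-sum
  rep-lhs = rep-resp (sum-cong n λ k _ → sum-diag _ k)
    (rep-sumR n λ k → rep-sumR (suc k) λ j → rep-⊠ (rep-cq j) (rep-cq (k ℕ.∸ j)))

  inner : Carrier
  inner = sum (suc h) (λ k → (1# - q) * (s ^ k * (g k * fi k) * ci k))

  rep-innerSum : Represents (innerSum n) inner
  rep-innerSum = ≡.subst (λ m → Represents (sumR (suc m) summand) inner) (≡.sym half) (rep-sumR (suc h) rep-inner)
    where
    summand : ℕ → RatFun
    summand k = (qpoch 2 4 k ⊛ X^ (2 ℕ.* k)) // (qint 1 (4 ℕ.* k ℕ.+ 1) ⊛ qpoch 4 4 k)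
    half : (n ℕ.∸ 1) ℕ./ 2 ≡ h
    half = ≡.trans (≡.cong (ℕ._/ 2) (solveℕ 1 (λ h → h +ₙ h =ₙ h *ₙ conₙ 2) ≡.refl h)) (DivMod.m*n/n≡m h 2)

  N : Carrier
  N = ι (qint 2 n)

  N*[1-q] : N * (1# - q) ≈ ε * (1# - u)
  N*[1-q] = begin
    N * (1# - q)                              ≈⟨ *-identityʳ _ ⟨
    N * (1# - q) * 1#                         ≈⟨ *-congˡ 1+q*ε ⟨
    N * (1# - q) * ((1# + q) * ε)             ≈⟨ solve 3 (λ N q ε → N :* (:1 :- q) :* ((:1 :+ q) :* ε) := ε :* (N :* (:1 :- q :* (q :* :1)))) refl N q ε ⟩
    ε * (N * (1# - q ^ 2))                    ≈⟨ *-congˡ (ι-qint 2 n) ⟩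
    ε * (1# - q ^ (2 ℕ.* n))                  ≈⟨ *-congˡ (+-congˡ (-‿cong (trans u≈q^2n (^-congʳ q (≡.cong (n ℕ.+_) (≡.sym (ℕₚ.+-identityʳ n))))))) ⟨
    ε * (1# - u)                              ∎

  R≈ : R ≈ N * d h * inner
  R≈ = trans (scaled (λ k → ε * d h * (s ^ k * (g k * fi k)) * ((1# - u) * ci k)) (ε * (1# - u) * d h)
      (λ k → solve 5 (λ ε D w z c → ε :* D :* w :* (z :* c) := ε :* z :* D :* (w :* c)) refl ε (d h) (s ^ k * (g k * fi k)) (1# - u) (ci k)))
    (sym (trans (*-congˡ (scaled (λ k → (1# - q) * (s ^ k * (g k * fi k) * ci k)) (1# - q) λ k → refl))
      (trans (solve 4 (λ N D z w → N :* D :* (z :* w) := (N :* z) :* D :* w) refl N (d h) (1# - q) Σ′)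
        (*-congʳ (*-congʳ N*[1-q])))))
    where
    term : ℕ → Carrier
    term k = s ^ k * (g k * fi k) * ci k
    Σ′ : Carrier
    Σ′ = sum (suc h) term
    scaled : ∀ T c → (∀ k → T k ≈ c * term k) → sum (suc h) T ≈ c * Σ′
    scaled T c e = trans (sum-cong (suc h) λ k _ → e k) (trans (sym (diag-sum _ h))
      (trans (diag-scale c (λ _ k → term k) h) (*-congˡ (diag-sum term h))))

  rep-rhs : Represents (rhs n) (R * R)
  rep-rhs = rep-resp (begin
    ι ((qint 2 n ^P 2) ⊛ X^ j) * inner * inner
      ≈⟨ *-congʳ (*-congʳ (trans (ι-* (qint 2 n ^P 2) (X^ j)) (*-cong (ι-square (qint 2 n)) (trans (ι-X^ j) (sym (d²≈ h)))))) ⟩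
    ((N * N) * (d h * d h)) * inner * inner
      ≈⟨ solve 3 (λ N D i → ((N :* N) :* (D :* D)) :* i :* i := (N :* D :* i) :* (N :* D :* i)) refl N (d h) inner ⟩
    (N * d h * inner) * (N * d h * inner)
      ≈⟨ *-cong R≈ R≈ ⟨
    R * R ∎) (rep-⊠ (rep-⊠ (rep-polyR ((qint 2 n ^P 2) ⊛ X^ j)) rep-innerSum) rep-innerSum)
    where
    j : ℕ
    j = (n ℕ.∸ 1) ℕ.* (n ℕ.∸ 1)

  -- For abstract P and P′, so that the cyclotomic polynomials are seen only through these
  -- divisibility and coprimality facts; P is to be Φ_n(-q) and P′ is to be Φ_n(q).
  congruence : ∀ P P′ → IsModulus n P → P ∣ᴿ X^ n ⊕ oneP → Coprime (Z n) P → IsModulus n P′ → Coprime P P′ →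
    CongMod (lhs n) (rhs n) ((P ^P 3) ⊛ (P′ ^P 2))
  congruence P P′ isModulus P∣X^n+1 Zn⊥P isModulus′ P⊥P′ = congMod rep-lhs rep-rhs
    (combine (coprime-^P 2 (coprime-sym (coprime-^P 3 (coprime-sym P⊥P′))))
      (CubeModulus.cube-divides P isModulus P∣X^n+1 Zn⊥P) (SquareModulus.square-divides P′ isModulus′))

theorem1p1 : (n : ℕ) → 1 < n → n % 2 ≡ 1 → CongMod (lhs n) (rhs n) (modulus n)
theorem1p1 n 1<n n%2≡1 = odd (n ℕ./ 2) (≡.trans (DivMod.m≡m%n+[m/n]*n n 2)
    (≡.cong₂ ℕ._+_ n%2≡1 (solveℕ 1 (λ h → h *ₙ conₙ 2 =ₙ h +ₙ h) ≡.refl (n ℕ./ 2))))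
  where
  odd : ∀ h → n ≡ suc (h ℕ.+ h) → CongMod (lhs n) (rhs n) (modulus n)
  odd zero     ≡.refl = ⊥-elim (ℕₚ.<-irrefl ≡.refl 1<n)
  odd (suc h′) ≡.refl = Assembly.congruence (Fractions.fractionRing ℚ[q]) h′ Φ⁻ Φ⁺ isModulus⁻ Φ⁻∣X^n+1 Zn⊥Φ⁻ isModulus⁺ Φ⁻⊥Φ⁺
    where open Moduli (suc h′)
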